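{- If $P$ is deterministic, then for any density operators $\rho, \sigma$, probability $p$, and observer $R$, $p\cdot\overline{\langle\!\langle \rho, P, R \rangle\!\rangle} + (1-p)\cdot\overline{\langle\!\langle \sigma, P, R \rangle\!\rangle} \sim_{cs} \overline{\langle\!\langle p\rho + (1-p)\sigma, P, R \rangle\!\rangle}$.
   Context: lqCCS is a quantum process calculus with a linear type system. Observers $R$ are processes without $\tau$ and restriction whose sums are only sums of inputs on distinct channels. Extended configurations $\langle\!\langle \rho, P, R \rangle\!\rangle$ consist of a density operator, a process and an observer; $\bot$ is a deadlock configuration; $\overline{\mathcal{C}}$ is the point distribution on $\mathcal{C}$. Contexts are $O[\cdot] = [\cdot] \parallel R'$ with $R'$ an observer. The enhanced semantics has transitions $\rightsquigarrow_\pi$ indexed by $\pi = \diamond$ (only the process moves, by standard probabilistic reduction including superoperators and measurements) or $\pi \in \{\ell,r\}^*$ (naming the parallel component of the observer that acts), lifted to distributions so that all configurations in the support move with the same index. Constrained saturated bisimilarity $\sim_{cs}$ is the largest relation on equally typed distributions that, for every context $O[\cdot]$, preserves barbs (probability of being ready to output on each free channel, and probability of $\bot$) and matches $O[\Delta] \rightsquigarrow_\pi \Delta'$ by $O[\Theta] \rightsquigarrow_\pi \Theta'$ with related results, and symmetrically. A set $\mathcal{A}$ of distributions is deterministic if for every $\Delta \in \mathcal{A}$, every context $O[\cdot]$ and every $\pi$, whenever $O[\Delta] \rightsquigarrow_\pi \Delta'$ and $O[\Delta] \rightsquigarrow_\pi \Delta''$ then $\Delta' \sim_{cs} \Delta''$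 and $\Delta',\Delta'' \in \mathcal{A}$; a distribution is deterministic if it belongs to some deterministic set, and a process $P$ is deterministic if $\overline{\langle\!\langle \rho, P, \mathbf{0} \rangle\!\rangle}$ is deterministic for every $\rho$. -}

module Defs where

open import Level using (0ℓ)
open import Algebra.Bundles using (RawMonoid)
open import Algebra.Structures using (IsCommutativeRing)
import Algebra.Definitions.RawMonoid as RawMonoidSum
open import Data.Bool.Base using (Bool; true; false; not; _∨_; if_then_else_)
open import Data.Fin.Base using (Fin; zero; suc; toℕ; finToFun; funToFin)
import Data.Fin.Properties as Fin
open import Data.Fin.Subset using (Subset; inside; outside; _∈_; _∪_; _∩_; ⁅_⁆)
  renaming (⊥ to ∅)
open import Data.List.Base using (List; []; _∷_; _++_; map; concatMap; foldr; tabulate)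
open import Data.List.Membership.Propositional using () renaming (_∈_ to _∈ˡ_)
open import Data.List.Relation.Unary.All using (All)
open import Data.List.Relation.Unary.Unique.Propositional using (Unique)
open import Data.Nat.Base using (ℕ; _^_; _≤ᵇ_)
open import Data.Product.Base using (_×_; _,_; proj₁; proj₂; map₂; ∃-syntax)
open import Data.Sum.Base using (_⊎_)
open import Data.Vec.Base as Vec using (Vec; []; _∷_; lookup)
open import Data.Vec.Relation.Unary.Any using (any?)
open import Data.Vec.Membership.Propositional using () renaming (_∈_ to _∈ᵛ_)
open import Function.Base using (_∘_)
open import Function.Bundles using (_⇔_)
open import Relation.Binary.PropositionalEquality.Core using (_≡_; _≢_)
open import Relation.Binary.Structures using (IsTotalOrder)
open import Relation.Nullary.Decidable using (Dec; does; _⊎-dec_)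
open import Relation.Nullary.Negation.Core using (¬_)

-- A Dedekind-complete ordered field; classically this determines the real
-- numbers up to unique isomorphism.  The inverse is total, with 0 ⁻¹
-- unspecified.
record RealNumbers : Set₁ where
  infixl 6 _+_
  infixl 7 _*_
  infix  8 -_
  infix  9 _⁻¹
  infix  4 _≤_
  field
    ℝ                 : Set
    _+_ _*_           : ℝ → ℝ → ℝ
    -_ _⁻¹            : ℝ → ℝ
    0ℝ 1ℝ             : ℝ
    _≤_               : ℝ → ℝ → Set
    isCommutativeRing : IsCommutativeRing _≡_ _+_ _*_ -_ 0ℝ 1ℝ
    0≢1               : 0ℝ ≢ 1ℝ
    inverseʳ          : ∀ x → x ≢ 0ℝ → x * x ⁻¹ ≡ 1ℝ
    isTotalOrder      : IsTotalOrder _≡_ _≤_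
    +-monoˡ-≤         : ∀ z {x y} → x ≤ y → x + z ≤ y + z
    *-nonneg          : ∀ {x y} → 0ℝ ≤ x → 0ℝ ≤ y → 0ℝ ≤ x * y
    complete          : (S : ℝ → Set) → (∃[ x ] S x) →
                        (∃[ b ] (∀ x → S x → x ≤ b)) →
                        ∃[ s ] ((∀ x → S x → x ≤ s) ×
                                (∀ b → (∀ x → S x → x ≤ b) → s ≤ b))

module LqCCS (reals : RealNumbers) where
  open RealNumbers reals public

  record ℂ : Set where
    constructor _+i_
    field re im : ℝ
  open ℂ public

  infixl 6 _+ᶜ_
  infixl 7 _*ᶜ_

  _+ᶜ_ _*ᶜ_ : ℂ → ℂ → ℂ
  (a +i b) +ᶜ (c +i d) = (a + c) +i (b + d)
  (a +i b) *ᶜ (c +i d) = (a * c + - (b * d)) +i (a * d + b * c)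

  conj : ℂ → ℂ
  conj (a +i b) = a +i (- b)

  0ᶜ 1ᶜ : ℂ
  0ᶜ = 0ℝ +i 0ℝ
  1ᶜ = 1ℝ +i 0ℝ

  ℂ-+-rawMonoid : RawMonoid 0ℓ 0ℓ
  ℂ-+-rawMonoid = record { Carrier = ℂ ; _≈_ = _≡_ ; _∙_ = _+ᶜ_ ; ε = 0ᶜ }

  ∑ : ∀ {d} → (Fin d → ℂ) → ℂ
  ∑ = RawMonoidSum.sum ℂ-+-rawMonoid

  Matrix : ℕ → Set
  Matrix d = Vec (Vec ℂ d) d

  matrix : ∀ {d} → (Fin d → Fin d → ℂ) → Matrix d
  matrix f = Vec.tabulate λ i → Vec.tabulate (f i)

  entry : ∀ {d} → Matrix d → Fin d → Fin d → ℂ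
  entry A i j = lookup (lookup A i) j

  infixl 6 _+ᴹ_
  infixl 7 _·ᴹ_ _*ᴹ_
  infix  9 _†

  0ᴹ 1ᴹ : ∀ {d} → Matrix d
  0ᴹ = matrix λ _ _ → 0ᶜ
  1ᴹ = matrix λ i j → if does (i Fin.≟ j) then 1ᶜ else 0ᶜ

  _+ᴹ_ _*ᴹ_ : ∀ {d} → Matrix d → Matrix d → Matrix d
  A +ᴹ B = matrix λ i j → entry A i j +ᶜ entry B i j
  A *ᴹ B = matrix λ i k → ∑ λ j → entry A i j *ᶜ entry B j k

  _·ᴹ_ : ∀ {d} → ℝ → Matrix d → Matrix d
  x ·ᴹ A = matrix λ i j → (x +i 0ℝ) *ᶜ entry A i j

  _† : ∀ {d} → Matrix d → Matrix d
  A † = matrix λ i j → conj (entry A j i)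

  trace : ∀ {d} → Matrix d → ℂ
  trace A = ∑ λ i → entry A i i

  sumᴹ : ∀ {d} → List (Matrix d) → Matrix d
  sumᴹ = foldr _+ᴹ_ 0ᴹ

  ⟨_∣_∣_⟩ : ∀ {d} → Vec ℂ d → Matrix d → Vec ℂ d → ℂ
  ⟨ v ∣ A ∣ w ⟩ =
    ∑ λ i → ∑ λ j → conj (lookup v i) *ᶜ entry A i j *ᶜ lookup w j

  PositiveSemidefinite : ∀ {d} → Matrix d → Set
  PositiveSemidefinite A =
    ∀ v → im ⟨ v ∣ A ∣ v ⟩ ≡ 0ℝ × 0ℝ ≤ re ⟨ v ∣ A ∣ v ⟩

  IsDensity : ∀ {d} → Matrix d → Set
  IsDensity ρ = PositiveSemidefinite ρ × trace ρ ≡ 1ᶜ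

  -- Computational basis states of n qubits are indexed by Fin (2 ^ n);
  -- finToFun i q is the value of qubit q in basis state i.

  -- A on the qubits qs (in that order), tensored with the identity on all
  -- the other qubits.
  onQubits : ∀ {N k} → Vec (Fin N) k → Matrix (2 ^ k) → Matrix (2 ^ N)
  onQubits {N} {k} qs A = matrix λ i j →
    if does (agreeOutside? i j) then entry A (restrict i) (restrict j) else 0ᶜ
    where
    bits : Fin (2 ^ N) → Fin N → Fin 2
    bits = finToFun

    restrict : Fin (2 ^ N) → Fin (2 ^ k)
    restrict i = funToFin (bits i ∘ lookup qs)

    agreeOutside? : ∀ i j → Dec (∀ q → q ∈ᵛ qs ⊎ bits i q ≡ bits j q)
    agreeOutside? i j = Fin.all? λ q → any? (q Fin.≟_) qs ⊎-dec (bits i q Fin.≟ bits j q)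

  -- A trace-preserving superoperator on k qubits, given by Kraus operators.
  record SuperOp (k : ℕ) : Set where
    field
      kraus           : List (Matrix (2 ^ k))
      tracePreserving : sumᴹ (map (λ K → K † *ᴹ K) kraus) ≡ 1ᴹ
  open SuperOp public

  applyOp : ∀ {N k} → SuperOp k → Vec (Fin N) k → Matrix (2 ^ N) → Matrix (2 ^ N)
  applyOp E qs ρ =
    sumᴹ (map (λ K → onQubits qs K *ᴹ ρ *ᴹ onQubits qs K †) (kraus E))

  record Measurement (k : ℕ) : Set where
    field
      outcomes : ℕ
      operator : Vec (Matrix (2 ^ k)) outcomes
      complete : sumᴹ (map (λ M → M † *ᴹ M) (Vec.toList operator)) ≡ 1ᴹ
  open Measurement public using (outcomes; operator)

  module _ {N k} (𝕄 : Measurement k) (qs : Vec (Fin N) k) (ρ : Matrix (2 ^ N))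
           (m : Fin (outcomes 𝕄)) where
    private
      M : Matrix (2 ^ N)
      M = onQubits qs (lookup (operator 𝕄) m)

    probability : ℝ
    probability = re (trace (M *ᴹ ρ *ᴹ M †))

    -- Meaningful only when the outcome has nonzero probability.
    postState : Matrix (2 ^ N)
    postState = probability ⁻¹ ·ᴹ (M *ᴹ ρ *ᴹ M †)

  -- Formal finite combinations; repeated elements and zero weights are
  -- allowed, and _≋_ identifies the combinations denoting the same function.
  Weighted : Set → Set
  Weighted A = List (ℝ × A)

  sumᴿ : List ℝ → ℝ
  sumᴿ = foldr _+_ 0ℝ

  expectation : ∀ {A : Set} → (A → ℝ) → Weighted A → ℝ
  expectation f Δ = sumᴿ (map (λ (w , a) → w * f a) Δ)

  -- Taking indicator functions for f gives equality of the weights of every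
  -- single element.
  infix 4 _≋_
  _≋_ : ∀ {A : Set} → Weighted A → Weighted A → Set
  Δ ≋ Θ = ∀ f → expectation f Δ ≡ expectation f Θ

  IsDistribution : ∀ {A : Set} → Weighted A → Set
  IsDistribution Δ = All (λ (w , _) → 0ℝ ≤ w) Δ × sumᴿ (map proj₁ Δ) ≡ 1ℝ

  point : ∀ {A : Set} → A → Weighted A
  point a = (1ℝ , a) ∷ []

  mapᵂ : ∀ {A B : Set} → (A → B) → Weighted A → Weighted B
  mapᵂ f = map (map₂ f)

  scale : ∀ {A : Set} → ℝ → Weighted A → Weighted A
  scale p = map λ (w , a) → p * w , a

  -- Weight Q Δ p: the elements of Δ satisfying Q have total weight p.
  data Weight {A : Set} (Q : A → Set) : Weighted A → ℝ → Set where
    []  : Weight Q [] 0ℝ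
    yes : ∀ {w a Δ p} → Q a   → Weight Q Δ p → Weight Q ((w , a) ∷ Δ) (w + p)
    no  : ∀ {w a Δ p} → ¬ Q a → Weight Q Δ p → Weight Q ((w , a) ∷ Δ) p

  data Ty : Set where
    bool nat qubit : Ty

  -- Every channel carries values of one fixed type.
  record Chan : Set where
    constructor chan
    field
      type : Ty
      name : ℕ
  open Chan public

  -- Variables are de Bruijn indices.  Qubit names are the free variables of
  -- the processes occurring in configurations: a process in a configuration
  -- with N qubits is a Proc N, and its variable q is the q-th qubit.
  data Expr (m : ℕ) : Set where
    var  : Fin m → Expr m
    bool : Bool → Expr m
    nat  : ℕ → Expr m
    ¬ᵉ_  : Expr m → Expr m
    _∨ᵉ_ : Expr m → Expr m → Expr m
    _≤ᵉ_ : Expr m → Expr m → Expr m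

  infixl 5 _∥_
  infixl 6 _⊕_
  infix  7 _∖_

  mutual
    data Proc (m : ℕ) : Set where
      ⌊_⌋  : Sum m → Proc m
      _∥_  : Proc m → Proc m → Proc m
      _∖_  : Proc m → Chan → Proc m
      cond : Expr m → Proc m → Proc m → Proc m

    data Sum (m : ℕ) : Set where
      nil : List (Expr m) → Sum m   -- inert; discards the listed qubits
      τ∙_ : Proc m → Sum m
      op  : ∀ {k} → SuperOp k → Vec (Expr m) k → Proc m → Sum m
      mea : ∀ {k} → Measurement k → Vec (Expr m) k → Proc (ℕ.suc m) → Sum m
      inp : Chan → Proc (ℕ.suc m) → Sum m
      out : Chan → Expr m → Sum m
      _⊕_ : Sum m → Sum m → Sum m

  𝟎 : ∀ {m} → Proc m
  𝟎 = ⌊ nil [] ⌋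

  data InputSum {m} : Sum m → List Chan → Set where
    inp : ∀ {c R} → InputSum (inp c R) (c ∷ [])
    _⊕_ : ∀ {K L cs ds} → InputSum K cs → InputSum L ds →
          InputSum (K ⊕ L) (cs ++ ds)

  mutual
    data IsObserver {m} : Proc m → Set where
      nil  : ∀ {es} → IsObserver ⌊ nil es ⌋
      op   : ∀ {k} {E : SuperOp k} {es R} → IsObserver R → IsObserver ⌊ op E es R ⌋
      mea  : ∀ {k} {𝕄 : Measurement k} {es R} → IsObserver R →
             IsObserver ⌊ mea 𝕄 es R ⌋
      out  : ∀ {c e} → IsObserver ⌊ out c e ⌋
      sum  : ∀ {K cs} → InputSum K cs → Unique cs → ObserverBranches K →
             IsObserver ⌊ K ⌋
      _∥_  : ∀ {R S} → IsObserver R → IsObserver S → IsObserver (R ∥ S)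
      cond : ∀ {e R S} → IsObserver R → IsObserver S → IsObserver (cond e R S)

    data ObserverBranches {m} : Sum m → Set where
      inp : ∀ {c R} → IsObserver R → ObserverBranches (inp c R)
      _⊕_ : ∀ {K L} → ObserverBranches K → ObserverBranches L →
            ObserverBranches (K ⊕ L)

  Ctx : ℕ → Set
  Ctx = Vec Ty

  infix 3 _⊢ᵉ_∶_ _⨾_⊢_ _⨾_⊢ˢ_

  data _⊢ᵉ_∶_ {m} (Γ : Ctx m) : Expr m → Ty → Set where
    var  : ∀ {i T} → lookup Γ i ≡ T → Γ ⊢ᵉ var i ∶ T
    bool : ∀ {b} → Γ ⊢ᵉ bool b ∶ bool
    nat  : ∀ {n} → Γ ⊢ᵉ nat n ∶ nat
    ¬ᵉ_  : ∀ {e} → Γ ⊢ᵉ e ∶ bool → Γ ⊢ᵉ ¬ᵉ e ∶ bool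
    _∨ᵉ_ : ∀ {e f} → Γ ⊢ᵉ e ∶ bool → Γ ⊢ᵉ f ∶ bool → Γ ⊢ᵉ e ∨ᵉ f ∶ bool
    _≤ᵉ_ : ∀ {e f} → Γ ⊢ᵉ e ∶ nat → Γ ⊢ᵉ f ∶ nat → Γ ⊢ᵉ e ≤ᵉ f ∶ bool

  Qubits : ∀ {m} → Ctx m → Subset m → List (Fin m) → Set
  Qubits Γ Θ xs = Unique xs × All (λ x → x ∈ Θ × lookup Γ x ≡ qubit) xs

  -- The effect on the linear context of binding a variable of type T.
  linear : Ty → Bool
  linear qubit = inside
  linear _     = outside

  -- Γ ⨾ Θ ⊢ P: the qubits (names and variables) owned by P, each of which P
  -- must send or discard exactly once, are those in Θ.
  mutual
    data _⨾_⊢_ {m} (Γ : Ctx m) (Θ : Subset m) : Proc m → Set where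
      ⌊_⌋  : ∀ {K} → Γ ⨾ Θ ⊢ˢ K → Γ ⨾ Θ ⊢ ⌊ K ⌋
      par  : ∀ {P Q} Θ₁ Θ₂ → Θ ≡ Θ₁ ∪ Θ₂ → Θ₁ ∩ Θ₂ ≡ ∅ →
             Γ ⨾ Θ₁ ⊢ P → Γ ⨾ Θ₂ ⊢ Q → Γ ⨾ Θ ⊢ P ∥ Q
      _∖_  : ∀ {P} → Γ ⨾ Θ ⊢ P → ∀ c → Γ ⨾ Θ ⊢ P ∖ c
      cond : ∀ {e P Q} → Γ ⊢ᵉ e ∶ bool → Γ ⨾ Θ ⊢ P → Γ ⨾ Θ ⊢ Q →
             Γ ⨾ Θ ⊢ cond e P Q

    data _⨾_⊢ˢ_ {m} (Γ : Ctx m) (Θ : Subset m) : Sum m → Set where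
      nil  : ∀ {es} xs → es ≡ map var xs → Qubits Γ Θ xs →
             (∀ x → x ∈ Θ → x ∈ˡ xs) → Γ ⨾ Θ ⊢ˢ nil es
      τ∙_  : ∀ {P} → Γ ⨾ Θ ⊢ P → Γ ⨾ Θ ⊢ˢ τ∙ P
      op   : ∀ {k} {E : SuperOp k} {es P} xs → es ≡ Vec.map var xs →
             Qubits Γ Θ (Vec.toList xs) → Γ ⨾ Θ ⊢ P → Γ ⨾ Θ ⊢ˢ op E es P
      mea  : ∀ {k} {𝕄 : Measurement k} {es P} xs → es ≡ Vec.map var xs →
             Qubits Γ Θ (Vec.toList xs) → nat ∷ Γ ⨾ outside ∷ Θ ⊢ P →
             Γ ⨾ Θ ⊢ˢ mea 𝕄 es P
      inp  : ∀ {c P} → type c ∷ Γ ⨾ linear (type c) ∷ Θ ⊢ P → Γ ⨾ Θ ⊢ˢ inp c P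
      outᶜ : ∀ {c e} → type c ≢ qubit → Γ ⊢ᵉ e ∶ type c → Θ ≡ ∅ →
             Γ ⨾ Θ ⊢ˢ out c e
      outᑫ : ∀ {c x} → type c ≡ qubit → lookup Γ x ≡ qubit → Θ ≡ ⁅ x ⁆ →
             Γ ⨾ Θ ⊢ˢ out c (var x)
      _⊕_  : ∀ {K L} → Γ ⨾ Θ ⊢ˢ K → Γ ⨾ Θ ⊢ˢ L → Γ ⨾ Θ ⊢ˢ K ⊕ L

  infix 3 _⊩_
  _⊩_ : ∀ {N} → Subset N → Proc N → Set
  Θ ⊩ P = Vec.replicate _ qubit ⨾ Θ ⊢ P

  substᵉ : ∀ {m n} → (Fin m → Expr n) → Expr m → Expr n
  substᵉ σ (var i)  = σ i
  substᵉ σ (bool b) = bool b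
  substᵉ σ (nat n)  = nat n
  substᵉ σ (¬ᵉ e)   = ¬ᵉ substᵉ σ e
  substᵉ σ (e ∨ᵉ f) = substᵉ σ e ∨ᵉ substᵉ σ f
  substᵉ σ (e ≤ᵉ f) = substᵉ σ e ≤ᵉ substᵉ σ f

  lift : ∀ {m n} → (Fin m → Expr n) → Fin (ℕ.suc m) → Expr (ℕ.suc n)
  lift σ zero    = var zero
  lift σ (suc i) = substᵉ (λ j → var (suc j)) (σ i)

  mutual
    subst : ∀ {m n} → (Fin m → Expr n) → Proc m → Proc n
    subst σ ⌊ K ⌋        = ⌊ substˢ σ K ⌋
    subst σ (P ∥ Q)      = subst σ P ∥ subst σ Q
    subst σ (P ∖ c)      = subst σ P ∖ c
    subst σ (cond e P Q) = cond (substᵉ σ e) (subst σ P) (subst σ Q)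

    substˢ : ∀ {m n} → (Fin m → Expr n) → Sum m → Sum n
    substˢ σ (nil es)     = nil (map (substᵉ σ) es)
    substˢ σ (τ∙ P)       = τ∙ subst σ P
    substˢ σ (op E es P)  = op E (Vec.map (substᵉ σ) es) (subst σ P)
    substˢ σ (mea 𝕄 es P) = mea 𝕄 (Vec.map (substᵉ σ) es) (subst (lift σ) P)
    substˢ σ (inp c P)    = inp c (subst (lift σ) P)
    substˢ σ (out c e)    = out c (substᵉ σ e)
    substˢ σ (K ⊕ L)      = substˢ σ K ⊕ substˢ σ L

  data Val (N : ℕ) : Set where
    bool  : Bool → Val N
    nat   : ℕ → Val N
    qubit : Fin N → Val N

  expr : ∀ {N} → Val N → Expr N
  expr (bool b)  = bool b
  expr (nat n)   = nat n
  expr (qubit q) = var q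

  _[_] : ∀ {N} → Proc (ℕ.suc N) → Val N → Proc N
  _[_] {N} P v = subst σ P
    where
    σ : Fin (ℕ.suc N) → Expr N
    σ zero    = expr v
    σ (suc i) = var i

  infix 4 _⇓_ _—⟨_⟩→_ _⟶_

  data _⇓_ {N} : Expr N → Val N → Set where
    var  : ∀ {q} → var q ⇓ qubit q
    bool : ∀ {b} → bool b ⇓ bool b
    nat  : ∀ {n} → nat n ⇓ nat n
    ¬ᵉ_  : ∀ {e b} → e ⇓ bool b → ¬ᵉ e ⇓ bool (not b)
    _∨ᵉ_ : ∀ {e f b c} → e ⇓ bool b → f ⇓ bool c → e ∨ᵉ f ⇓ bool (b ∨ c)
    _≤ᵉ_ : ∀ {e f n m} → e ⇓ nat n → f ⇓ nat m → e ≤ᵉ f ⇓ bool (n ≤ᵇ m)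

  data Act (N : ℕ) : Set where
    _！_ _？_ : Chan → Val N → Act N

  subject : ∀ {N} → Act N → Chan
  subject (c ！ _) = c
  subject (c ？ _) = c

  -- Early-style labels, used only to define synchronisation and barbs.
  data _—⟨_⟩→_ {N} : Proc N → Act N → Proc N → Set where
    out   : ∀ {c e v} → e ⇓ v → ⌊ out c e ⌋ —⟨ c ！ v ⟩→ 𝟎
    inp   : ∀ {c P v} → ⌊ inp c P ⌋ —⟨ c ？ v ⟩→ P [ v ]
    sumˡ  : ∀ {K L a P} → ⌊ K ⌋ —⟨ a ⟩→ P → ⌊ K ⊕ L ⌋ —⟨ a ⟩→ P
    sumʳ  : ∀ {K L a P} → ⌊ L ⌋ —⟨ a ⟩→ P → ⌊ K ⊕ L ⌋ —⟨ a ⟩→ P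
    parˡ  : ∀ {P Q a P′} → P —⟨ a ⟩→ P′ → P ∥ Q —⟨ a ⟩→ P′ ∥ Q
    parʳ  : ∀ {P Q a Q′} → Q —⟨ a ⟩→ Q′ → P ∥ Q —⟨ a ⟩→ P ∥ Q′
    res   : ∀ {P c a P′} → P —⟨ a ⟩→ P′ → subject a ≢ c →
            P ∖ c —⟨ a ⟩→ P′ ∖ c
    true  : ∀ {e P Q a P′} → e ⇓ bool true → P —⟨ a ⟩→ P′ →
            cond e P Q —⟨ a ⟩→ P′
    false : ∀ {e P Q a Q′} → e ⇓ bool false → Q —⟨ a ⟩→ Q′ →
            cond e P Q —⟨ a ⟩→ Q′

  State : ℕ → Set
  State N = Matrix (2 ^ N)

  -- All outcomes are listed, impossible ones with weight zero.
  measure : ∀ {N k} {A : Set} → Measurement k → Vec (Fin N) k → State N →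
            (ℕ → A) → Weighted (State N × A)
  measure 𝕄 qs ρ f = tabulate λ m →
    probability 𝕄 qs ρ m , postState 𝕄 qs ρ m , f (toℕ m)

  data _⟶_ {N} : State N × Proc N → Weighted (State N × Proc N) → Set where
    τ∙    : ∀ {ρ P} → (ρ , ⌊ τ∙ P ⌋) ⟶ point (ρ , P)
    op    : ∀ {ρ k} {E : SuperOp k} {es P} qs → es ≡ Vec.map var qs →
            (ρ , ⌊ op E es P ⌋) ⟶ point (applyOp E qs ρ , P)
    mea   : ∀ {ρ k} {𝕄 : Measurement k} {es P} qs → es ≡ Vec.map var qs →
            (ρ , ⌊ mea 𝕄 es P ⌋) ⟶ measure 𝕄 qs ρ (λ m → P [ nat m ])
    sumˡ  : ∀ {ρ K L Δ} → (ρ , ⌊ K ⌋) ⟶ Δ → (ρ , ⌊ K ⊕ L ⌋) ⟶ Δ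
    sumʳ  : ∀ {ρ K L Δ} → (ρ , ⌊ L ⌋) ⟶ Δ → (ρ , ⌊ K ⊕ L ⌋) ⟶ Δ
    comˡ  : ∀ {ρ P Q c v P′ Q′} → P —⟨ c ！ v ⟩→ P′ → Q —⟨ c ？ v ⟩→ Q′ →
            (ρ , P ∥ Q) ⟶ point (ρ , P′ ∥ Q′)
    comʳ  : ∀ {ρ P Q c v P′ Q′} → P —⟨ c ？ v ⟩→ P′ → Q —⟨ c ！ v ⟩→ Q′ →
            (ρ , P ∥ Q) ⟶ point (ρ , P′ ∥ Q′)
    parˡ  : ∀ {ρ P Q Δ} → (ρ , P) ⟶ Δ → (ρ , P ∥ Q) ⟶ mapᵂ (map₂ (_∥ Q)) Δ
    parʳ  : ∀ {ρ P Q Δ} → (ρ , Q) ⟶ Δ → (ρ , P ∥ Q) ⟶ mapᵂ (map₂ (P ∥_)) Δ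
    res   : ∀ {ρ P c Δ} → (ρ , P) ⟶ Δ → (ρ , P ∖ c) ⟶ mapᵂ (map₂ (_∖ c)) Δ
    true  : ∀ {ρ e P Q Δ} → e ⇓ bool true → (ρ , P) ⟶ Δ → (ρ , cond e P Q) ⟶ Δ
    false : ∀ {ρ e P Q Δ} → e ⇓ bool false → (ρ , Q) ⟶ Δ → (ρ , cond e P Q) ⟶ Δ

  data Conf (N : ℕ) : Set where
    ⟪_,_,_⟫ : State N → Proc N → Proc N → Conf N
    ⊥       : Conf N

  Dist : ℕ → Set
  Dist N = Weighted (Conf N)

  -- The context [·] ∥ R.
  plug : ∀ {N} → Proc N → Conf N → Conf N
  plug R ⟪ ρ , P , S ⟫ = ⟪ ρ , P , S ∥ R ⟫
  plug R ⊥             = ⊥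

  plugʳ : ∀ {N} → Proc N → Conf N → Conf N
  plugʳ R ⟪ ρ , P , S ⟫ = ⟪ ρ , P , R ∥ S ⟫
  plugʳ R ⊥             = ⊥

  infix 7 _‖_
  _‖_ : ∀ {N} → Dist N → Proc N → Dist N
  Δ ‖ R = mapᵂ (plug R) Δ

  data Side : Set where
    ℓ r : Side

  data Index : Set where
    ◇  : Index
    at : List Side → Index

  infix 4 _↝[_]_ _⇝[_]_ _⟿[_]_

  -- The index ◇ means that the process moves alone.  With index at π, the
  -- component of the observer at position π in its tree of parallel
  -- compositions acts, on the quantum state or by communicating with the
  -- process; components of the observer do not communicate with each other.
  data _↝[_]_ {N} : Conf N → Index → Dist N → Set where
    proc  : ∀ {ρ P R Δ} → (ρ , P) ⟶ Δ →
            ⟪ ρ , P , R ⟫ ↝[ ◇ ] mapᵂ (λ (ρ′ , P′) → ⟪ ρ′ , P′ , R ⟫) Δ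
    op    : ∀ {ρ P k} {E : SuperOp k} {es R} qs → es ≡ Vec.map var qs →
            ⟪ ρ , P , ⌊ op E es R ⌋ ⟫ ↝[ at [] ] point ⟪ applyOp E qs ρ , P , R ⟫
    mea   : ∀ {ρ P k} {𝕄 : Measurement k} {es R} qs → es ≡ Vec.map var qs →
            ⟪ ρ , P , ⌊ mea 𝕄 es R ⌋ ⟫ ↝[ at [] ]
              mapᵂ (λ (ρ′ , R′) → ⟪ ρ′ , P , R′ ⟫)
                   (measure 𝕄 qs ρ (λ m → R [ nat m ]))
    send  : ∀ {ρ P P′ K c v R′} → ⌊ K ⌋ —⟨ c ！ v ⟩→ R′ → P —⟨ c ？ v ⟩→ P′ →
            ⟪ ρ , P , ⌊ K ⌋ ⟫ ↝[ at [] ] point ⟪ ρ , P′ , R′ ⟫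
    recv  : ∀ {ρ P P′ K c v R′} → ⌊ K ⌋ —⟨ c ？ v ⟩→ R′ → P —⟨ c ！ v ⟩→ P′ →
            ⟪ ρ , P , ⌊ K ⌋ ⟫ ↝[ at [] ] point ⟪ ρ , P′ , R′ ⟫
    parˡ  : ∀ {ρ P R S π Δ} → ⟪ ρ , P , R ⟫ ↝[ at π ] Δ →
            ⟪ ρ , P , R ∥ S ⟫ ↝[ at (ℓ ∷ π) ] mapᵂ (plug S) Δ
    parʳ  : ∀ {ρ P R S π Δ} → ⟪ ρ , P , S ⟫ ↝[ at π ] Δ →
            ⟪ ρ , P , R ∥ S ⟫ ↝[ at (r ∷ π) ] mapᵂ (plugʳ R) Δ
    true  : ∀ {ρ P e R S π Δ} → e ⇓ bool true → ⟪ ρ , P , R ⟫ ↝[ at π ] Δ →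
            ⟪ ρ , P , cond e R S ⟫ ↝[ at π ] Δ
    false : ∀ {ρ P e R S π Δ} → e ⇓ bool false → ⟪ ρ , P , S ⟫ ↝[ at π ] Δ →
            ⟪ ρ , P , cond e R S ⟫ ↝[ at π ] Δ

  -- With this completion every configuration can move with every index, so
  -- that the lifting below is defined on all distributions; ⊥ moves to ⊥.
  data _⇝[_]_ {N} (C : Conf N) (π : Index) : Dist N → Set where
    move     : ∀ {Δ} → C ↝[ π ] Δ → C ⇝[ π ] Δ
    deadlock : (∀ Δ → ¬ C ↝[ π ] Δ) → C ⇝[ π ] point ⊥

  -- Lifting to distributions: Δ = Σᵢ wᵢ Cᵢ and Θ = Σᵢ wᵢ Ξᵢ with Cᵢ ⇝[ π ] Ξᵢ.
  record _⟿[_]_ {N} (Δ : Dist N) (π : Index) (Θ : Dist N) : Set where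
    field
      parts          : List (ℝ × Conf N × Dist N)
      nonneg         : All (λ (w , _ , _) → 0ℝ ≤ w) parts
      moves          : All (λ (_ , C , Ξ) → C ⇝[ π ] Ξ) parts
      source         : Δ ≋ map (λ (w , C , _) → w , C) parts
      isDistribution : IsDistribution Θ
      target         : Θ ≋ concatMap (λ (w , _ , Ξ) → scale w Ξ) parts

  infix 3 _⊢ᶜ_ _⊢ᵈ_

  -- The type of a configuration is the set of qubits owned jointly by the
  -- process and the observer; ⊥ has every type.
  data _⊢ᶜ_ {N} (Θ : Subset N) : Conf N → Set where
    conf : ∀ {ρ P R} Θ₁ Θ₂ → Θ ≡ Θ₁ ∪ Θ₂ → Θ₁ ∩ Θ₂ ≡ ∅ → IsDensity ρ →
           Θ₁ ⊩ P → Θ₂ ⊩ R → IsObserver R → Θ ⊢ᶜ ⟪ ρ , P , R ⟫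
    ⊥    : Θ ⊢ᶜ ⊥

  _⊢ᵈ_ : ∀ {N} → Subset N → Dist N → Set
  Θ ⊢ᵈ Δ = IsDistribution Δ × All (λ (w , C) → w ≢ 0ℝ → Θ ⊢ᶜ C) Δ

  -- Observers R for which [·] ∥ R accepts distributions of type Θ and yields
  -- distributions of type Θ ∪ Θ′.
  record Context {N} (Θ Θ′ : Subset N) (R : Proc N) : Set where
    field
      isObserver : IsObserver R
      typed      : Θ′ ⊩ R
      disjoint   : Θ ∩ Θ′ ≡ ∅

  infix 4 _↓_

  _↓_ : ∀ {N} → Proc N → Chan → Set
  P ↓ c = ∃[ v ] ∃[ P′ ] P —⟨ c ！ v ⟩→ P′

  data Barb {N} (c : Chan) : Conf N → Set where
    process  : ∀ {ρ P R} → P ↓ c → Barb c ⟪ ρ , P , R ⟫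
    observer : ∀ {ρ P R} → R ↓ c → Barb c ⟪ ρ , P , R ⟫

  SameBarbs : ∀ {N} → Dist N → Dist N → Set
  SameBarbs Δ Θ =
    (∀ c p → Weight (Barb c) Δ p ⇔ Weight (Barb c) Θ p) ×
    (∀ p → Weight (_≡ ⊥) Δ p ⇔ Weight (_≡ ⊥) Θ p)

  TypedRel : ℕ → Set₁
  TypedRel N = Subset N → Dist N → Dist N → Set

  record IsBisimulation {N} (ℛ : TypedRel N) : Set where
    field
      typed : ∀ {Θ Δ₁ Δ₂} → ℛ Θ Δ₁ Δ₂ → Θ ⊢ᵈ Δ₁ × Θ ⊢ᵈ Δ₂
      barbs : ∀ {Θ Δ₁ Δ₂} → ℛ Θ Δ₁ Δ₂ → ∀ Θ′ R → Context Θ Θ′ R →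
              SameBarbs (Δ₁ ‖ R) (Δ₂ ‖ R)
      forth : ∀ {Θ Δ₁ Δ₂} → ℛ Θ Δ₁ Δ₂ → ∀ Θ′ R → Context Θ Θ′ R →
              ∀ π Δ₁′ → Δ₁ ‖ R ⟿[ π ] Δ₁′ →
              ∃[ Δ₂′ ] (Δ₂ ‖ R ⟿[ π ] Δ₂′ × ℛ (Θ ∪ Θ′) Δ₁′ Δ₂′)
      back  : ∀ {Θ Δ₁ Δ₂} → ℛ Θ Δ₁ Δ₂ → ∀ Θ′ R → Context Θ Θ′ R →
              ∀ π Δ₂′ → Δ₂ ‖ R ⟿[ π ] Δ₂′ →
              ∃[ Δ₁′ ] (Δ₁ ‖ R ⟿[ π ] Δ₁′ × ℛ (Θ ∪ Θ′) Δ₁′ Δ₂′)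

  infix 4 _∼cs[_]_

  -- The largest bisimulation, as the union of all of them.
  _∼cs[_]_ : ∀ {N} → Dist N → Subset N → Dist N → Set₁
  _∼cs[_]_ {N} Δ₁ Θ Δ₂ = ∃[ ℛ ] (IsBisimulation {N} ℛ × ℛ Θ Δ₁ Δ₂)

  record IsDeterministicSet {N} (𝒜 : Subset N → Dist N → Set) : Set₁ where
    field
      typed         : ∀ {Θ Δ} → 𝒜 Θ Δ → Θ ⊢ᵈ Δ
      deterministic : ∀ {Θ Δ} → 𝒜 Θ Δ → ∀ Θ′ R → Context Θ Θ′ R →
                      ∀ π Δ′ Δ″ → Δ ‖ R ⟿[ π ] Δ′ → Δ ‖ R ⟿[ π ] Δ″ →
                      Δ′ ∼cs[ Θ ∪ Θ′ ] Δ″ × 𝒜 (Θ ∪ Θ′) Δ′ × 𝒜 (Θ ∪ Θ′) Δ″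

  DeterministicDist : ∀ {N} → Subset N → Dist N → Set₁
  DeterministicDist Θ Δ = ∃[ 𝒜 ] (IsDeterministicSet 𝒜 × 𝒜 Θ Δ)

  Deterministic : ∀ {N} → Subset N → Proc N → Set₁
  Deterministic Θ P =
    ∀ ρ → IsDensity ρ → DeterministicDist Θ (point ⟪ ρ , P , 𝟎 ⟫)

  mix : ∀ {A : Set} → ℝ → Weighted A → Weighted A → Weighted A
  mix p Δ Θ = scale p Δ ++ scale (1ℝ + - p) Θ

{-# OPTIONS --safe #-}

-- Because no transition rule inspects the quantum state, a transition of a
-- configuration comes with a family of transitions from all states, and each of
-- its branches acts linearly on unnormalised states (a measurement outcome of
-- probability zero yields the zero matrix, as a positive semidefinite matrix of
-- trace zero vanishes).  Hence if ρ, σ and p ρ + (1 - p) σ resolve all choices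
-- alike, the two sides of the statement evolve into distributions with the same
-- weights, barbs and terms, whose states remain in convex combination.
-- Determinism of P makes any other resolution of the choices bisimilar to this
-- one, and bisimilarity is closed under convex combinations since a transition of
-- a mixture splits into transitions of its components.  This gives the claim for
-- the observer 𝟎; an arbitrary observer R is reached by the context [·] ∥ R, and
-- the resulting observer 𝟎 ∥ R behaves like R up to a renaming of the indices.

module Submission where

open import Level using (0ℓ; suc)
open import Axiom.ExcludedMiddle using (ExcludedMiddle)
open import Data.Fin.Subset using (Subset; _∪_; _∩_) renaming (⊥ to ∅)
open import Data.Nat.Base using (ℕ)
open import Relation.Binary.PropositionalEquality.Core using (_≡_)
open import Defs

open import Algebra.Bundles using (CommutativeRing)
open import Algebra.Solver.Ring.AlmostCommutativeRing using (_-Raw-AlmostCommutative⟶_; Induced-equivalence; fromCommutativeRing)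
open import Algebra.Structures using (IsCommutativeRing)
open import Data.Bool.Base using (Bool; true; false; if_then_else_)
open import Data.Fin.Base as Fin using (Fin; finToFun; funToFin)
import Data.Fin.Properties as Finₚ
import Data.Fin.Subset.Properties as Subsetₚ
open import Data.Integer.Base as ℤ using (ℤ)
import Data.Integer.Properties as ℤₚ
open import Data.List.Base as List using (List; []; _∷_; _++_; map; concatMap)
open import Data.List.Membership.Propositional using () renaming (_∈_ to _∈ˡ_)
import Data.List.Properties as Listₚ
open import Data.List.Relation.Unary.All as All using (All; []; _∷_)
import Data.List.Relation.Unary.All.Properties as Allₚ
open import Data.List.Relation.Unary.AllPairs using ([]; _∷_)
open import Data.List.Relation.Unary.Unique.Propositional using (Unique)
open import Data.Maybe.Base as Maybe using (Maybe; just; nothing)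
import Data.Nat.Base as ℕ
import Data.Nat.Properties as ℕₚ
open import Data.Product.Base using (_×_; _,_; proj₁; proj₂; map₂; swap; ∃-syntax)
open import Data.Sum.Base as Sum using (_⊎_; inj₁; inj₂; [_,_]′)
open import Data.Unit.Base using (⊤; tt)
open import Data.Vec.Base as Vec using (Vec; []; _∷_; lookup)
open import Data.Vec.Membership.Propositional using () renaming (_∈_ to _∈ᵛ_)
open import Data.Vec.Membership.Propositional.Properties using (∈-lookup)
import Data.Vec.Properties as Vecₚ
open import Data.Vec.Relation.Unary.Any as Any using (any?)
import Data.Vec.Relation.Unary.Any.Properties as Anyₚ
open import Function.Base using (_∘_; id)
open import Function.Bundles using (_⇔_; mk⇔; Equivalence)
open import Function.Properties.Equivalence using () renaming (sym to ⇔-sym; trans to ⇔-trans)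
open import Relation.Binary.Definitions using (WeaklyDecidable)
open import Relation.Binary.PropositionalEquality as ≡ using (_≢_; refl; sym; trans; cong; cong₂; module ≡-Reasoning)
open import Relation.Binary.Structures using (IsTotalOrder)
open import Relation.Nullary.Decidable using (Dec; yes; no; does; dec⇒maybe; map′; True; toWitness; fromWitness; does-⇔; dec-true; dec-false; _⊎-dec_)
open import Relation.Nullary.Negation using (¬_; contradiction)

-- Three features of the definitions shape the development. A lifted transition decomposes its
-- source only up to `≋`, so one part of a transition of a mixture may draw on both components at
-- once; it is divided between them in proportion to the mass that each gives to its source
-- configuration. The states after a measurement are normalised by probabilities that differ between
-- ρ, σ and their mixture, so the invariant cannot speak of the states themselves: it relates
-- weighted states, a s + b t = c u, and entries of weight zero are exempt from all conditions on
-- states and types. Finally, each round of the bisimulation game plugs a new context outside the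
-- old observer, so the extra `𝟎` in front of R sinks one level per round, and the comparison with
-- the unpadded observer has to keep track of that depth. Excluded middle decides whether a weight
-- vanishes and whether a configuration can move, and it brings bisimilarity down to `Set`, where
-- relations have to live.

-- With integer coefficients, whose equality is decidable, the solver also
-- recognises terms that cancel.
module IntegerSolver (R : CommutativeRing 0ℓ 0ℓ) where
  open CommutativeRing R hiding (refl; sym; trans)
  open CommutativeRing R using () renaming (refl to ≈-refl; sym to ≈-sym; trans to ≈-trans)
  open import Algebra.Properties.Ring ring using (-‿distribˡ-*; -‿distribʳ-*; -0#≈0#; -‿involutive; -‿+-comm)
  open import Algebra.Properties.Semiring.Mult.TCOptimised semiring using (1+×; ×-homo-+; ×1-homo-*) renaming (_×_ to infixr 8 _·_)
  open import Relation.Binary.Reasoning.Setoid setoid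

  private
    -- With these multiples the integers 0 and 1 evaluate to `0#` and `1#` definitionally, so solver
    -- equations can mention the constants of the ring.
    ⟦_⟧ : ℤ → Carrier
    ⟦ ℤ.+ n ⟧      = n · 1#
    ⟦ ℤ.-[1+ n ] ⟧ = - (ℕ.suc n · 1#)

    ⟦⊖⟧ : ∀ m n → ⟦ m ℤ.⊖ n ⟧ ≈ m · 1# + - (n · 1#)
    ⟦⊖⟧ m         ℕ.zero    = ≈-sym (≈-trans (+-congˡ -0#≈0#) (+-identityʳ _))
    ⟦⊖⟧ ℕ.zero    (ℕ.suc n) = ≈-sym (+-identityˡ _)
    ⟦⊖⟧ (ℕ.suc m) (ℕ.suc n) = begin
      ⟦ ℕ.suc m ℤ.⊖ ℕ.suc n ⟧                 ≡⟨ ≡.cong ⟦_⟧ (ℤₚ.[1+m]⊖[1+n]≡m⊖n m n) ⟩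
      ⟦ m ℤ.⊖ n ⟧                             ≈⟨ ⟦⊖⟧ m n ⟩
      x + - y                                 ≈⟨ +-identityˡ _ ⟨
      0# + (x + - y)                          ≈⟨ +-congʳ (-‿inverseʳ 1#) ⟨
      (1# + - 1#) + (x + - y)                 ≈⟨ +-assoc _ _ _ ⟩
      1# + (- 1# + (x + - y))                 ≈⟨ +-congˡ (+-assoc _ _ _) ⟨
      1# + ((- 1# + x) + - y)                 ≈⟨ +-congˡ (+-congʳ (+-comm _ _)) ⟩
      1# + ((x + - 1#) + - y)                 ≈⟨ +-congˡ (+-assoc _ _ _) ⟩
      1# + (x + (- 1# + - y))                 ≈⟨ +-assoc _ _ _ ⟨
      (1# + x) + (- 1# + - y)                 ≈⟨ +-congˡ (-‿+-comm _ _) ⟩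
      (1# + x) + - (1# + y)                   ≈⟨ +-cong (1+× m 1#) (-‿cong (1+× n 1#)) ⟨
      ℕ.suc m · 1# + - (ℕ.suc n · 1#)         ∎
      where
      x = m · 1#
      y = n · 1#

    ⟦+⟧ : ∀ i j → ⟦ i ℤ.+ j ⟧ ≈ ⟦ i ⟧ + ⟦ j ⟧
    ⟦+⟧ (ℤ.+ m)      (ℤ.+ n)      = ×-homo-+ 1# m n
    ⟦+⟧ (ℤ.+ m)      ℤ.-[1+ n ]   = ⟦⊖⟧ m (ℕ.suc n)
    ⟦+⟧ ℤ.-[1+ m ]   (ℤ.+ n)      = ≈-trans (⟦⊖⟧ n (ℕ.suc m)) (+-comm _ _)
    ⟦+⟧ ℤ.-[1+ m ]   ℤ.-[1+ n ]   = begin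
      - ((2 ℕ.+ (m ℕ.+ n)) · 1#)              ≡⟨ ≡.cong (λ k → - (ℕ.suc k · 1#)) (≡.sym (ℕₚ.+-suc m n)) ⟩
      - ((ℕ.suc m ℕ.+ ℕ.suc n) · 1#)          ≈⟨ -‿cong (×-homo-+ 1# (ℕ.suc m) (ℕ.suc n)) ⟩
      - (ℕ.suc m · 1# + ℕ.suc n · 1#)         ≈⟨ -‿+-comm _ _ ⟨
      - (ℕ.suc m · 1#) + - (ℕ.suc n · 1#)     ∎

    ⟦-⟧ : ∀ i → ⟦ ℤ.- i ⟧ ≈ - ⟦ i ⟧
    ⟦-⟧ (ℤ.+ ℕ.zero)    = ≈-sym -0#≈0#
    ⟦-⟧ (ℤ.+ (ℕ.suc n)) = ≈-refl
    ⟦-⟧ ℤ.-[1+ n ]      = ≈-sym (-‿involutive _)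

    ⟦+*⟧ : ∀ m j → ⟦ ℤ.+ m ℤ.* j ⟧ ≈ ⟦ ℤ.+ m ⟧ * ⟦ j ⟧
    ⟦+*⟧ m (ℤ.+ n)    = ≈-trans (reflexive (≡.cong ⟦_⟧ (≡.sym (ℤₚ.pos-* m n)))) (×1-homo-* m n)
    ⟦+*⟧ m ℤ.-[1+ n ] = begin
      ⟦ ℤ.+ m ℤ.* ℤ.-[1+ n ] ⟧          ≡⟨ ≡.cong ⟦_⟧ (ℤₚ.neg-distribʳ-* (ℤ.+ m) (ℤ.+ ℕ.suc n)) ⟨
      ⟦ ℤ.- (ℤ.+ m ℤ.* ℤ.+ ℕ.suc n) ⟧   ≈⟨ ⟦-⟧ (ℤ.+ m ℤ.* ℤ.+ ℕ.suc n) ⟩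
      - ⟦ ℤ.+ m ℤ.* ℤ.+ ℕ.suc n ⟧       ≈⟨ -‿cong (⟦+*⟧ m (ℤ.+ ℕ.suc n)) ⟩
      - (⟦ ℤ.+ m ⟧ * ⟦ ℤ.+ ℕ.suc n ⟧)   ≈⟨ -‿distribʳ-* _ _ ⟩
      ⟦ ℤ.+ m ⟧ * ⟦ ℤ.-[1+ n ] ⟧        ∎

    ⟦*⟧ : ∀ i j → ⟦ i ℤ.* j ⟧ ≈ ⟦ i ⟧ * ⟦ j ⟧
    ⟦*⟧ (ℤ.+ m)    j = ⟦+*⟧ m j
    ⟦*⟧ ℤ.-[1+ m ] j = begin
      ⟦ ℤ.-[1+ m ] ℤ.* j ⟧          ≡⟨ ≡.cong ⟦_⟧ (ℤₚ.neg-distribˡ-* (ℤ.+ ℕ.suc m) j) ⟨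
      ⟦ ℤ.- (ℤ.+ ℕ.suc m ℤ.* j) ⟧   ≈⟨ ⟦-⟧ (ℤ.+ ℕ.suc m ℤ.* j) ⟩
      - ⟦ ℤ.+ ℕ.suc m ℤ.* j ⟧       ≈⟨ -‿cong (⟦+*⟧ (ℕ.suc m) j) ⟩
      - (⟦ ℤ.+ ℕ.suc m ⟧ * ⟦ j ⟧)   ≈⟨ -‿distribˡ-* _ _ ⟩
      ⟦ ℤ.-[1+ m ] ⟧ * ⟦ j ⟧        ∎

    morphism : ℤ.+-*-rawRing -Raw-AlmostCommutative⟶ fromCommutativeRing R
    morphism = record
      { ⟦_⟧ = ⟦_⟧ ; +-homo = ⟦+⟧ ; *-homo = ⟦*⟧ ; -‿homo = ⟦-⟧ ; 0-homo = ≈-refl ; 1-homo = ≈-refl }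

    _coeff≟_ : WeaklyDecidable (Induced-equivalence morphism)
    i coeff≟ j = Maybe.map (λ i≡j → reflexive (≡.cong ⟦_⟧ i≡j)) (dec⇒maybe (i ℤₚ.≟ j))

  open import Algebra.Solver.Ring ℤ.+-*-rawRing (fromCommutativeRing R) morphism _coeff≟_ public

-- Basis states and their restriction to selected qubits

funToFin-cong : ∀ {m n} {f g : Fin m → Fin n} → (∀ i → f i ≡ g i) → funToFin f ≡ funToFin g
funToFin-cong {ℕ.zero}  f≗g = refl
funToFin-cong {ℕ.suc m} f≗g = cong₂ Fin.combine (f≗g Fin.zero) (funToFin-cong (f≗g ∘ Fin.suc))

finToFun-injective : ∀ {m n} {i j : Fin (n ℕ.^ m)} → (∀ q → finToFun {n} {m} i q ≡ finToFun j q) → i ≡ j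
finToFun-injective {m} {n} {i} {j} eq =
  trans (sym (Finₚ.funToFin-finToFin {m} {n} i)) (trans (funToFin-cong eq) (Finₚ.funToFin-finToFin {m} {n} j))

-- The local functions of `onQubits` are repeated with the same bodies, so that its entries are
-- convertible with expressions in the functions below.
module Embedding {N k : ℕ} (qs : Vec (Fin N) k) where
  bits : Fin (2 ℕ.^ N) → Fin N → Fin 2
  bits = finToFun

  restrict : Fin (2 ℕ.^ N) → Fin (2 ℕ.^ k)
  restrict i = funToFin (bits i ∘ lookup qs)

  Agree : Fin (2 ℕ.^ N) → Fin (2 ℕ.^ N) → Set
  Agree i j = ∀ q → q ∈ᵛ qs ⊎ bits i q ≡ bits j q

  agree? : ∀ i j → Dec (Agree i j)
  agree? i j = Finₚ.all? λ q → any? (q Finₚ.≟_) qs ⊎-dec (bits i q Finₚ.≟ bits j q)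

  agree-refl : ∀ i → Agree i i
  agree-refl i q = inj₂ refl

  agree-sym : ∀ {i j} → Agree i j → Agree j i
  agree-sym ag q = Sum.map₂ sym (ag q)

  agree-trans : ∀ {i j l} → Agree i j → Agree j l → Agree i l
  agree-trans ag ag′ q with ag q | ag′ q
  ... | inj₁ q∈ | _       = inj₁ q∈
  ... | inj₂ _  | inj₁ q∈ = inj₁ q∈
  ... | inj₂ eq | inj₂ eq′ = inj₂ (trans eq eq′)

  -- Together with `restrict`, overwriting the bits at `qs` identifies the states that agree with i
  -- elsewhere with the basis states of k qubits; this is how sums over the former become sums over
  -- the latter.
  mergeBits : Fin (2 ℕ.^ N) → Fin (2 ℕ.^ k) → Fin N → Fin 2
  mergeBits i b q with any? (q Finₚ.≟_) qs
  ... | yes q∈ = finToFun b (Any.index q∈)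
  ... | no  _  = bits i q

  merge : Fin (2 ℕ.^ N) → Fin (2 ℕ.^ k) → Fin (2 ℕ.^ N)
  merge i b = funToFin (mergeBits i b)

  bits-merge : ∀ i b q → bits (merge i b) q ≡ mergeBits i b q
  bits-merge i b = Finₚ.finToFun-funToFin (mergeBits i b)

  bits-restrict : ∀ i l → finToFun (restrict i) l ≡ bits i (lookup qs l)
  bits-restrict i = Finₚ.finToFun-funToFin (bits i ∘ lookup qs)

  agree-merge : ∀ i b → Agree i (merge i b)
  agree-merge i b q with any? (q Finₚ.≟_) qs in eq
  ... | yes q∈ = inj₁ q∈
  ... | no q∉  = inj₂ (sym (trans (bits-merge i b q) mergeBits≡))
    where
    mergeBits≡ : mergeBits i b q ≡ bits i q
    mergeBits≡ rewrite eq = refl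

  merge-restrict : ∀ {i j} → Agree i j → merge i (restrict j) ≡ j
  merge-restrict {i} {j} ag = finToFun-injective λ q → trans (bits-merge i (restrict j) q) (mergeBits≡ q)
    where
    mergeBits≡ : ∀ q → mergeBits i (restrict j) q ≡ bits j q
    mergeBits≡ q with any? (q Finₚ.≟_) qs
    ... | yes q∈ = trans (bits-restrict j (Any.index q∈)) (cong (bits j) (sym (Anyₚ.lookup-index q∈)))
    ... | no q∉  = [ (λ q∈ → contradiction q∈ q∉) , id ]′ (ag q)

  agree∧restrict≡⇒≡ : ∀ {i j} → Agree i j → restrict i ≡ restrict j → i ≡ j
  agree∧restrict≡⇒≡ {i} ag eq = trans (sym (merge-restrict (agree-refl i))) (trans (cong (merge i) eq) (merge-restrict ag))

  module _ (qs-injective : ∀ l m → lookup qs l ≡ lookup qs m → l ≡ m) where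
    -- If a qubit were listed twice, `mergeBits` would use the bit of only one occurrence and the
    -- other bit of b would be lost.
    restrict-merge : ∀ i b → restrict (merge i b) ≡ b
    restrict-merge i b = finToFun-injective λ l →
      trans (bits-restrict (merge i b) l) (trans (bits-merge i b (lookup qs l)) (mergeBits≡ l))
      where
      mergeBits≡ : ∀ l → mergeBits i b (lookup qs l) ≡ finToFun b l
      mergeBits≡ l with any? (lookup qs l Finₚ.≟_) qs
      ... | yes q∈ = cong (finToFun b) (qs-injective _ _ (sym (Anyₚ.lookup-index q∈)))
      ... | no q∉  = contradiction (∈-lookup l qs) q∉

-- The sum and the matrices are parameters so that they do not unfold during
-- unification; once instantiated, the operations below are convertible with
-- those of LqCCS.
module StarMatrices
  (C : Set) (_+′_ _*′_ : C → C → C) (-_ : C → C) (0# 1# : C)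
  (isCommutativeRing : IsCommutativeRing _≡_ _+′_ _*′_ -_ 0# 1#)
  (conj : C → C)
  (conj-0 : conj 0# ≡ 0#) (conj-conj : ∀ x → conj (conj x) ≡ x)
  (conj-+ : ∀ x y → conj (x +′ y) ≡ conj x +′ conj y)
  (conj-* : ∀ x y → conj (x *′ y) ≡ conj x *′ conj y)
  (∑ : ∀ {d} → (Fin d → C) → C)
  (∑-zero : (f : Fin 0 → C) → ∑ f ≡ 0#)
  (∑-suc : ∀ {d} (f : Fin (ℕ.suc d) → C) → ∑ f ≡ f Fin.zero +′ ∑ (f ∘ Fin.suc))
  (Matrix : ℕ → Set)
  (matrix : ∀ {d} → (Fin d → Fin d → C) → Matrix d)
  (entry : ∀ {d} → Matrix d → Fin d → Fin d → C)
  (entry-matrix : ∀ {d} (f : Fin d → Fin d → C) i j → entry (matrix f) i j ≡ f i j)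
  (matrix-ext : ∀ {d} {A B : Matrix d} → (∀ i j → entry A i j ≡ entry B i j) → A ≡ B)
  where

  open IsCommutativeRing isCommutativeRing
    using (+-identityˡ; +-identityʳ; *-assoc; *-comm; *-identityˡ; *-identityʳ; distribˡ; distribʳ; zeroˡ; zeroʳ)

  private
    infixl 6 _+_
    infixl 7 _*_

    _+_ _*_ : C → C → C
    _+_ = _+′_
    _*_ = _*′_

    ring : CommutativeRing 0ℓ 0ℓ
    ring = record { isCommutativeRing = isCommutativeRing }

    module Solver = IntegerSolver ring

    infixl 6 _+ᴹ_
    infixl 7 _·_ _*ᴹ_
    infix  9 _†

    0ᴹ 1ᴹ : ∀ {d} → Matrix d
    0ᴹ = matrix λ _ _ → 0#
    1ᴹ = matrix λ i j → if does (i Finₚ.≟ j) then 1# else 0#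

    _+ᴹ_ _*ᴹ_ : ∀ {d} → Matrix d → Matrix d → Matrix d
    A +ᴹ B = matrix λ i j → entry A i j + entry B i j
    A *ᴹ B = matrix λ i k → ∑ λ j → entry A i j * entry B j k

    _·_ : ∀ {d} → C → Matrix d → Matrix d
    x · A = matrix λ i j → x * entry A i j

    _† : ∀ {d} → Matrix d → Matrix d
    A † = matrix λ i j → conj (entry A j i)

    trace : ∀ {d} → Matrix d → C
    trace A = ∑ λ i → entry A i i

    sumᴹ : ∀ {d} → List (Matrix d) → Matrix d
    sumᴹ = List.foldr _+ᴹ_ 0ᴹ

  -- Finite sums and matrix algebra over a ring with involution

  ∑-cong : ∀ {d} {f g : Fin d → C} → (∀ i → f i ≡ g i) → ∑ f ≡ ∑ g
  ∑-cong {ℕ.zero}  f≗g = trans (∑-zero _) (sym (∑-zero _))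
  ∑-cong {ℕ.suc d} f≗g = trans (∑-suc _) (trans (cong₂ _+_ (f≗g Fin.zero) (∑-cong (f≗g ∘ Fin.suc))) (sym (∑-suc _)))

  ∑-0 : ∀ d → ∑ {d} (λ _ → 0#) ≡ 0#
  ∑-0 ℕ.zero    = ∑-zero _
  ∑-0 (ℕ.suc d) = trans (∑-suc _) (trans (+-identityˡ _) (∑-0 d))

  ∑-+ : ∀ {d} (f g : Fin d → C) → ∑ (λ i → f i + g i) ≡ ∑ f + ∑ g
  ∑-+ {ℕ.zero}  f g = trans (∑-zero _) (trans (sym (+-identityˡ _)) (sym (cong₂ _+_ (∑-zero f) (∑-zero g))))
  ∑-+ {ℕ.suc d} f g = trans (∑-suc _) (trans (cong (_ +_) (∑-+ (f ∘ Fin.suc) (g ∘ Fin.suc)))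
    (trans (solve 4 (λ a b c d → (a :+ b) :+ (c :+ d) := (a :+ c) :+ (b :+ d)) refl _ _ _ _) (sym (cong₂ _+_ (∑-suc f) (∑-suc g)))))
    where open Solver

  ∑-*ˡ : ∀ {d} x (f : Fin d → C) → x * ∑ f ≡ ∑ (λ i → x * f i)
  ∑-*ˡ {ℕ.zero}  x f = trans (cong (x *_) (∑-zero f)) (trans (zeroʳ x) (sym (∑-zero _)))
  ∑-*ˡ {ℕ.suc d} x f = trans (cong (x *_) (∑-suc f)) (trans (distribˡ x _ _)
    (trans (cong (_ +_) (∑-*ˡ x (f ∘ Fin.suc))) (sym (∑-suc _))))

  ∑-*ʳ : ∀ {d} x (f : Fin d → C) → ∑ f * x ≡ ∑ (λ i → f i * x)
  ∑-*ʳ x f = trans (*-comm _ _) (trans (∑-*ˡ x f) (∑-cong λ i → *-comm _ _))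

  ∑-swap : ∀ {d e} (f : Fin d → Fin e → C) → ∑ (λ i → ∑ (f i)) ≡ ∑ (λ j → ∑ (λ i → f i j))
  ∑-swap {ℕ.zero}  f = trans (∑-zero _) (sym (trans (∑-cong λ j → ∑-zero _) (∑-0 _)))
  ∑-swap {ℕ.suc d} f = trans (∑-suc _) (trans (cong (∑ (f Fin.zero) +_) (∑-swap (f ∘ Fin.suc)))
    (trans (sym (∑-+ _ _)) (∑-cong λ j → sym (∑-suc _))))

  conj-∑ : ∀ {d} (f : Fin d → C) → conj (∑ f) ≡ ∑ (λ i → conj (f i))
  conj-∑ {ℕ.zero}  f = trans (cong conj (∑-zero f)) (trans conj-0 (sym (∑-zero _)))
  conj-∑ {ℕ.suc d} f = trans (cong conj (∑-suc f)) (trans (conj-+ _ _) (trans (cong (_ +_) (conj-∑ (f ∘ Fin.suc))) (sym (∑-suc _))))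

  δ : ∀ {d} → Fin d → Fin d → C
  δ i j = if does (i Finₚ.≟ j) then 1# else 0#

  ∑-δ : ∀ {d} (i : Fin d) (f : Fin d → C) → ∑ (λ j → δ i j * f j) ≡ f i
  ∑-δ {ℕ.suc d} Fin.zero f = begin
    ∑ (λ j → δ Fin.zero j * f j)                    ≡⟨ ∑-suc _ ⟩
    1# * f Fin.zero + ∑ (λ j → 0# * f (Fin.suc j))  ≡⟨ cong₂ _+_ (*-identityˡ _) (trans (∑-cong λ j → zeroˡ _) (∑-0 d)) ⟩
    f Fin.zero + 0#                                 ≡⟨ +-identityʳ _ ⟩
    f Fin.zero                                      ∎
    where open ≡-Reasoning
  ∑-δ {ℕ.suc d} (Fin.suc i) f = begin
    ∑ (λ j → δ (Fin.suc i) j * f j)                    ≡⟨ ∑-suc _ ⟩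
    0# * f Fin.zero + ∑ (λ j → δ i j * f (Fin.suc j))  ≡⟨ cong₂ _+_ (zeroˡ _) (∑-δ i (f ∘ Fin.suc)) ⟩
    0# + f (Fin.suc i)                                 ≡⟨ +-identityˡ _ ⟩
    f (Fin.suc i)                                      ∎
    where open ≡-Reasoning

  module _ {d : ℕ} (A B : Matrix d) (i j : Fin d) where
    entry-+ : entry (A +ᴹ B) i j ≡ entry A i j + entry B i j
    entry-+ = entry-matrix _ i j

    entry-* : entry (A *ᴹ B) i j ≡ ∑ (λ k → entry A i k * entry B k j)
    entry-* = entry-matrix _ i j

  module _ {d : ℕ} (A : Matrix d) (i j : Fin d) where
    entry-· : ∀ x → entry (x · A) i j ≡ x * entry A i j
    entry-· x = entry-matrix _ i j

    entry-† : entry (A †) i j ≡ conj (entry A j i)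
    entry-† = entry-matrix _ i j

  entry-0 : ∀ {d} (i j : Fin d) → entry 0ᴹ i j ≡ 0#
  entry-0 = entry-matrix _

  entry-1 : ∀ {d} (i j : Fin d) → entry 1ᴹ i j ≡ δ i j
  entry-1 = entry-matrix _

  entry-·+· : ∀ {d} a b (A B : Matrix d) i j →
              entry (a · A +ᴹ b · B) i j ≡ a * entry A i j + b * entry B i j
  entry-·+· a b A B i j = trans (entry-+ _ _ i j) (cong₂ _+_ (entry-· A i j a) (entry-· B i j b))

  +ᴹ-identityʳ : ∀ {d} (A : Matrix d) → A +ᴹ 0ᴹ ≡ A
  +ᴹ-identityʳ A = matrix-ext λ i j → trans (entry-+ A 0ᴹ i j)
    (trans (cong (entry A i j +_) (entry-0 i j)) (+-identityʳ _))

  ·-assoc : ∀ {d} a b (A : Matrix d) → a · (b · A) ≡ (a * b) · A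
  ·-assoc a b A = matrix-ext λ i j → begin
    entry (a · (b · A)) i j          ≡⟨ entry-· (b · A) i j a ⟩
    a * entry (b · A) i j          ≡⟨ cong (a *_) (entry-· A i j b) ⟩
    a * (b * entry A i j)        ≡⟨ *-assoc _ _ _ ⟨
    (a * b) * entry A i j           ≡⟨ entry-· A i j (a * b) ⟨
    entry ((a * b) · A) i j           ∎
    where open ≡-Reasoning

  ·-identity : ∀ {d} (A : Matrix d) → 1# · A ≡ A
  ·-identity A = matrix-ext λ i j → trans (entry-· A i j 1#) (*-identityˡ _)

  ·-zeroˡ : ∀ {d} (A : Matrix d) → 0# · A ≡ 0ᴹ
  ·-zeroˡ A = matrix-ext λ i j → trans (entry-· A i j 0#) (trans (zeroˡ _) (sym (entry-0 i j)))

  ·-zeroʳ : ∀ {d} x → x · 0ᴹ {d} ≡ 0ᴹ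
  ·-zeroʳ x = matrix-ext λ i j → trans (entry-· 0ᴹ i j x)
    (trans (cong (x *_) (entry-0 i j)) (trans (zeroʳ _) (sym (entry-0 i j))))

  *ᴹ-assoc : ∀ {d} (A B C : Matrix d) → (A *ᴹ B) *ᴹ C ≡ A *ᴹ (B *ᴹ C)
  *ᴹ-assoc A B C = matrix-ext λ i l → begin
    entry ((A *ᴹ B) *ᴹ C) i l                                                 ≡⟨ entry-* _ _ i l ⟩
    ∑ (λ k → entry (A *ᴹ B) i k * entry C k l)                               ≡⟨ ∑-cong (λ k → cong (_* entry C k l) (entry-* A B i k)) ⟩
    ∑ (λ k → ∑ (λ j → entry A i j * entry B j k) * entry C k l)             ≡⟨ ∑-cong (λ k → ∑-*ʳ _ _) ⟩
    ∑ (λ k → ∑ (λ j → (entry A i j * entry B j k) * entry C k l))           ≡⟨ ∑-swap _ ⟩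
    ∑ (λ j → ∑ (λ k → (entry A i j * entry B j k) * entry C k l))           ≡⟨ ∑-cong (λ j → ∑-cong λ k → *-assoc _ _ _) ⟩
    ∑ (λ j → ∑ (λ k → entry A i j * (entry B j k * entry C k l)))           ≡⟨ ∑-cong (λ j → ∑-*ˡ _ _) ⟨
    ∑ (λ j → entry A i j * ∑ (λ k → entry B j k * entry C k l))             ≡⟨ ∑-cong (λ j → cong (entry A i j *_) (entry-* B C j l)) ⟨
    ∑ (λ j → entry A i j * entry (B *ᴹ C) j l)                               ≡⟨ entry-* _ _ i l ⟨
    entry (A *ᴹ (B *ᴹ C)) i l                                                 ∎
    where open ≡-Reasoning

  *ᴹ-identityˡ : ∀ {d} (A : Matrix d) → 1ᴹ *ᴹ A ≡ A
  *ᴹ-identityˡ A = matrix-ext λ i k → trans (entry-* 1ᴹ A i k)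
    (trans (∑-cong λ j → cong (_* entry A j k) (entry-1 i j)) (∑-δ i λ j → entry A j k))

  *ᴹ-zeroˡ : ∀ {d} (A : Matrix d) → 0ᴹ *ᴹ A ≡ 0ᴹ
  *ᴹ-zeroˡ {d} A = matrix-ext λ i k → trans (entry-* 0ᴹ A i k)
    (trans (∑-cong λ j → trans (cong (_* entry A j k) (entry-0 i j)) (zeroˡ _)) (trans (∑-0 d) (sym (entry-0 i k))))

  *ᴹ-distribʳ : ∀ {d} (A B C : Matrix d) → (A +ᴹ B) *ᴹ C ≡ A *ᴹ C +ᴹ B *ᴹ C
  *ᴹ-distribʳ A B C = matrix-ext λ i k → begin
    entry ((A +ᴹ B) *ᴹ C) i k                                                 ≡⟨ entry-* _ _ i k ⟩
    ∑ (λ j → entry (A +ᴹ B) i j * entry C j k)                               ≡⟨ ∑-cong (λ j → trans (cong (_* entry C j k) (entry-+ A B i j)) (distribʳ _ _ _)) ⟩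
    ∑ (λ j → entry A i j * entry C j k + entry B i j * entry C j k)        ≡⟨ ∑-+ _ _ ⟩
    ∑ (λ j → entry A i j * entry C j k) + ∑ (λ j → entry B i j * entry C j k)  ≡⟨ cong₂ _+_ (entry-* A C i k) (entry-* B C i k) ⟨
    entry (A *ᴹ C) i k + entry (B *ᴹ C) i k                                  ≡⟨ entry-+ _ _ i k ⟨
    entry (A *ᴹ C +ᴹ B *ᴹ C) i k                                              ∎
    where open ≡-Reasoning

  Linear : ∀ {d e} → (Matrix d → Matrix e) → Set
  Linear L = ∀ a b A B → L (a · A +ᴹ b · B) ≡ a · L A +ᴹ b · L B

  linear-· : ∀ {d e} (L : Matrix d → Matrix e) → Linear L → ∀ a A → L (a · A) ≡ a · L A
  linear-· L lin a A = begin
    L (a · A)                  ≡⟨ cong L (+ᴹ-identityʳ _) ⟨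
    L (a · A +ᴹ 0ᴹ)            ≡⟨ cong (λ Z → L (a · A +ᴹ Z)) (·-zeroˡ A) ⟨
    L (a · A +ᴹ 0# · A)       ≡⟨ lin a 0# A A ⟩
    a · L A +ᴹ 0# · L A       ≡⟨ cong (a · L A +ᴹ_) (·-zeroˡ (L A)) ⟩
    a · L A +ᴹ 0ᴹ              ≡⟨ +ᴹ-identityʳ _ ⟩
    a · L A                    ∎
    where open ≡-Reasoning

  *ᴹ-linearˡ : ∀ {d} (K : Matrix d) → Linear (_*ᴹ K)
  *ᴹ-linearˡ K a b A B = matrix-ext λ i k → begin
    entry ((a · A +ᴹ b · B) *ᴹ K) i k
      ≡⟨ entry-* _ _ i k ⟩
    ∑ (λ j → entry (a · A +ᴹ b · B) i j * entry K j k)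
      ≡⟨ ∑-cong (λ j → trans (cong (_* entry K j k) (entry-·+· a b A B i j))
                         (solve 5 (λ x y z t u → (x :* y :+ z :* t) :* u := x :* (y :* u) :+ z :* (t :* u)) refl (a) (entry A i j) (b) (entry B i j) (entry K j k))) ⟩
    ∑ (λ j → a * (entry A i j * entry K j k) + b * (entry B i j * entry K j k))
      ≡⟨ ∑-+ _ _ ⟩
    ∑ (λ j → a * (entry A i j * entry K j k)) + ∑ (λ j → b * (entry B i j * entry K j k))
      ≡⟨ cong₂ _+_ (∑-*ˡ _ _) (∑-*ˡ _ _) ⟨
    a * ∑ (λ j → entry A i j * entry K j k) + b * ∑ (λ j → entry B i j * entry K j k)
      ≡⟨ cong₂ (λ x y → a * x + b * y) (entry-* A K i k) (entry-* B K i k) ⟨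
    a * entry (A *ᴹ K) i k + b * entry (B *ᴹ K) i k
      ≡⟨ entry-·+· a b _ _ i k ⟨
    entry (a · (A *ᴹ K) +ᴹ b · (B *ᴹ K)) i k ∎
    where
    open ≡-Reasoning
    open Solver

  *ᴹ-linearʳ : ∀ {d} (K : Matrix d) → Linear (K *ᴹ_)
  *ᴹ-linearʳ K a b A B = matrix-ext λ i k → begin
    entry (K *ᴹ (a · A +ᴹ b · B)) i k
      ≡⟨ entry-* _ _ i k ⟩
    ∑ (λ j → entry K i j * entry (a · A +ᴹ b · B) j k)
      ≡⟨ ∑-cong (λ j → trans (cong (entry K i j *_) (entry-·+· a b A B j k))
                         (solve 5 (λ x y z t u → u :* (x :* y :+ z :* t) := x :* (u :* y) :+ z :* (u :* t)) refl (a) (entry A j k) (b) (entry B j k) (entry K i j))) ⟩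
    ∑ (λ j → a * (entry K i j * entry A j k) + b * (entry K i j * entry B j k))
      ≡⟨ ∑-+ _ _ ⟩
    ∑ (λ j → a * (entry K i j * entry A j k)) + ∑ (λ j → b * (entry K i j * entry B j k))
      ≡⟨ cong₂ _+_ (∑-*ˡ _ _) (∑-*ˡ _ _) ⟨
    a * ∑ (λ j → entry K i j * entry A j k) + b * ∑ (λ j → entry K i j * entry B j k)
      ≡⟨ cong₂ (λ x y → a * x + b * y) (entry-* K A i k) (entry-* K B i k) ⟨
    a * entry (K *ᴹ A) i k + b * entry (K *ᴹ B) i k
      ≡⟨ entry-·+· a b _ _ i k ⟨
    entry (a · (K *ᴹ A) +ᴹ b · (K *ᴹ B)) i k ∎
    where
    open ≡-Reasoning
    open Solver

  conjugate : ∀ {d} → Matrix d → Matrix d → Matrix d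
  conjugate K A = K *ᴹ A *ᴹ K †

  conjugate-linear : ∀ {d} (K : Matrix d) → Linear (conjugate K)
  conjugate-linear K a b A B =
    trans (cong (_*ᴹ K †) (*ᴹ-linearʳ K a b A B)) (*ᴹ-linearˡ (K †) a b _ _)

  sum-conjugate-linear : ∀ {d} {B : Set} (K : B → Matrix d) Ks → Linear (λ A → sumᴹ (map (λ k → conjugate (K k) A) Ks))
  sum-conjugate-linear K [] a b A B = sym (trans (cong₂ _+ᴹ_ (·-zeroʳ a) (·-zeroʳ b)) (+ᴹ-identityʳ _))
  sum-conjugate-linear K (k ∷ Ks) a b A B = begin
    conjugate (K k) (a · A +ᴹ b · B) +ᴹ L (a · A +ᴹ b · B)
      ≡⟨ cong₂ _+ᴹ_ (conjugate-linear (K k) a b A B) (sum-conjugate-linear K Ks a b A B) ⟩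
    (a · D A +ᴹ b · D B) +ᴹ (a · L A +ᴹ b · L B)
      ≡⟨ matrix-ext (λ i j → trans (entry-+ _ _ i j) (trans (cong₂ _+_ (entry-·+· a b _ _ i j) (entry-·+· a b _ _ i j))
           (trans (solve 6 (λ a b x y z t → (a :* x :+ b :* y) :+ (a :* z :+ b :* t) := a :* (x :+ z) :+ b :* (y :+ t)) refl
                    (a) (b) (entry (D A) i j) (entry (D B) i j) (entry (L A) i j) (entry (L B) i j))
             (sym (trans (entry-·+· a b _ _ i j) (cong₂ (λ x y → a * x + b * y) (entry-+ _ _ i j) (entry-+ _ _ i j))))))) ⟩
    a · (D A +ᴹ L A) +ᴹ b · (D B +ᴹ L B) ∎
    where
    open ≡-Reasoning
    open Solver
    D = conjugate (K k)
    L = λ A → sumᴹ (map (λ k → conjugate (K k) A) Ks)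

  trace-·+· : ∀ {d} a b (A B : Matrix d) → trace (a · A +ᴹ b · B) ≡ a * trace A + b * trace B
  trace-·+· a b A B = trans (∑-cong λ i → entry-·+· a b A B i i)
    (trans (∑-+ _ _) (cong₂ _+_ (sym (∑-*ˡ _ _)) (sym (∑-*ˡ _ _))))

  trace-+ : ∀ {d} (A B : Matrix d) → trace (A +ᴹ B) ≡ trace A + trace B
  trace-+ A B = trans (∑-cong λ i → entry-+ A B i i) (∑-+ _ _)

  trace-0 : ∀ d → trace (0ᴹ {d}) ≡ 0#
  trace-0 d = trans (∑-cong {d} λ i → entry-0 i i) (∑-0 d)

  trace-cyclic : ∀ {d} (A B : Matrix d) → trace (A *ᴹ B) ≡ trace (B *ᴹ A)
  trace-cyclic A B = begin
    ∑ (λ i → entry (A *ᴹ B) i i)                      ≡⟨ ∑-cong (λ i → entry-* A B i i) ⟩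
    ∑ (λ i → ∑ (λ j → entry A i j * entry B j i))    ≡⟨ ∑-swap _ ⟩
    ∑ (λ j → ∑ (λ i → entry A i j * entry B j i))    ≡⟨ ∑-cong (λ j → ∑-cong λ i → *-comm _ _) ⟩
    ∑ (λ j → ∑ (λ i → entry B j i * entry A i j))    ≡⟨ ∑-cong (λ j → entry-* B A j j) ⟨
    ∑ (λ j → entry (B *ᴹ A) j j)                      ∎
    where open ≡-Reasoning

  trace-conjugate : ∀ {d} (K A : Matrix d) → trace (conjugate K A) ≡ trace ((K † *ᴹ K) *ᴹ A)
  trace-conjugate K A = trans (trace-cyclic (K *ᴹ A) (K †)) (cong trace (sym (*ᴹ-assoc (K †) K A)))

  -- Cyclicity of the trace brings each K† next to its K, so the trace depends on the family only
  -- through the sum of the K† K, which completeness makes the identity.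
  trace-sum-conjugate : ∀ {d} {B : Set} (K : B → Matrix d) Ks A →
    trace (sumᴹ (map (λ k → conjugate (K k) A) Ks)) ≡ trace (sumᴹ (map (λ k → K k † *ᴹ K k) Ks) *ᴹ A)
  trace-sum-conjugate K []       A = sym (cong trace (*ᴹ-zeroˡ A))
  trace-sum-conjugate K (k ∷ Ks) A = begin
    trace (conjugate (K k) A +ᴹ sumᴹ (map (λ k → conjugate (K k) A) Ks))                ≡⟨ trace-+ _ _ ⟩
    trace (conjugate (K k) A) + trace (sumᴹ (map (λ k → conjugate (K k) A) Ks))         ≡⟨ cong₂ _+_ (trace-conjugate (K k) A) (trace-sum-conjugate K Ks A) ⟩
    trace ((K k † *ᴹ K k) *ᴹ A) + trace (sumᴹ (map (λ k → K k † *ᴹ K k) Ks) *ᴹ A)       ≡⟨ trace-+ _ _ ⟨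
    trace ((K k † *ᴹ K k) *ᴹ A +ᴹ sumᴹ (map (λ k → K k † *ᴹ K k) Ks) *ᴹ A)              ≡⟨ cong trace (*ᴹ-distribʳ _ _ A) ⟨
    trace ((K k † *ᴹ K k +ᴹ sumᴹ (map (λ k → K k † *ᴹ K k) Ks)) *ᴹ A)                   ∎
    where open ≡-Reasoning

  -- The left vector is not conjugated here, so that the factors of a matrix product can be moved
  -- into either argument separately.
  form : ∀ {d} → (Fin d → C) → Matrix d → (Fin d → C) → C
  form x A y = ∑ λ i → ∑ λ j → x i * entry A i j * y j

  form-cong : ∀ {d} {x x′ y y′ : Fin d → C} A → (∀ i → x i ≡ x′ i) → (∀ i → y i ≡ y′ i) → form x A y ≡ form x′ A y′
  form-cong A x≗x′ y≗y′ = ∑-cong λ i → ∑-cong λ j → cong₂ (λ u v → u * entry A i j * v) (x≗x′ i) (y≗y′ j)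

  form-*ʳ : ∀ {d} (x y : Fin d → C) (A B : Matrix d) → form x (A *ᴹ B) y ≡ form x A (λ j → ∑ λ l → entry B j l * y l)
  form-*ʳ x y A B = ∑-cong λ i → begin
    ∑ (λ l → x i * entry (A *ᴹ B) i l * y l)                       ≡⟨ ∑-cong (λ l → cong (λ u → x i * u * y l) (entry-* A B i l)) ⟩
    ∑ (λ l → x i * ∑ (λ j → entry A i j * entry B j l) * y l)      ≡⟨ ∑-cong (λ l → trans (cong (_* y l) (∑-*ˡ _ _)) (∑-*ʳ _ _)) ⟩
    ∑ (λ l → ∑ (λ j → x i * (entry A i j * entry B j l) * y l))    ≡⟨ ∑-swap _ ⟩
    ∑ (λ j → ∑ (λ l → x i * (entry A i j * entry B j l) * y l))    ≡⟨ ∑-cong (λ j → ∑-cong λ l → solve 4 (λ a b c d → a :* (b :* c) :* d := a :* b :* (c :* d)) refl _ _ _ _) ⟩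
    ∑ (λ j → ∑ (λ l → x i * entry A i j * (entry B j l * y l)))    ≡⟨ ∑-cong (λ j → ∑-*ˡ _ _) ⟨
    ∑ (λ j → x i * entry A i j * ∑ (λ l → entry B j l * y l))      ∎
    where
    open ≡-Reasoning
    open Solver

  form-*ˡ : ∀ {d} (x y : Fin d → C) (A B : Matrix d) → form x (A *ᴹ B) y ≡ form (λ j → ∑ λ i → x i * entry A i j) B y
  form-*ˡ x y A B = begin
    ∑ (λ i → ∑ λ l → x i * entry (A *ᴹ B) i l * y l)                          ≡⟨ ∑-swap _ ⟩
    ∑ (λ l → ∑ λ i → x i * entry (A *ᴹ B) i l * y l)                          ≡⟨ ∑-cong (λ l → ∑-cong λ i → cong (λ u → x i * u * y l) (entry-* A B i l)) ⟩
    ∑ (λ l → ∑ λ i → x i * ∑ (λ j → entry A i j * entry B j l) * y l)         ≡⟨ ∑-cong (λ l → ∑-cong λ i → trans (cong (_* y l) (∑-*ˡ _ _)) (∑-*ʳ _ _)) ⟩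
    ∑ (λ l → ∑ λ i → ∑ λ j → x i * (entry A i j * entry B j l) * y l)         ≡⟨ ∑-cong (λ l → ∑-swap _) ⟩
    ∑ (λ l → ∑ λ j → ∑ λ i → x i * (entry A i j * entry B j l) * y l)         ≡⟨ ∑-swap _ ⟩
    ∑ (λ j → ∑ λ l → ∑ λ i → x i * (entry A i j * entry B j l) * y l)         ≡⟨ ∑-cong (λ j → ∑-cong λ l → ∑-cong λ i → solve 4 (λ a b c d → a :* (b :* c) :* d := a :* b :* (c :* d)) refl _ _ _ _) ⟩
    ∑ (λ j → ∑ λ l → ∑ λ i → x i * entry A i j * (entry B j l * y l))         ≡⟨ ∑-cong (λ j → ∑-cong λ l → trans (sym (∑-*ʳ _ _)) (sym (*-assoc _ _ _))) ⟩
    ∑ (λ j → ∑ λ l → ∑ (λ i → x i * entry A i j) * entry B j l * y l)         ∎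
    where
    open ≡-Reasoning
    open Solver

  -- The vector w is K† v; this is why conjugation by K preserves positivity.
  form-conjugate : ∀ {d} (K A : Matrix d) (v : Fin d → C) → let w = λ j → ∑ λ l → entry (K †) j l * v l in
                   form (conj ∘ v) (conjugate K A) v ≡ form (conj ∘ w) A w
  form-conjugate K A v = trans (form-*ʳ _ v (K *ᴹ A) (K †)) (trans (form-*ˡ _ _ K A) (form-cong A (λ j → begin
    ∑ (λ i → conj (v i) * entry K i j)                  ≡⟨ ∑-cong (λ i → trans (*-comm _ _) (cong (_* conj (v i))
                                                             (trans (sym (conj-conj _)) (cong conj (sym (entry-† K j i)))))) ⟩
    ∑ (λ i → conj (entry (K †) j i) * conj (v i))       ≡⟨ ∑-cong (λ i → conj-* _ _) ⟨
    ∑ (λ i → conj (entry (K †) j i * v i))              ≡⟨ conj-∑ _ ⟨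
    conj (∑ (λ i → entry (K †) j i * v i))              ∎) (λ _ → refl)))
    where open ≡-Reasoning

  form-·+· : ∀ {d} a b (A B : Matrix d) x y → form x (a · A +ᴹ b · B) y ≡ a * form x A y + b * form x B y
  form-·+· a b A B x y = begin
    ∑ (λ i → ∑ λ j → x i * entry (a · A +ᴹ b · B) i j * y j)
      ≡⟨ ∑-cong (λ i → trans (∑-cong λ j → trans (cong (λ u → x i * u * y j) (entry-·+· a b A B i j))
            (solve 6 (λ a b A B x y → x :* (a :* A :+ b :* B) :* y := a :* (x :* A :* y) :+ b :* (x :* B :* y)) refl
               a b (entry A i j) (entry B i j) (x i) (y j))) (trans (∑-+ _ _) (sym (cong₂ _+_ (∑-*ˡ _ _) (∑-*ˡ _ _))))) ⟩
    ∑ (λ i → a * ∑ (λ j → x i * entry A i j * y j) + b * ∑ (λ j → x i * entry B i j * y j))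
      ≡⟨ trans (∑-+ _ _) (sym (cong₂ _+_ (∑-*ˡ _ _) (∑-*ˡ _ _))) ⟩
    a * form x A y + b * form x B y ∎
    where
    open ≡-Reasoning
    open Solver

  -- Vectors supported on the basis vectors i and j see only the corresponding two by two principal
  -- block.
  form-δ-δ : ∀ {d} (A : Matrix d) (i j : Fin d) α β γ η →
    form (λ k → α * δ i k + β * δ j k) A (λ k → γ * δ i k + η * δ j k) ≡
    α * (γ * entry A i i + η * entry A i j) + β * (γ * entry A j i + η * entry A j j)
  form-δ-δ A i j α β γ η = begin
    ∑ (λ k → ∑ λ l → (α * δ i k + β * δ j k) * entry A k l * (γ * δ i l + η * δ j l))
      ≡⟨ ∑-cong (λ k → trans (∑-cong λ l → *-assoc _ _ _) (sym (∑-*ˡ _ _))) ⟩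
    ∑ (λ k → (α * δ i k + β * δ j k) * row k)
      ≡⟨ ∑-cong (λ k → solve 5 (λ a b x y z → (a :* x :+ b :* y) :* z := a :* (x :* z) :+ b :* (y :* z)) refl _ _ _ _ _) ⟩
    ∑ (λ k → α * (δ i k * row k) + β * (δ j k * row k))
      ≡⟨ trans (∑-+ _ _) (sym (cong₂ _+_ (∑-*ˡ _ _) (∑-*ˡ _ _))) ⟩
    α * ∑ (λ k → δ i k * row k) + β * ∑ (λ k → δ j k * row k)
      ≡⟨ cong₂ (λ u v → α * u + β * v) (trans (∑-δ i row) (row≡ i)) (trans (∑-δ j row) (row≡ j)) ⟩
    α * (γ * entry A i i + η * entry A i j) + β * (γ * entry A j i + η * entry A j j) ∎
    where
    open ≡-Reasoning
    open Solver
    row : Fin _ → C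
    row k = ∑ λ l → entry A k l * (γ * δ i l + η * δ j l)
    row≡ : ∀ k → row k ≡ γ * entry A k i + η * entry A k j
    row≡ k = begin
      ∑ (λ l → entry A k l * (γ * δ i l + η * δ j l))
        ≡⟨ ∑-cong (λ l → solve 5 (λ z g h x y → z :* (g :* x :+ h :* y) := g :* (x :* z) :+ h :* (y :* z)) refl _ _ _ _ _) ⟩
      ∑ (λ l → γ * (δ i l * entry A k l) + η * (δ j l * entry A k l))
        ≡⟨ trans (∑-+ _ _) (sym (cong₂ _+_ (∑-*ˡ _ _) (∑-*ˡ _ _))) ⟩
      γ * ∑ (λ l → δ i l * entry A k l) + η * ∑ (λ l → δ j l * entry A k l)
        ≡⟨ cong₂ (λ u v → γ * u + η * v) (∑-δ i (entry A k)) (∑-δ j (entry A k)) ⟩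
      γ * entry A k i + η * entry A k j ∎

  -- Operators embedded on selected qubits

  if-cong₂ : ∀ {b b′ : Bool} {x x′ y : C} → b ≡ b′ → x ≡ x′ → (if b then x else y) ≡ (if b′ then x′ else y)
  if-cong₂ refl refl = refl

  if-dec : ∀ {A : Set} {x y z : C} (a? : Dec A) → (A → x ≡ z) → (¬ A → y ≡ z) → (if does a? then x else y) ≡ z
  if-dec (yes a) x≡z y≡z = x≡z a
  if-dec (no ¬a) x≡z y≡z = y≡z ¬a

  conj-if : ∀ b x → conj (if b then x else 0#) ≡ (if b then conj x else 0#)
  conj-if true  x = refl
  conj-if false x = conj-0

  +-if : ∀ b x y → (if b then x else 0#) + (if b then y else 0#) ≡ (if b then x + y else 0#)
  +-if true  x y = refl
  +-if false x y = +-identityˡ 0#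

  module _ {N k : ℕ} (qs : Vec (Fin N) k) where
    open Embedding qs

    private
      onQubits : Matrix (2 ℕ.^ k) → Matrix (2 ℕ.^ N)
      onQubits A = matrix λ i j → if does (agree? i j) then entry A (restrict i) (restrict j) else 0#

    entry-onQubits : ∀ A i j → entry (onQubits A) i j ≡ (if does (agree? i j) then entry A (restrict i) (restrict j) else 0#)
    entry-onQubits A = entry-matrix _

    onQubits-† : ∀ A → onQubits A † ≡ onQubits (A †)
    onQubits-† A = matrix-ext λ i j → trans (entry-† (onQubits A) i j) (trans (cong conj (entry-onQubits A j i))
      (trans (conj-if (does (agree? j i)) _) (trans (if-cong₂ (does-⇔ (mk⇔ agree-sym agree-sym) (agree? j i) (agree? i j))
        (sym (entry-† A (restrict i) (restrict j)))) (sym (entry-onQubits (A †) i j)))))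

    onQubits-+ : ∀ A B → onQubits A +ᴹ onQubits B ≡ onQubits (A +ᴹ B)
    onQubits-+ A B = matrix-ext λ i j → trans (entry-+ _ _ i j) (trans (cong₂ _+_ (entry-onQubits A i j) (entry-onQubits B i j))
      (trans (+-if (does (agree? i j)) _ _) (trans (if-cong₂ {b = does (agree? i j)} refl (sym (entry-+ A B (restrict i) (restrict j))))
        (sym (entry-onQubits (A +ᴹ B) i j)))))

    onQubits-0 : onQubits 0ᴹ ≡ 0ᴹ
    onQubits-0 = matrix-ext λ i j → trans (entry-onQubits 0ᴹ i j)
      (trans (if-dec (agree? i j) (λ _ → entry-0 (restrict i) (restrict j)) (λ _ → refl)) (sym (entry-0 i j)))

    -- States that agree outside `qs` are equal exactly when their restrictions are, and states that
    -- disagree there are distinct.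
    onQubits-1 : onQubits 1ᴹ ≡ 1ᴹ
    onQubits-1 = matrix-ext λ i j → trans (entry-onQubits 1ᴹ i j) (trans (one i j) (sym (entry-1 i j)))
      where
      one : ∀ i j → (if does (agree? i j) then entry 1ᴹ (restrict i) (restrict j) else 0#) ≡ δ i j
      one i j = if-dec (agree? i j)
        (λ ag → trans (entry-1 (restrict i) (restrict j)) (cong (λ b → if b then 1# else 0#)
          (does-⇔ (mk⇔ (agree∧restrict≡⇒≡ ag) (cong restrict)) (restrict i Finₚ.≟ restrict j) (i Finₚ.≟ j))))
        (λ ¬ag → sym (cong (λ b → if b then 1# else 0#) (dec-false (i Finₚ.≟ j) λ { refl → ¬ag (agree-refl i) })))

    sum-onQubits : ∀ As → sumᴹ (map onQubits As) ≡ onQubits (sumᴹ As)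
    sum-onQubits []       = sym onQubits-0
    sum-onQubits (A ∷ As) = trans (cong (onQubits A +ᴹ_) (sum-onQubits As)) (onQubits-+ A (sumᴹ As))

    module _ (qs-injective : ∀ l m → lookup qs l ≡ lookup qs m → l ≡ m) where
      -- Each state agreeing with i outside `qs` is `merge i b` for exactly one b. Expanding the
      -- condition into Kronecker deltas over b and swapping the sums makes the enumeration an
      -- instance of `∑-δ`.
      ∑-agree : ∀ i (g : Fin (2 ℕ.^ N) → C) → ∑ (λ j → if does (agree? i j) then g j else 0#) ≡ ∑ (λ b → g (merge i b))
      ∑-agree i g = begin
        ∑ (λ j → if does (agree? i j) then g j else 0#)    ≡⟨ ∑-cong pointwise ⟩
        ∑ (λ j → ∑ λ b → δ (merge i b) j * g j)            ≡⟨ ∑-swap _ ⟩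
        ∑ (λ b → ∑ λ j → δ (merge i b) j * g j)            ≡⟨ ∑-cong (λ b → ∑-δ (merge i b) g) ⟩
        ∑ (λ b → g (merge i b))                            ∎
        where
        open ≡-Reasoning
        δ-merge : ∀ {j} → Agree i j → ∀ b → δ (merge i b) j ≡ δ (restrict j) b
        δ-merge {j} ag b = cong (λ b → if b then 1# else 0#) (does-⇔
          (mk⇔ (λ { refl → restrict-merge qs-injective i b }) (λ { refl → merge-restrict ag }))
          (merge i b Finₚ.≟ j) (restrict j Finₚ.≟ b))
        δ-merge-0 : ∀ {j} → ¬ Agree i j → ∀ b → δ (merge i b) j ≡ 0#
        δ-merge-0 {j} ¬ag b = cong (λ b → if b then 1# else 0#)
          (dec-false (merge i b Finₚ.≟ j) λ { refl → ¬ag (agree-merge i b) })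
        pointwise : ∀ j → (if does (agree? i j) then g j else 0#) ≡ ∑ (λ b → δ (merge i b) j * g j)
        pointwise j = if-dec (agree? i j)
          (λ ag → sym (trans (∑-cong λ b → cong (_* g j) (δ-merge ag b)) (∑-δ (restrict j) (λ _ → g j))))
          (λ ¬ag → sym (trans (∑-cong λ b → trans (cong (_* g j) (δ-merge-0 ¬ag b)) (zeroˡ _)) (∑-0 _)))

      -- Only intermediate states that agree with i outside `qs` contribute, and `∑-agree`
      -- enumerates them by their bits on `qs`, which are the inner indices of the small product.
      onQubits-* : ∀ A B → onQubits A *ᴹ onQubits B ≡ onQubits (A *ᴹ B)
      onQubits-* A B = matrix-ext λ i l → begin
        entry (onQubits A *ᴹ onQubits B) i l
          ≡⟨ entry-* _ _ i l ⟩
        ∑ (λ j → entry (onQubits A) i j * entry (onQubits B) j l)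
          ≡⟨ ∑-cong (λ j → trans (cong₂ _*_ (entry-onQubits A i j) (entry-onQubits B j l)) (if-* (does (agree? i j)) _ _)) ⟩
        ∑ (λ j → if does (agree? i j) then entry A (restrict i) (restrict j) * b-entry j l else 0#)
          ≡⟨ ∑-agree i (λ j → entry A (restrict i) (restrict j) * b-entry j l) ⟩
        ∑ (λ b → entry A (restrict i) (restrict (merge i b)) * b-entry (merge i b) l)
          ≡⟨ ∑-cong (λ b → cong₂ (λ c x → entry A (restrict i) c * x) (restrict-merge qs-injective i b)
               (if-cong₂ (does-⇔ (mk⇔ (agree-trans (agree-merge i b)) (agree-trans (agree-sym (agree-merge i b)))) (agree? (merge i b) l) (agree? i l))
                         (cong (λ c → entry B c (restrict l)) (restrict-merge qs-injective i b)))) ⟩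
        ∑ (λ b → entry A (restrict i) b * (if does (agree? i l) then entry B b (restrict l) else 0#))
          ≡⟨ pull (does (agree? i l)) ⟩
        (if does (agree? i l) then ∑ (λ b → entry A (restrict i) b * entry B b (restrict l)) else 0#)
          ≡⟨ if-cong₂ {b = does (agree? i l)} refl (entry-* A B (restrict i) (restrict l)) ⟨
        (if does (agree? i l) then entry (A *ᴹ B) (restrict i) (restrict l) else 0#)
          ≡⟨ entry-onQubits (A *ᴹ B) i l ⟨
        entry (onQubits (A *ᴹ B)) i l ∎
        where
        open ≡-Reasoning
        b-entry : ∀ j l → C
        b-entry j l = if does (agree? j l) then entry B (restrict j) (restrict l) else 0#
        if-* : ∀ b x y → (if b then x else 0#) * y ≡ (if b then x * y else 0#)
        if-* true  x y = refl
        if-* false x y = zeroˡ y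
        pull : ∀ {f g : Fin (2 ℕ.^ k) → C} b → ∑ (λ c → f c * (if b then g c else 0#)) ≡ (if b then ∑ (λ c → f c * g c) else 0#)
        pull true  = refl
        pull false = trans (∑-cong λ c → zeroʳ _) (∑-0 _)

      -- On distinct qubits the embedding respects adjoints, products, sums and the identity, so it
      -- carries the completeness relation to the whole space.
      onQubits-complete : ∀ Ks → sumᴹ (map (λ K → K † *ᴹ K) Ks) ≡ 1ᴹ →
                          sumᴹ (map (λ K → onQubits K † *ᴹ onQubits K) Ks) ≡ 1ᴹ
      onQubits-complete Ks complete = begin
        sumᴹ (map (λ K → onQubits K † *ᴹ onQubits K) Ks)   ≡⟨ cong sumᴹ (Listₚ.map-cong (λ K → trans (cong (_*ᴹ onQubits K) (onQubits-† K)) (onQubits-* (K †) K)) Ks) ⟩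
        sumᴹ (map (λ K → onQubits (K † *ᴹ K)) Ks)          ≡⟨ cong sumᴹ (Listₚ.map-∘ Ks) ⟩
        sumᴹ (map onQubits (map (λ K → K † *ᴹ K) Ks))      ≡⟨ sum-onQubits (map (λ K → K † *ᴹ K) Ks) ⟩
        onQubits (sumᴹ (map (λ K → K † *ᴹ K) Ks))          ≡⟨ cong onQubits complete ⟩
        onQubits 1ᴹ                                        ≡⟨ onQubits-1 ⟩
        1ᴹ                                                 ∎
        where open ≡-Reasoning

      trace-complete : ∀ Ks → sumᴹ (map (λ K → K † *ᴹ K) Ks) ≡ 1ᴹ → ∀ A →
                       trace (sumᴹ (map (λ K → conjugate (onQubits K) A) Ks)) ≡ trace A
      trace-complete Ks complete A = trans (trace-sum-conjugate onQubits Ks A)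
        (cong trace (trans (cong (_*ᴹ A) (onQubits-complete Ks complete)) (*ᴹ-identityˡ A)))

module Classical (em : ExcludedMiddle (suc 0ℓ)) (reals : RealNumbers) where
  open LqCCS reals renaming (yes to here; no to there)

  -- Real and complex numbers

  opaque
    -- Excluded middle is assumed for `Set₁` only, hence the lifting. Opacity keeps case
    -- distinctions from unfolding into it.
    em₀ : {A : Set} → Dec A
    em₀ {A} = map′ Level.lower Level.lift (em {Level.Lift (suc 0ℓ) A})

  -- Bisimilarity is Set₁-valued whereas bisimulations are Set-valued, so that a
  -- relation defined up to ∼cs has to be resized.
  Squash : Set₁ → Set
  Squash A = True (em {A})

  squash : ∀ {A : Set₁} → A → Squash A
  squash = fromWitness

  unsquash : ∀ {A : Set₁} → Squash A → A
  unsquash = toWitness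

  ℝ-ring : CommutativeRing 0ℓ 0ℓ
  ℝ-ring = record { isCommutativeRing = isCommutativeRing }

  module ℝ-Solver = IntegerSolver ℝ-ring

  open IsCommutativeRing isCommutativeRing public
    using (+-assoc; +-comm; +-identityˡ; +-identityʳ; *-assoc; *-comm; *-identityˡ; *-identityʳ;
           distribˡ; distribʳ; zeroˡ; zeroʳ; -‿inverseˡ; -‿inverseʳ)
  open IsTotalOrder isTotalOrder public
    using (total) renaming (refl to ≤-refl; trans to ≤-trans; antisym to ≤-antisym; reflexive to ≤-reflexive)

  +-nonneg : ∀ {x y} → 0ℝ ≤ x → 0ℝ ≤ y → 0ℝ ≤ x + y
  +-nonneg {x} {y} 0≤x 0≤y = ≤-trans 0≤y (≡.subst (_≤ x + y) (+-identityˡ y) (+-monoˡ-≤ y 0≤x))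

  x≤0⇒0≤-x : ∀ {x} → x ≤ 0ℝ → 0ℝ ≤ - x
  x≤0⇒0≤-x {x} x≤0 = ≡.subst₂ _≤_ (-‿inverseʳ x) (+-identityˡ (- x)) (+-monoˡ-≤ (- x) x≤0)

  0≤-x⇒x≤0 : ∀ {x} → 0ℝ ≤ - x → x ≤ 0ℝ
  0≤-x⇒x≤0 {x} 0≤-x = ≡.subst₂ _≤_ (+-identityˡ x) (-‿inverseˡ x) (+-monoˡ-≤ x 0≤-x)

  x≤y⇒0≤y-x : ∀ {x y} → x ≤ y → 0ℝ ≤ y + - x
  x≤y⇒0≤y-x {x} {y} x≤y = ≡.subst (_≤ y + - x) (-‿inverseʳ x) (+-monoˡ-≤ (- x) x≤y)

  square-nonneg : ∀ x → 0ℝ ≤ x * x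
  square-nonneg x with total 0ℝ x
  ... | inj₁ 0≤x = *-nonneg 0≤x 0≤x
  ... | inj₂ x≤0 = ≡.subst (0ℝ ≤_) (solve 1 (λ a → (:- a) :* (:- a) := a :* a) refl x)
                     (*-nonneg (x≤0⇒0≤-x x≤0) (x≤0⇒0≤-x x≤0))
    where open ℝ-Solver

  0≤1 : 0ℝ ≤ 1ℝ
  0≤1 = ≡.subst (0ℝ ≤_) (*-identityˡ 1ℝ) (square-nonneg 1ℝ)

  x+y≡0⇒x≡0 : ∀ {x y} → 0ℝ ≤ x → 0ℝ ≤ y → x + y ≡ 0ℝ → x ≡ 0ℝ
  x+y≡0⇒x≡0 {x} {y} 0≤x 0≤y x+y≡0 = ≤-antisym
    (≡.subst₂ _≤_ (+-identityˡ x) (trans (+-comm y x) x+y≡0) (+-monoˡ-≤ x 0≤y)) 0≤x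

  x+y≡0⇒y≡0 : ∀ {x y} → 0ℝ ≤ x → 0ℝ ≤ y → x + y ≡ 0ℝ → y ≡ 0ℝ
  x+y≡0⇒y≡0 0≤x 0≤y x+y≡0 = x+y≡0⇒x≡0 0≤y 0≤x (trans (+-comm _ _) x+y≡0)

  x+x≡0⇒x≡0 : ∀ {x} → x + x ≡ 0ℝ → x ≡ 0ℝ
  x+x≡0⇒x≡0 {x} x+x≡0 with total 0ℝ x
  ... | inj₁ 0≤x = x+y≡0⇒x≡0 0≤x 0≤x x+x≡0
  ... | inj₂ x≤0 = begin
    x            ≡⟨ solve 1 (λ a → a := (a :+ a) :+ :- a) refl x ⟩
    (x + x) + - x  ≡⟨ cong₂ _+_ x+x≡0 (x+y≡0⇒x≡0 0≤-x 0≤-x -x-x≡0) ⟩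
    0ℝ + 0ℝ      ≡⟨ +-identityˡ 0ℝ ⟩
    0ℝ           ∎
    where
    open ≡-Reasoning
    open ℝ-Solver
    0≤-x = x≤0⇒0≤-x x≤0
    -x-x≡0 : - x + - x ≡ 0ℝ
    -x-x≡0 = trans (solve 1 (λ a → :- a :+ :- a := :- (a :+ a)) refl x)
                   (trans (cong -_ x+x≡0) (solve 0 (:- con (ℤ.+ 0) := con (ℤ.+ 0)) refl))

  inverseˡ : ∀ x → x ≢ 0ℝ → x ⁻¹ * x ≡ 1ℝ
  inverseˡ x x≢0 = trans (*-comm _ _) (inverseʳ x x≢0)

  *-cancelˡ-0 : ∀ {x y} → x ≢ 0ℝ → x * y ≡ 0ℝ → y ≡ 0ℝ
  *-cancelˡ-0 {x} {y} x≢0 xy≡0 = begin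
    y               ≡⟨ *-identityˡ y ⟨
    1ℝ * y          ≡⟨ cong (_* y) (inverseˡ x x≢0) ⟨
    (x ⁻¹ * x) * y  ≡⟨ *-assoc _ _ _ ⟩
    x ⁻¹ * (x * y)  ≡⟨ cong (x ⁻¹ *_) xy≡0 ⟩
    x ⁻¹ * 0ℝ       ≡⟨ zeroʳ _ ⟩
    0ℝ              ∎
    where open ≡-Reasoning

  x*y≢0⇒y≢0 : ∀ {x y} → x * y ≢ 0ℝ → y ≢ 0ℝ
  x*y≢0⇒y≢0 xy≢0 refl = xy≢0 (zeroʳ _)

  ⁻¹-nonneg : ∀ {x} → 0ℝ ≤ x → x ≢ 0ℝ → 0ℝ ≤ x ⁻¹
  ⁻¹-nonneg {x} 0≤x x≢0 = ≡.subst (0ℝ ≤_)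
    (trans (sym (*-assoc _ _ _)) (trans (cong (_* x ⁻¹) (inverseʳ x x≢0)) (*-identityˡ _)))
    (*-nonneg 0≤x (square-nonneg (x ⁻¹)))

  -ᶜ_ : ℂ → ℂ
  -ᶜ z = (- re z) +i (- im z)

  ℂ-isCommutativeRing : IsCommutativeRing _≡_ _+ᶜ_ _*ᶜ_ -ᶜ_ 0ᶜ 1ᶜ
  ℂ-isCommutativeRing = record
    { isRing = record
      { +-isAbelianGroup = record
        { isGroup = record
          { isMonoid = record
            { isSemigroup = record
              { isMagma = record { isEquivalence = ≡.isEquivalence ; ∙-cong = cong₂ _+ᶜ_ }
              ; assoc = λ x y z → cong₂ _+i_ (+-assoc _ _ _) (+-assoc _ _ _) }
            ; identity = (λ x → cong₂ _+i_ (+-identityˡ _) (+-identityˡ _)) ,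
                         (λ x → cong₂ _+i_ (+-identityʳ _) (+-identityʳ _)) }
          ; inverse = (λ x → cong₂ _+i_ (-‿inverseˡ _) (-‿inverseˡ _)) ,
                      (λ x → cong₂ _+i_ (-‿inverseʳ _) (-‿inverseʳ _))
          ; ⁻¹-cong = cong -ᶜ_ }
        ; comm = λ x y → cong₂ _+i_ (+-comm _ _) (+-comm _ _) }
      ; *-cong = cong₂ _*ᶜ_
      ; *-assoc = λ (a +i b) (c +i d) (e +i f) → cong₂ _+i_
          (solve 6 (λ a b c d e f → (a :* c :+ :- (b :* d)) :* e :+ :- ((a :* d :+ b :* c) :* f) :=
                      a :* (c :* e :+ :- (d :* f)) :+ :- (b :* (c :* f :+ d :* e))) refl a b c d e f)
          (solve 6 (λ a b c d e f → (a :* c :+ :- (b :* d)) :* f :+ (a :* d :+ b :* c) :* e :=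
                      a :* (c :* f :+ d :* e) :+ b :* (c :* e :+ :- (d :* f))) refl a b c d e f)
      ; *-identity = (λ (a +i b) → ℂ-*-identityˡ a b) ,
                     (λ (a +i b) → trans (ℂ-*-comm (a +i b) 1ᶜ) (ℂ-*-identityˡ a b))
      ; distrib = (λ x y z → ℂ-distribˡ x y z) ,
                  (λ x y z → trans (ℂ-*-comm (y +ᶜ z) x) (trans (ℂ-distribˡ x y z)
                     (cong₂ _+ᶜ_ (ℂ-*-comm x y) (ℂ-*-comm x z)))) }
    ; *-comm = ℂ-*-comm }
    where
    open ℝ-Solver
    ℂ-*-comm : ∀ x y → x *ᶜ y ≡ y *ᶜ x
    ℂ-*-comm (a +i b) (c +i d) = cong₂ _+i_
      (solve 4 (λ a b c d → a :* c :+ :- (b :* d) := c :* a :+ :- (d :* b)) refl a b c d)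
      (solve 4 (λ a b c d → a :* d :+ b :* c := c :* b :+ d :* a) refl a b c d)
    ℂ-*-identityˡ : ∀ a b → 1ᶜ *ᶜ (a +i b) ≡ a +i b
    ℂ-*-identityˡ a b = cong₂ _+i_
      (solve 2 (λ a b → con (ℤ.+ 1) :* a :+ :- (con (ℤ.+ 0) :* b) := a) refl a b)
      (solve 2 (λ a b → con (ℤ.+ 1) :* b :+ con (ℤ.+ 0) :* a := b) refl a b)
    ℂ-distribˡ : ∀ x y z → x *ᶜ (y +ᶜ z) ≡ x *ᶜ y +ᶜ x *ᶜ z
    ℂ-distribˡ (a +i b) (c +i d) (e +i f) = cong₂ _+i_
      (solve 6 (λ a b c d e f → a :* (c :+ e) :+ :- (b :* (d :+ f)) :=
                  (a :* c :+ :- (b :* d)) :+ (a :* e :+ :- (b :* f))) refl a b c d e f)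
      (solve 6 (λ a b c d e f → a :* (d :+ f) :+ b :* (c :+ e) :=
                  (a :* d :+ b :* c) :+ (a :* f :+ b :* e)) refl a b c d e f)

  ℂ-ring : CommutativeRing 0ℓ 0ℓ
  ℂ-ring = record { isCommutativeRing = ℂ-isCommutativeRing }

  module ℂ-Solver = IntegerSolver ℂ-ring
  module ℂᵣ = CommutativeRing ℂ-ring

  conj-+ : ∀ x y → conj (x +ᶜ y) ≡ conj x +ᶜ conj y
  conj-+ (a +i b) (c +i d) = cong₂ _+i_ refl (solve 2 (λ b d → :- (b :+ d) := :- b :+ :- d) refl b d)
    where open ℝ-Solver

  conj-* : ∀ x y → conj (x *ᶜ y) ≡ conj x *ᶜ conj y
  conj-* (a +i b) (c +i d) = cong₂ _+i_
    (solve 4 (λ a b c d → a :* c :+ :- (b :* d) := a :* c :+ :- (:- b :* :- d)) refl a b c d)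
    (solve 4 (λ a b c d → :- (a :* d :+ b :* c) := a :* :- d :+ :- b :* c) refl a b c d)
    where open ℝ-Solver

  conj-conj : ∀ x → conj (conj x) ≡ x
  conj-conj (a +i b) = cong₂ _+i_ refl (solve 1 (λ b → :- :- b := b) refl b)
    where open ℝ-Solver

  ι : ℝ → ℂ
  ι x = x +i 0ℝ

  conj-ι : ∀ x → conj (ι x) ≡ ι x
  conj-ι x = cong (x +i_) (solve 0 (:- con (ℤ.+ 0) := con (ℤ.+ 0)) refl)
    where open ℝ-Solver

  ι-+ : ∀ x y → ι (x + y) ≡ ι x +ᶜ ι y
  ι-+ x y = cong₂ _+i_ refl (sym (+-identityˡ 0ℝ))

  ι-* : ∀ x y → ι (x * y) ≡ ι x *ᶜ ι y
  ι-* x y = cong₂ _+i_ (solve 2 (λ x y → x :* y := x :* y :+ :- (con (ℤ.+ 0) :* con (ℤ.+ 0))) refl x y)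
                       (solve 2 (λ x y → con (ℤ.+ 0) := x :* con (ℤ.+ 0) :+ con (ℤ.+ 0) :* y) refl x y)
    where open ℝ-Solver

  re-ι* : ∀ x z → re (ι x *ᶜ z) ≡ x * re z
  re-ι* x (c +i d) = solve 3 (λ x c d → x :* c :+ :- (con (ℤ.+ 0) :* d) := x :* c) refl x c d
    where open ℝ-Solver

  im-ι* : ∀ x z → im (ι x *ᶜ z) ≡ x * im z
  im-ι* x (c +i d) = solve 3 (λ x c d → x :* d :+ con (ℤ.+ 0) :* c := x :* d) refl x c d
    where open ℝ-Solver

  -- Complex matrices

  private
    ∑-zero : (f : Fin 0 → ℂ) → ∑ f ≡ 0ᶜ
    ∑-zero f = refl

    ∑-suc : ∀ {d} (f : Fin (ℕ.suc d) → ℂ) → ∑ f ≡ f Fin.zero +ᶜ ∑ (f ∘ Fin.suc)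
    ∑-suc f = refl

    entry-matrix : ∀ {d} (f : Fin d → Fin d → ℂ) i j → entry (matrix f) i j ≡ f i j
    entry-matrix f i j = trans (cong (λ v → lookup v j) (Vecₚ.lookup∘tabulate _ i)) (Vecₚ.lookup∘tabulate (f i) j)

    matrix-entry : ∀ {d} (A : Matrix d) → matrix (entry A) ≡ A
    matrix-entry A = trans (Vecₚ.tabulate-cong λ i → Vecₚ.tabulate∘lookup (lookup A i)) (Vecₚ.tabulate∘lookup A)

    matrix-ext : ∀ {d} {A B : Matrix d} → (∀ i j → entry A i j ≡ entry B i j) → A ≡ B
    matrix-ext {A = A} {B} A≗B = trans (sym (matrix-entry A))
      (trans (Vecₚ.tabulate-cong λ i → Vecₚ.tabulate-cong (A≗B i)) (matrix-entry B))

  module Mat = StarMatrices ℂ _+ᶜ_ _*ᶜ_ -ᶜ_ 0ᶜ 1ᶜ ℂ-isCommutativeRing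
    conj (conj-ι 0ℝ) conj-conj conj-+ conj-* ∑ ∑-zero ∑-suc Matrix matrix entry entry-matrix matrix-ext

  re-∑-nonneg : ∀ {d} (f : Fin d → ℂ) → (∀ i → 0ℝ ≤ re (f i)) → 0ℝ ≤ re (∑ f)
  re-∑-nonneg {ℕ.zero}  f 0≤f = ≤-refl
  re-∑-nonneg {ℕ.suc d} f 0≤f = +-nonneg (0≤f Fin.zero) (re-∑-nonneg (f ∘ Fin.suc) (0≤f ∘ Fin.suc))

  re-∑≡0 : ∀ {d} (f : Fin d → ℂ) → (∀ i → 0ℝ ≤ re (f i)) → re (∑ f) ≡ 0ℝ → ∀ i → re (f i) ≡ 0ℝ
  re-∑≡0 f 0≤f eq Fin.zero    = x+y≡0⇒x≡0 (0≤f Fin.zero) (re-∑-nonneg (f ∘ Fin.suc) (0≤f ∘ Fin.suc)) eq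
  re-∑≡0 f 0≤f eq (Fin.suc i) = re-∑≡0 (f ∘ Fin.suc) (0≤f ∘ Fin.suc)
    (x+y≡0⇒y≡0 (0≤f Fin.zero) (re-∑-nonneg (f ∘ Fin.suc) (0≤f ∘ Fin.suc)) eq) i

  -- `Mat.Linear` for real coefficients, since the coefficients that occur are weights and
  -- probabilities.
  Linear : ∀ {d e} → (Matrix d → Matrix e) → Set
  Linear L = ∀ a b A B → L (a ·ᴹ A +ᴹ b ·ᴹ B) ≡ a ·ᴹ L A +ᴹ b ·ᴹ L B

  conjugate : ∀ {d} → Matrix d → Matrix d → Matrix d
  conjugate K A = K *ᴹ A *ᴹ K †

  conjugate-linear : ∀ {d} (K : Matrix d) → Linear (conjugate K)
  conjugate-linear K a b = Mat.conjugate-linear K (ι a) (ι b)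

  ·ᴹ-assoc : ∀ {d} a b (A : Matrix d) → a ·ᴹ (b ·ᴹ A) ≡ (a * b) ·ᴹ A
  ·ᴹ-assoc a b A = trans (Mat.·-assoc (ι a) (ι b) A) (cong (λ z → matrix λ i j → z *ᶜ entry A i j) (sym (ι-* a b)))

  linear-· : ∀ {d e} (L : Matrix d → Matrix e) → Linear L → ∀ a A → L (a ·ᴹ A) ≡ a ·ᴹ L A
  linear-· L lin a A = begin
    L (a ·ᴹ A)                  ≡⟨ cong L (Mat.+ᴹ-identityʳ (a ·ᴹ A)) ⟨
    L (a ·ᴹ A +ᴹ 0ᴹ)            ≡⟨ cong (λ Z → L (a ·ᴹ A +ᴹ Z)) (Mat.·-zeroˡ A) ⟨
    L (a ·ᴹ A +ᴹ 0ℝ ·ᴹ A)       ≡⟨ lin a 0ℝ A A ⟩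
    a ·ᴹ L A +ᴹ 0ℝ ·ᴹ L A       ≡⟨ cong (a ·ᴹ L A +ᴹ_) (Mat.·-zeroˡ (L A)) ⟩
    a ·ᴹ L A +ᴹ 0ᴹ              ≡⟨ Mat.+ᴹ-identityʳ (a ·ᴹ L A) ⟩
    a ·ᴹ L A                    ∎
    where open ≡-Reasoning

  applyOp-linear : ∀ {N k} (E : SuperOp k) (qs : Vec (Fin N) k) → Linear (applyOp E qs)
  applyOp-linear E qs a b = Mat.sum-conjugate-linear (onQubits qs) (kraus E) (ι a) (ι b)

  re-trace-·+· : ∀ {d} a b (A B : Matrix d) → re (trace (a ·ᴹ A +ᴹ b ·ᴹ B)) ≡ a * re (trace A) + b * re (trace B)
  re-trace-·+· a b A B = trans (cong re (Mat.trace-·+· (ι a) (ι b) A B)) (cong₂ _+_ (re-ι* a (trace A)) (re-ι* b (trace B)))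

  re-trace-· : ∀ {d} a (A : Matrix d) → re (trace (a ·ᴹ A)) ≡ a * re (trace A)
  re-trace-· a A = trans (cong (re ∘ trace) (trans (sym (Mat.+ᴹ-identityʳ (a ·ᴹ A))) (cong (a ·ᴹ A +ᴹ_) (sym (Mat.·-zeroˡ A)))))
    (trans (re-trace-·+· a 0ℝ A A) (trans (cong (a * re (trace A) +_) (zeroˡ (re (trace A)))) (+-identityʳ (a * re (trace A)))))

  re-trace-sum : ∀ {d} (As : List (Matrix d)) → re (trace (sumᴹ As)) ≡ sumᴿ (map (re ∘ trace) As)
  re-trace-sum {d} []       = cong re (Mat.trace-0 d)
  re-trace-sum (A ∷ As) = trans (cong re (Mat.trace-+ A (sumᴹ As))) (cong (re (trace A) +_) (re-trace-sum As))

  conjugate-psd : ∀ {d} (K A : Matrix d) → PositiveSemidefinite A → PositiveSemidefinite (conjugate K A)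
  conjugate-psd {d} K A psd v = ≡.subst (λ z → im z ≡ 0ℝ × 0ℝ ≤ re z) (sym form≡) (psd (Vec.tabulate w))
    where
    w : Fin d → ℂ
    w j = ∑ λ l → entry (K †) j l *ᶜ lookup v l
    form≡ : ⟨ v ∣ conjugate K A ∣ v ⟩ ≡ ⟨ Vec.tabulate w ∣ A ∣ Vec.tabulate w ⟩
    form≡ = trans (Mat.form-conjugate K A (lookup v))
      (Mat.form-cong A (λ i → cong conj (sym (Vecₚ.lookup∘tabulate w i))) (λ i → sym (Vecₚ.lookup∘tabulate w i)))

  private
    conj-δ : ∀ {d} (i k : Fin d) → conj (Mat.δ i k) ≡ Mat.δ i k
    conj-δ i k with does (i Finₚ.≟ k)
    ... | true  = conj-ι 1ℝ
    ... | false = conj-ι 0ℝ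

    -- Positivity tested at the vector α e_i + β e_j.
    psd-δ-δ : ∀ {d} (A : Matrix d) → PositiveSemidefinite A → ∀ i j α β →
      let z = conj α *ᶜ (α *ᶜ entry A i i +ᶜ β *ᶜ entry A i j) +ᶜ conj β *ᶜ (α *ᶜ entry A j i +ᶜ β *ᶜ entry A j j) in
      im z ≡ 0ℝ × 0ℝ ≤ re z
    psd-δ-δ {d} A psd i j α β = ≡.subst (λ z → im z ≡ 0ℝ × 0ℝ ≤ re z) form≡ (psd (Vec.tabulate v))
      where
      v : Fin d → ℂ
      v k = α *ᶜ Mat.δ i k +ᶜ β *ᶜ Mat.δ j k
      conj-v : ∀ k → conj (v k) ≡ conj α *ᶜ Mat.δ i k +ᶜ conj β *ᶜ Mat.δ j k
      conj-v k = trans (conj-+ (α *ᶜ Mat.δ i k) (β *ᶜ Mat.δ j k)) (cong₂ _+ᶜ_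
        (trans (conj-* α (Mat.δ i k)) (cong (conj α *ᶜ_) (conj-δ i k)))
        (trans (conj-* β (Mat.δ j k)) (cong (conj β *ᶜ_) (conj-δ j k))))
      form≡ : ⟨ Vec.tabulate v ∣ A ∣ Vec.tabulate v ⟩ ≡
              conj α *ᶜ (α *ᶜ entry A i i +ᶜ β *ᶜ entry A i j) +ᶜ conj β *ᶜ (α *ᶜ entry A j i +ᶜ β *ᶜ entry A j j)
      form≡ = trans
        (Mat.form-cong A (λ k → trans (cong conj (Vecₚ.lookup∘tabulate v k)) (conj-v k)) (Vecₚ.lookup∘tabulate v))
        (Mat.form-δ-δ A i j (conj α) (conj β) α β)

    diagonal : ∀ {d} (A : Matrix d) → PositiveSemidefinite A → ∀ i → im (entry A i i) ≡ 0ℝ × 0ℝ ≤ re (entry A i i)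
    diagonal A psd i = ≡.subst (λ z → im z ≡ 0ℝ × 0ℝ ≤ re z)
      (trans (cong (λ u → u *ᶜ (1ᶜ *ᶜ entry A i i +ᶜ 0ᶜ *ᶜ entry A i i) +ᶜ conj 0ᶜ *ᶜ (1ᶜ *ᶜ entry A i i +ᶜ 0ᶜ *ᶜ entry A i i)) (conj-ι 1ℝ))
        (trans (cong (λ u → 1ᶜ *ᶜ (1ᶜ *ᶜ entry A i i +ᶜ 0ᶜ *ᶜ entry A i i) +ᶜ u *ᶜ (1ᶜ *ᶜ entry A i i +ᶜ 0ᶜ *ᶜ entry A i i)) (conj-ι 0ℝ))
          (solve 1 (λ a → con (ℤ.+ 1) :* (con (ℤ.+ 1) :* a :+ con (ℤ.+ 0) :* a) :+ con (ℤ.+ 0) :* (con (ℤ.+ 1) :* a :+ con (ℤ.+ 0) :* a) := a) refl (entry A i i))))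
      (psd-δ-δ A psd i i 1ᶜ 0ᶜ)
      where open ℂ-Solver

  trace-nonneg : ∀ {d} (A : Matrix d) → PositiveSemidefinite A → 0ℝ ≤ re (trace A)
  trace-nonneg A psd = re-∑-nonneg (λ i → entry A i i) (proj₂ ∘ diagonal A psd)

  -- The diagonal entries are nonnegative with sum zero, so they vanish. The form at e_i + z e_j is
  -- then z A_ij plus conj z times A_ji, which has to be real and nonnegative for every z. Writing
  -- A_ij = a + i b and A_ji = c + i d, the real parts at z = 1, -1, i, -i give a + c = 0 and d = b,
  -- and the imaginary parts at z = 1, i give b + d = 0 and a = c.
  psd∧trace≡0⇒≡0 : ∀ {d} (A : Matrix d) → PositiveSemidefinite A → re (trace A) ≡ 0ℝ → A ≡ 0ᴹ
  psd∧trace≡0⇒≡0 A psd tr≡0 = matrix-ext λ i j → trans (off i j) (sym (Mat.entry-0 i j))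
    where
    diag : ∀ i → entry A i i ≡ 0ᶜ
    diag i = cong₂ _+i_ (re-∑≡0 (λ i → entry A i i) (proj₂ ∘ diagonal A psd) tr≡0 i) (proj₁ (diagonal A psd i))
    off : ∀ i j → entry A i j ≡ 0ᶜ
    off i j = cong₂ _+i_ (x+x≡0⇒x≡0 a+a≡0) (x+x≡0⇒x≡0 b+b≡0)
      where
      open ℝ-Solver
      a = re (entry A i j)
      b = im (entry A i j)
      c = re (entry A j i)
      d = im (entry A j i)
      -- Here z = x + i y, and the vanishing diagonal entries are already replaced by zero.
      test : ∀ x y → let z = (conj 1ᶜ *ᶜ (1ᶜ *ᶜ 0ᶜ +ᶜ (x +i y) *ᶜ entry A i j) +ᶜ conj (x +i y) *ᶜ (1ᶜ *ᶜ entry A j i +ᶜ (x +i y) *ᶜ 0ᶜ)) in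
             im z ≡ 0ℝ × 0ℝ ≤ re z
      test x y = ≡.subst₂ (λ u v → let z = (conj 1ᶜ *ᶜ (1ᶜ *ᶜ u +ᶜ (x +i y) *ᶜ entry A i j) +ᶜ conj (x +i y) *ᶜ (1ᶜ *ᶜ entry A j i +ᶜ (x +i y) *ᶜ v)) in
             im z ≡ 0ℝ × 0ℝ ≤ re z) (diag i) (diag j) (psd-δ-δ A psd i j 1ᶜ (x +i y))
      test-re : ∀ x y → 0ℝ ≤ (x * a + - (y * b)) + (x * c + y * d)
      -- The polynomial spells out what `re` of the complex expression computes to; `:- O` is the
      -- imaginary part of `conj 1ᶜ`.
      test-re x y = ≡.subst (0ℝ ≤_) (solve 6 (λ x y a b c d →
          let I = con (ℤ.+ 1) ; O = con (ℤ.+ 0) in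
          I :* ((I :* O :+ :- (O :* O)) :+ (x :* a :+ :- (y :* b))) :+ :- (:- O :* ((I :* O :+ O :* O) :+ (x :* b :+ y :* a))) :+
          (x :* ((I :* c :+ :- (O :* d)) :+ (x :* O :+ :- (y :* O))) :+ :- (:- y :* ((I :* d :+ O :* c) :+ (x :* O :+ y :* O))))
          := (x :* a :+ :- (y :* b)) :+ (x :* c :+ y :* d)) refl x y a b c d) (proj₂ (test x y))
      test-im : ∀ x y → (x * b + y * a) + (x * d + - (y * c)) ≡ 0ℝ
      test-im x y = trans (sym (solve 6 (λ x y a b c d →
          let I = con (ℤ.+ 1) ; O = con (ℤ.+ 0) in
          I :* ((I :* O :+ O :* O) :+ (x :* b :+ y :* a)) :+ :- O :* ((I :* O :+ :- (O :* O)) :+ (x :* a :+ :- (y :* b))) :+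
          (x :* ((I :* d :+ O :* c) :+ (x :* O :+ y :* O)) :+ :- y :* ((I :* c :+ :- (O :* d)) :+ (x :* O :+ :- (y :* O))))
          := (x :* b :+ y :* a) :+ (x :* d :+ :- (y :* c))) refl x y a b c d)) (proj₁ (test x y))
      a+c≡0 : a + c ≡ 0ℝ
      a+c≡0 = ≤-antisym
        (0≤-x⇒x≤0 (≡.subst (0ℝ ≤_) (solve 4 (λ a b c d → (:- con (ℤ.+ 1) :* a :+ :- (con (ℤ.+ 0) :* b)) :+ (:- con (ℤ.+ 1) :* c :+ con (ℤ.+ 0) :* d) := :- (a :+ c)) refl a b c d) (test-re (- 1ℝ) 0ℝ)))
        (≡.subst (0ℝ ≤_) (solve 4 (λ a b c d → (con (ℤ.+ 1) :* a :+ :- (con (ℤ.+ 0) :* b)) :+ (con (ℤ.+ 1) :* c :+ con (ℤ.+ 0) :* d) := a :+ c) refl a b c d) (test-re 1ℝ 0ℝ))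
      d-b≡0 : d + - b ≡ 0ℝ
      d-b≡0 = ≤-antisym
        (0≤-x⇒x≤0 (≡.subst (0ℝ ≤_) (solve 4 (λ a b c d → (con (ℤ.+ 0) :* a :+ :- (:- con (ℤ.+ 1) :* b)) :+ (con (ℤ.+ 0) :* c :+ :- con (ℤ.+ 1) :* d) := :- (d :+ :- b)) refl a b c d) (test-re 0ℝ (- 1ℝ))))
        (≡.subst (0ℝ ≤_) (solve 4 (λ a b c d → (con (ℤ.+ 0) :* a :+ :- (con (ℤ.+ 1) :* b)) :+ (con (ℤ.+ 0) :* c :+ con (ℤ.+ 1) :* d) := d :+ :- b) refl a b c d) (test-re 0ℝ 1ℝ))
      b+d≡0 : b + d ≡ 0ℝ
      b+d≡0 = trans (solve 4 (λ a b c d → b :+ d := (con (ℤ.+ 1) :* b :+ con (ℤ.+ 0) :* a) :+ (con (ℤ.+ 1) :* d :+ :- (con (ℤ.+ 0) :* c))) refl a b c d) (test-im 1ℝ 0ℝ)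
      a-c≡0 : a + - c ≡ 0ℝ
      a-c≡0 = trans (solve 4 (λ a b c d → a :+ :- c := (con (ℤ.+ 0) :* b :+ con (ℤ.+ 1) :* a) :+ (con (ℤ.+ 0) :* d :+ :- (con (ℤ.+ 1) :* c))) refl a b c d) (test-im 0ℝ 1ℝ)
      a+a≡0 : a + a ≡ 0ℝ
      a+a≡0 = trans (solve 2 (λ a c → a :+ a := (a :+ c) :+ (a :+ :- c)) refl a c) (trans (cong₂ _+_ a+c≡0 a-c≡0) (+-identityˡ 0ℝ))
      b+b≡0 : b + b ≡ 0ℝ
      b+b≡0 = trans (solve 2 (λ b d → b :+ b := (b :+ d) :+ :- (d :+ :- b)) refl b d)
        (trans (cong₂ (λ u v → u + - v) b+d≡0 d-b≡0) (-‿inverseʳ 0ℝ))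

  -- Weighted lists

  module _ {A : Set} where
    private variable
      f g : A → ℝ
      Δ Δ′ Θ Θ′ : Weighted A

    expectation-++ : ∀ (f : A → ℝ) Δ Θ → expectation f (Δ ++ Θ) ≡ expectation f Δ + expectation f Θ
    expectation-++ f []            Θ = sym (+-identityˡ _)
    expectation-++ f ((w , a) ∷ Δ) Θ = trans (cong (w * f a +_) (expectation-++ f Δ Θ)) (sym (+-assoc _ _ _))

    expectation-scale : ∀ (f : A → ℝ) p Δ → expectation f (scale p Δ) ≡ p * expectation f Δ
    expectation-scale f p []            = sym (zeroʳ p)
    expectation-scale f p ((w , a) ∷ Δ) = trans (cong₂ _+_ (*-assoc p w (f a)) (expectation-scale f p Δ)) (sym (distribˡ p _ _))

    expectation-+ : ∀ (f g : A → ℝ) Δ → expectation (λ a → f a + g a) Δ ≡ expectation f Δ + expectation g Δ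
    expectation-+ f g []            = sym (+-identityˡ _)
    expectation-+ f g ((w , a) ∷ Δ) = trans (cong (w * (f a + g a) +_) (expectation-+ f g Δ))
      (solve 5 (λ w x y u v → w :* (x :+ y) :+ (u :+ v) := (w :* x :+ u) :+ (w :* y :+ v)) refl w (f a) (g a) (expectation f Δ) (expectation g Δ))
      where open ℝ-Solver

    expectation-* : ∀ c (f : A → ℝ) Δ → expectation (λ a → c * f a) Δ ≡ c * expectation f Δ
    expectation-* c f []            = sym (zeroʳ c)
    expectation-* c f ((w , a) ∷ Δ) = trans (cong (w * (c * f a) +_) (expectation-* c f Δ))
      (solve 4 (λ w c x u → w :* (c :* x) :+ c :* u := c :* (w :* x :+ u)) refl w c (f a) (expectation f Δ))
      where open ℝ-Solver

    Nonneg : Weighted A → Set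
    Nonneg = All (λ (w , _) → 0ℝ ≤ w)

    -- Entries of weight zero are exempt: impossible measurement outcomes stay in the list, with
    -- post-states that need not be density operators.
    Supported : (A → Set) → Weighted A → Set
    Supported Q = All (λ (w , a) → w ≢ 0ℝ → Q a)

    supported-map : ∀ {P Q : A → Set} → (∀ {a} → P a → Q a) → Supported P Δ → Supported Q Δ
    supported-map P⇒Q = All.map (P⇒Q ∘_)

    expectation-cong-supported : Supported (λ a → f a ≡ g a) Δ → expectation f Δ ≡ expectation g Δ
    expectation-cong-supported []                           = refl
    expectation-cong-supported {f} {g} {(w , a) ∷ Δ} (eq ∷ eqs) = cong₂ _+_ head (expectation-cong-supported eqs)
      where
      head : w * f a ≡ w * g a
      head with em₀ {w ≡ 0ℝ}
      ... | yes refl = trans (zeroˡ _) (sym (zeroˡ _))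
      ... | no w≢0   = cong (w *_) (eq w≢0)

    expectation-cong : (∀ a → f a ≡ g a) → ∀ Δ → expectation f Δ ≡ expectation g Δ
    expectation-cong f≗g Δ = expectation-cong-supported (All.universal (λ (_ , a) _ → f≗g a) Δ)

    expectation-zero : ∀ Δ → expectation (λ (_ : A) → 0ℝ) Δ ≡ 0ℝ
    expectation-zero []            = refl
    expectation-zero ((w , a) ∷ Δ) = trans (cong₂ _+_ (zeroʳ w) (expectation-zero Δ)) (+-identityˡ 0ℝ)

    expectation-nonneg : Nonneg Δ → (∀ a → 0ℝ ≤ f a) → 0ℝ ≤ expectation f Δ
    expectation-nonneg []           0≤f = ≤-refl
    expectation-nonneg (0≤w ∷ 0≤ws) 0≤f = +-nonneg (*-nonneg 0≤w (0≤f _)) (expectation-nonneg 0≤ws 0≤f)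

    expectation≡0⇒ : Nonneg Δ → (∀ a → 0ℝ ≤ f a) → expectation f Δ ≡ 0ℝ → Supported (λ a → f a ≡ 0ℝ) Δ
    expectation≡0⇒ []           0≤f eq = []
    expectation≡0⇒ (0≤w ∷ 0≤ws) 0≤f eq =
      (λ w≢0 → *-cancelˡ-0 w≢0 (x+y≡0⇒x≡0 (*-nonneg 0≤w (0≤f _)) (expectation-nonneg 0≤ws 0≤f) eq)) ∷
      expectation≡0⇒ 0≤ws 0≤f (x+y≡0⇒y≡0 (*-nonneg 0≤w (0≤f _)) (expectation-nonneg 0≤ws 0≤f) eq)

    totalWeight : Weighted A → ℝ
    totalWeight = expectation (λ _ → 1ℝ)

    total≡ : ∀ Δ → sumᴿ (map proj₁ Δ) ≡ totalWeight Δ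
    total≡ []            = refl
    total≡ ((w , a) ∷ Δ) = cong₂ _+_ (sym (*-identityʳ w)) (total≡ Δ)

    isDistribution : Nonneg Δ → totalWeight Δ ≡ 1ℝ → IsDistribution Δ
    isDistribution {Δ} 0≤Δ eq = 0≤Δ , trans (total≡ Δ) eq

    distribution-total : IsDistribution Δ → totalWeight Δ ≡ 1ℝ
    distribution-total {Δ} (_ , eq) = trans (sym (total≡ Δ)) eq

    point-isDistribution : ∀ (a : A) → IsDistribution (point a)
    point-isDistribution a = (0≤1 ∷ []) , +-identityʳ 1ℝ

    ≋-sym : Δ ≋ Θ → Θ ≋ Δ
    ≋-sym Δ≋Θ f = sym (Δ≋Θ f)

    ≡⇒≋ : Δ ≡ Θ → Δ ≋ Θ
    ≡⇒≋ refl f = refl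

    expectation-mix : ∀ (f : A → ℝ) p Δ Θ → expectation f (mix p Δ Θ) ≡ p * expectation f Δ + (1ℝ + - p) * expectation f Θ
    expectation-mix f p Δ Θ = trans (expectation-++ f (scale p Δ) _)
      (cong₂ _+_ (expectation-scale f p Δ) (expectation-scale f (1ℝ + - p) Θ))

    mix-cong : ∀ p → Δ ≋ Δ′ → Θ ≋ Θ′ → mix p Δ Θ ≋ mix p Δ′ Θ′
    mix-cong {Δ} {Δ′} {Θ} {Θ′} p eq eq′ f = trans (expectation-mix f p Δ Θ)
      (trans (cong₂ (λ x y → p * x + (1ℝ + - p) * y) (eq f) (eq′ f)) (sym (expectation-mix f p Δ′ Θ′)))

    scale-nonneg : ∀ {p} → 0ℝ ≤ p → Nonneg Δ → Nonneg (scale p Δ)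
    scale-nonneg 0≤p []           = []
    scale-nonneg 0≤p (0≤w ∷ 0≤ws) = *-nonneg 0≤p 0≤w ∷ scale-nonneg 0≤p 0≤ws

    scale-supported : ∀ {p} {Q : A → Set} → Supported Q Δ → Supported Q (scale p Δ)
    scale-supported []       = []
    scale-supported (q ∷ qs) = (q ∘ x*y≢0⇒y≢0) ∷ scale-supported qs

    mix-supported : ∀ {p} {Q : A → Set} → Supported Q Δ → Supported Q Θ → Supported Q (mix p Δ Θ)
    mix-supported qs qs′ = Allₚ.++⁺ (scale-supported qs) (scale-supported qs′)

    mix-isDistribution : ∀ {p} → 0ℝ ≤ p → p ≤ 1ℝ → IsDistribution Δ → IsDistribution Θ → IsDistribution (mix p Δ Θ)
    mix-isDistribution {Δ} {Θ} {p} 0≤p p≤1 δ θ = isDistribution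
      (Allₚ.++⁺ (scale-nonneg 0≤p (proj₁ δ)) (scale-nonneg (x≤y⇒0≤y-x p≤1) (proj₁ θ)))
      (trans (expectation-mix _ p Δ Θ) (trans (cong₂ (λ x y → p * x + (1ℝ + - p) * y) (distribution-total δ) (distribution-total θ))
        (solve 1 (λ p → p :* con (ℤ.+ 1) :+ (con (ℤ.+ 1) :+ :- p) :* con (ℤ.+ 1) := con (ℤ.+ 1)) refl p)))
      where open ℝ-Solver

    𝟙 : (A → Set) → A → ℝ
    𝟙 Q a = if does (em₀ {Q a}) then 1ℝ else 0ℝ

    𝟙-yes : ∀ {Q : A → Set} {a} → Q a → 𝟙 Q a ≡ 1ℝ
    𝟙-yes q = cong (if_then 1ℝ else 0ℝ) (dec-true em₀ q)

    𝟙-no : ∀ {Q : A → Set} {a} → ¬ Q a → 𝟙 Q a ≡ 0ℝ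
    𝟙-no ¬q = cong (if_then 1ℝ else 0ℝ) (dec-false em₀ ¬q)

    𝟙-nonneg : ∀ (Q : A → Set) a → 0ℝ ≤ 𝟙 Q a
    𝟙-nonneg Q a with does (em₀ {Q a})
    ... | true  = 0≤1
    ... | false = ≤-refl

    -- Whether a list is supported in Q depends on its entries, while `≋` sees only expectations.
    -- The indicator of the complement of Q bridges the two: its expectation vanishes on Θ, hence on
    -- Δ, where nonnegative weights cannot cancel.
    supported-≋ : ∀ {Q : A → Set} → Nonneg Δ → Δ ≋ Θ → Supported Q Θ → Supported Q Δ
    supported-≋ {Δ} {Θ} {Q} 0≤Δ Δ≋Θ q = supported-map 𝟙≡0⇒ (expectation≡0⇒ 0≤Δ (𝟙-nonneg (¬_ ∘ Q))
      (trans (Δ≋Θ (𝟙 (¬_ ∘ Q))) (trans (expectation-cong-supported {g = λ _ → 0ℝ} (supported-map (λ q → 𝟙-no {Q = ¬_ ∘ Q} (λ ¬q → ¬q q)) q)) (expectation-zero Θ))))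
      where
      𝟙≡0⇒ : ∀ {a} → 𝟙 (¬_ ∘ Q) a ≡ 0ℝ → Q a
      𝟙≡0⇒ {a} eq with em₀ {Q a}
      ... | yes q = q
      ... | no ¬q = contradiction (trans (sym eq) (𝟙-yes {Q = ¬_ ∘ Q} ¬q)) 0≢1

    weight : ∀ (Q : A → Set) Δ → Weight Q Δ (expectation (𝟙 Q) Δ)
    weight Q []            = []
    weight Q ((w , a) ∷ Δ) with em₀ {Q a}
    ... | yes q = ≡.subst (Weight Q _) (cong (_+ expectation (𝟙 Q) Δ) (sym (*-identityʳ w))) (here q (weight Q Δ))
    ... | no ¬q = ≡.subst (Weight Q _) (trans (sym (+-identityˡ _)) (cong (_+ expectation (𝟙 Q) Δ) (sym (zeroʳ w)))) (there ¬q (weight Q Δ))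

    weight-unique : ∀ {Q : A → Set} {p} → Weight Q Δ p → p ≡ expectation (𝟙 Q) Δ
    weight-unique [] = refl
    weight-unique {Q = Q} (here {w} {a} q ws) = cong₂ _+_ (trans (sym (*-identityʳ w)) (cong (w *_) (sym (𝟙-yes {Q = Q} q)))) (weight-unique ws)
    weight-unique {Δ = _ ∷ Δ} {Q = Q} (there {w} {a} ¬q ws) = trans (weight-unique ws)
      (trans (sym (+-identityˡ _)) (cong (_+ expectation (𝟙 Q) Δ) (trans (sym (zeroʳ w)) (cong (w *_) (sym (𝟙-no {Q = Q} ¬q))))))

    -- Reduces the comparison of `Weight` relations, and so of barbs, to one equation between
    -- expectations.
    weight-⇔ : ∀ {Q : A → Set} → expectation (𝟙 Q) Δ ≡ expectation (𝟙 Q) Θ → ∀ p → Weight Q Δ p ⇔ Weight Q Θ p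
    weight-⇔ {Δ} {Θ} {Q} eq p = mk⇔
      (λ ws → ≡.subst (Weight Q Θ) (sym (trans (weight-unique ws) eq)) (weight Q Θ))
      (λ ws → ≡.subst (Weight Q Δ) (sym (trans (weight-unique ws) (sym eq))) (weight Q Δ))

    weight-⇔⁻¹ : ∀ {Q : A → Set} → (∀ p → Weight Q Δ p ⇔ Weight Q Θ p) → expectation (𝟙 Q) Δ ≡ expectation (𝟙 Q) Θ
    weight-⇔⁻¹ {Δ} {Θ} {Q} eqv = weight-unique (Equivalence.to (eqv _) (weight Q Δ))

    mass : A → Weighted A → ℝ
    mass a = expectation (𝟙 (_≡ a))

    mass-nonneg : ∀ {a} → Nonneg Δ → 0ℝ ≤ mass a Δ
    mass-nonneg 0≤Δ = expectation-nonneg 0≤Δ (𝟙-nonneg (_≡ _))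

    mass≡0⇒ : Nonneg Δ → ∀ {a} → mass a Δ ≡ 0ℝ → Supported (_≢ a) Δ
    mass≡0⇒ 0≤Δ {a} eq = supported-map (λ 𝟙≡0 b≡a → 0≢1 (trans (sym 𝟙≡0) (𝟙-yes {Q = _≡ a} b≡a))) (expectation≡0⇒ 0≤Δ (𝟙-nonneg (_≡ a)) eq)

    -- The mass of an element is at least the weight of any single entry for it, because the other
    -- entries are nonnegative.
    mass-supported : Nonneg Δ → Supported (λ a → mass a Δ ≢ 0ℝ) Δ
    mass-supported {Δ} 0≤Δ = go 0≤Δ
      where
      go : ∀ {Θ} → Nonneg Θ → Supported (λ a → mass a Θ ≢ 0ℝ) Θ
      go [] = []
      go {(w , a) ∷ Θ} 0≤wΘ@(0≤w ∷ 0≤Θ) =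
        (λ w≢0 m≡0 → All.head (mass≡0⇒ 0≤wΘ m≡0) w≢0 refl) ∷
        supported-map (λ {b} m≢0 m≡0 → m≢0 (x+y≡0⇒y≡0 (*-nonneg 0≤w (𝟙-nonneg (_≡ b) a)) (mass-nonneg 0≤Θ) m≡0)) (go 0≤Θ)

  expectation-mapᵂ : ∀ {A B : Set} (f : B → ℝ) (g : A → B) Δ → expectation f (mapᵂ g Δ) ≡ expectation (f ∘ g) Δ
  expectation-mapᵂ f g []            = refl
  expectation-mapᵂ f g ((w , a) ∷ Δ) = cong (w * f (g a) +_) (expectation-mapᵂ f g Δ)

  mapᵂ-nonneg : ∀ {A B : Set} (g : A → B) {Δ} → Nonneg Δ → Nonneg (mapᵂ g Δ)
  mapᵂ-nonneg g = Allₚ.map⁺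

  mapᵂ-isDistribution : ∀ {A B : Set} (g : A → B) {Δ} → IsDistribution Δ → IsDistribution (mapᵂ g Δ)
  mapᵂ-isDistribution g {Δ} δ = isDistribution (mapᵂ-nonneg g (proj₁ δ)) (trans (expectation-mapᵂ _ g Δ) (distribution-total δ))

  mapᵂ-supported : ∀ {A B : Set} {Q : B → Set} {g : A → B} {Δ} → Supported (Q ∘ g) Δ → Supported Q (mapᵂ g Δ)
  mapᵂ-supported = Allₚ.map⁺

  mapᵂ-supported⁻ : ∀ {A B : Set} {Q : B → Set} {g : A → B} {Δ} → Supported Q (mapᵂ g Δ) → Supported (Q ∘ g) Δ
  mapᵂ-supported⁻ = Allₚ.map⁻

  mapᵂ-≋ : ∀ {A B : Set} (g : A → B) {Δ Θ} → Δ ≋ Θ → mapᵂ g Δ ≋ mapᵂ g Θ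
  mapᵂ-≋ g {Δ} {Θ} Δ≋Θ f = trans (expectation-mapᵂ f g Δ) (trans (Δ≋Θ (f ∘ g)) (sym (expectation-mapᵂ f g Θ)))

  mapᵂ-mix : ∀ {A B : Set} (g : A → B) p Δ Θ → mapᵂ g (mix p Δ Θ) ≋ mix p (mapᵂ g Δ) (mapᵂ g Θ)
  mapᵂ-mix g p Δ Θ f = trans (expectation-mapᵂ f g (mix p Δ Θ)) (trans (expectation-mix (f ∘ g) p Δ Θ)
    (trans (sym (cong₂ (λ x y → p * x + (1ℝ + - p) * y) (expectation-mapᵂ f g Δ) (expectation-mapᵂ f g Θ)))
      (sym (expectation-mix f p (mapᵂ g Δ) (mapᵂ g Θ)))))

  expectation-swap : ∀ {A B : Set} (k : A → B → ℝ) Δ Θ →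
    expectation (λ a → expectation (k a) Θ) Δ ≡ expectation (λ b → expectation (λ a → k a b) Δ) Θ
  expectation-swap k []            Θ = sym (expectation-zero Θ)
  expectation-swap k ((w , a) ∷ Δ) Θ = trans
    (cong₂ _+_ (sym (expectation-* w (k a) Θ)) (expectation-swap k Δ Θ))
    (sym (expectation-+ (λ b → w * k a b) (λ b → expectation (λ a → k a b) Δ) Θ))

  -- Convertible with the combination in the `target` field of `_⟿[_]_`; the component in A keeps
  -- the source of each part at hand.
  bind : ∀ {A B : Set} → Weighted (A × Weighted B) → Weighted B
  bind = concatMap (λ (w , _ , Ξ) → scale w Ξ)

  module _ {A B : Set} where
    expectation-bind : ∀ (f : B → ℝ) (L : Weighted (A × Weighted B)) →
                       expectation f (bind L) ≡ expectation (λ (_ , Ξ) → expectation f Ξ) L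
    expectation-bind f []                = refl
    expectation-bind f ((w , a , Ξ) ∷ L) = trans (expectation-++ f (scale w Ξ) (bind L))
      (cong₂ _+_ (expectation-scale f w Ξ) (expectation-bind f L))

    bind-supported : ∀ {Q : B → Set} {L : Weighted (A × Weighted B)} → Supported (λ (_ , Ξ) → Supported Q Ξ) L → Supported Q (bind L)
    bind-supported [] = []
    bind-supported {Q} {(w , _ , Ξ) ∷ L} (q ∷ qs) = Allₚ.++⁺ head (bind-supported qs)
      where
      head : Supported Q (scale w Ξ)
      head with em₀ {w ≡ 0ℝ}
      ... | yes refl = Allₚ.map⁺ (All.universal (λ _ 0*v≢0 → contradiction (zeroˡ _) 0*v≢0) Ξ)
      ... | no w≢0   = scale-supported (q w≢0)

    bind-isDistribution : ∀ {L : Weighted (A × Weighted B)} → Nonneg L → totalWeight L ≡ 1ℝ →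
                          Supported (λ (_ , Ξ) → IsDistribution Ξ) L → IsDistribution (bind L)
    bind-isDistribution {L} 0≤L total≡1 dist = isDistribution (nonneg 0≤L dist)
      (trans (expectation-bind (λ _ → 1ℝ) L) (trans (expectation-cong-supported (supported-map distribution-total dist)) total≡1))
      where
      nonneg : ∀ {L : Weighted (A × Weighted B)} → Nonneg L → Supported (λ (_ , Ξ) → IsDistribution Ξ) L → Nonneg (bind L)
      nonneg [] [] = []
      nonneg {(w , _ , Ξ) ∷ L} (0≤w ∷ 0≤L) (d ∷ ds) = Allₚ.++⁺ head (nonneg 0≤L ds)
        where
        head : Nonneg (scale w Ξ)
        head with em₀ {w ≡ 0ℝ}
        ... | yes refl = Allₚ.map⁺ (All.universal (λ _ → ≤-reflexive (sym (zeroˡ _))) Ξ)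
        ... | no w≢0   = scale-nonneg 0≤w (proj₁ (d w≢0))

  -- Reweighting a ↦ mass a Θ / mass a Δ turns any list equivalent to Δ into one
  -- equivalent to Θ, provided that Θ is absolutely continuous with respect to Δ.
  reweight : ∀ {A : Set} {Δ Θ S : Weighted A} → Δ ≋ S → Supported (λ a → mass a Δ ≢ 0ℝ) Θ →
             ∀ f → expectation (λ a → (mass a Θ * mass a Δ ⁻¹) * f a) S ≡ expectation f Θ
  reweight {A} {Δ} {Θ} {S} Δ≋S Θ≪Δ f = begin
    expectation (λ a → (mass a Θ * mass a Δ ⁻¹) * f a) S                               ≡⟨ Δ≋S _ ⟨
    expectation (λ a → (mass a Θ * mass a Δ ⁻¹) * f a) Δ                               ≡⟨ expectation-cong (λ a → trans (*-assoc _ _ _) (*-comm _ _)) Δ ⟩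
    expectation (λ a → (mass a Δ ⁻¹ * f a) * mass a Θ) Δ                               ≡⟨ expectation-cong (λ a → sym (expectation-* _ _ Θ)) Δ ⟩
    -- Once the mass of a under Θ is written as an expectation, the sum runs over pairs (a , b) and
    -- only the diagonal contributes, so a may be replaced by b in the factor in front.
    expectation (λ a → expectation (λ b → (mass a Δ ⁻¹ * f a) * 𝟙 (_≡ a) b) Θ) Δ       ≡⟨ expectation-cong (λ a → expectation-cong (λ b → exchange a b) Θ) Δ ⟩
    expectation (λ a → expectation (λ b → (mass b Δ ⁻¹ * f b) * 𝟙 (_≡ b) a) Θ) Δ       ≡⟨ expectation-swap _ Δ Θ ⟩
    expectation (λ b → expectation (λ a → (mass b Δ ⁻¹ * f b) * 𝟙 (_≡ b) a) Δ) Θ       ≡⟨ expectation-cong (λ b → expectation-* _ _ Δ) Θ ⟩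
    expectation (λ b → (mass b Δ ⁻¹ * f b) * mass b Δ) Θ                               ≡⟨ expectation-cong-supported (supported-map cancel Θ≪Δ) ⟩
    expectation f Θ                                                                    ∎
    where
    open ≡-Reasoning
    exchange : ∀ a b → (mass a Δ ⁻¹ * f a) * 𝟙 (_≡ a) b ≡ (mass b Δ ⁻¹ * f b) * 𝟙 (_≡ b) a
    exchange a b = by-cases em₀
      where
      by-cases : Dec (a ≡ b) → (mass a Δ ⁻¹ * f a) * 𝟙 (_≡ a) b ≡ (mass b Δ ⁻¹ * f b) * 𝟙 (_≡ b) a
      by-cases (yes refl) = refl
      by-cases (no a≢b)   = trans (trans (cong (_ *_) (𝟙-no {Q = _≡ a} (a≢b ∘ sym))) (zeroʳ _))
                              (sym (trans (cong (_ *_) (𝟙-no {Q = _≡ b} a≢b)) (zeroʳ _)))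
    cancel : ∀ {b} → mass b Δ ≢ 0ℝ → (mass b Δ ⁻¹ * f b) * mass b Δ ≡ f b
    cancel {b} m≢0 = trans (*-comm _ _) (trans (sym (*-assoc _ _ _)) (trans (cong (_* f b) (inverseʳ _ m≢0)) (*-identityˡ _)))

  -- Moves of well-typed configurations lead to distributions

  all-lookup : ∀ {A : Set} {P : A → Set} {n} (xs : Vec A n) → All P (Vec.toList xs) → ∀ l → P (lookup xs l)
  all-lookup (x ∷ xs) (px ∷ pxs) Fin.zero    = px
  all-lookup (x ∷ xs) (px ∷ pxs) (Fin.suc l) = all-lookup xs pxs l

  unique-lookup : ∀ {A : Set} {n} (xs : Vec A n) → Unique (Vec.toList xs) → ∀ l m → lookup xs l ≡ lookup xs m → l ≡ m
  unique-lookup (x ∷ xs) (x∉ ∷ u) Fin.zero    Fin.zero    eq = refl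
  unique-lookup (x ∷ xs) (x∉ ∷ u) Fin.zero    (Fin.suc m) eq = contradiction eq (all-lookup xs x∉ m)
  unique-lookup (x ∷ xs) (x∉ ∷ u) (Fin.suc l) Fin.zero    eq = contradiction (sym eq) (all-lookup xs x∉ l)
  unique-lookup (x ∷ xs) (x∉ ∷ u) (Fin.suc l) (Fin.suc m) eq = cong Fin.suc (unique-lookup xs u l m eq)

  map-var-injective : ∀ {m n} {xs ys : Vec (Fin m) n} → Vec.map {B = Expr m} var xs ≡ Vec.map var ys → xs ≡ ys
  map-var-injective {xs = []}     {[]}     eq = refl
  map-var-injective {xs = x ∷ xs} {y ∷ ys} eq with Vecₚ.∷-injective eq
  ... | refl , eq′ = cong (x ∷_) (map-var-injective eq′)

  tabulate-lookup : ∀ {A B : Set} {n} (g : A → B) (xs : Vec A n) → List.tabulate (λ m → g (lookup xs m)) ≡ map g (Vec.toList xs)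
  tabulate-lookup g []       = refl
  tabulate-lookup g (x ∷ xs) = cong (g x ∷_) (tabulate-lookup g xs)

  module _ {N k : ℕ} {A : Set} (𝕄 : Measurement k) (qs : Vec (Fin N) k) (ρ : State N) (f : ℕ → A) where
    -- Probabilities are traces of positive matrices, hence nonnegative, and completeness makes
    -- their sum the trace of ρ. Distinctness of the qubits is what lets completeness survive the
    -- embedding.
    measure-isDistribution : IsDensity ρ → Unique (Vec.toList qs) → IsDistribution (measure 𝕄 qs ρ f)
    measure-isDistribution (psd , tr) uniq = Allₚ.tabulate⁺ nonneg , (begin
      sumᴿ (map proj₁ (measure 𝕄 qs ρ f))                              ≡⟨ cong sumᴿ (Listₚ.map-tabulate {n = outcomes 𝕄} _ proj₁) ⟩
      sumᴿ (List.tabulate (probability 𝕄 qs ρ))                        ≡⟨ cong sumᴿ (tabulate-lookup prob (operator 𝕄)) ⟩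
      sumᴿ (map prob (Vec.toList (operator 𝕄)))                        ≡⟨ cong sumᴿ (Listₚ.map-∘ (Vec.toList (operator 𝕄))) ⟩
      sumᴿ (map (re ∘ trace) (map branch (Vec.toList (operator 𝕄))))   ≡⟨ re-trace-sum (map branch (Vec.toList (operator 𝕄))) ⟨
      re (trace (sumᴹ (map branch (Vec.toList (operator 𝕄)))))         ≡⟨ cong re (Mat.trace-complete qs (unique-lookup qs uniq) (Vec.toList (operator 𝕄)) (Measurement.complete 𝕄) ρ) ⟩
      re (trace ρ)                                                     ≡⟨ cong re tr ⟩
      1ℝ                                                               ∎)
      where
      open ≡-Reasoning
      branch : Matrix (2 ℕ.^ k) → State N
      branch K = conjugate (onQubits qs K) ρ
      prob : Matrix (2 ℕ.^ k) → ℝ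
      prob K = re (trace (branch K))
      nonneg : ∀ m → 0ℝ ≤ probability 𝕄 qs ρ m
      nonneg m = trace-nonneg (branch (lookup (operator 𝕄) m)) (conjugate-psd (onQubits qs (lookup (operator 𝕄) m)) ρ psd)

  module _ {N : ℕ} where
    -- Measurement is the only source of nontrivial weights. Its typing rule provides distinct
    -- qubits, and injectivity of `var` identifies them with those of the transition rule.
    ⟶-isDistribution : ∀ {ρ : State N} {P : Proc N} {Δ Θ} → IsDensity ρ → Θ ⊩ P → (ρ , P) ⟶ Δ → IsDistribution Δ
    ⟶-isDistribution δ ⊢P τ∙ = point-isDistribution _
    ⟶-isDistribution δ ⊢P (op qs eq) = point-isDistribution _
    ⟶-isDistribution {ρ} δ ⌊ mea xs eq (uniq , _) _ ⌋ (mea {𝕄 = 𝕄} {P = P} qs eq′) =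
      measure-isDistribution 𝕄 qs ρ (λ m → P [ nat m ]) δ (≡.subst (Unique ∘ Vec.toList) (map-var-injective (trans (sym eq) eq′)) uniq)
    ⟶-isDistribution δ ⌊ ⊢K ⊕ ⊢L ⌋ (sumˡ s) = ⟶-isDistribution δ ⌊ ⊢K ⌋ s
    ⟶-isDistribution δ ⌊ ⊢K ⊕ ⊢L ⌋ (sumʳ s) = ⟶-isDistribution δ ⌊ ⊢L ⌋ s
    ⟶-isDistribution δ ⊢P (comˡ _ _) = point-isDistribution _
    ⟶-isDistribution δ ⊢P (comʳ _ _) = point-isDistribution _
    ⟶-isDistribution δ (par _ _ _ _ ⊢P ⊢Q) (parˡ s) = mapᵂ-isDistribution _ (⟶-isDistribution δ ⊢P s)
    ⟶-isDistribution δ (par _ _ _ _ ⊢P ⊢Q) (parʳ s) = mapᵂ-isDistribution _ (⟶-isDistribution δ ⊢Q s)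
    ⟶-isDistribution δ (⊢P ∖ c) (res s) = mapᵂ-isDistribution _ (⟶-isDistribution δ ⊢P s)
    ⟶-isDistribution δ (cond _ ⊢P ⊢Q) (true _ s) = ⟶-isDistribution δ ⊢P s
    ⟶-isDistribution δ (cond _ ⊢P ⊢Q) (false _ s) = ⟶-isDistribution δ ⊢Q s

    ↝-isDistribution : ∀ {ρ : State N} {P R : Proc N} {π Δ Θ₁ Θ₂} → IsDensity ρ → Θ₁ ⊩ P → Θ₂ ⊩ R →
                       ⟪ ρ , P , R ⟫ ↝[ π ] Δ → IsDistribution Δ
    ↝-isDistribution δ ⊢P ⊢R (proc s) = mapᵂ-isDistribution _ (⟶-isDistribution δ ⊢P s)
    ↝-isDistribution δ ⊢P ⊢R (op qs eq) = point-isDistribution _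
    ↝-isDistribution {ρ} δ ⊢P ⌊ mea xs eq (uniq , _) _ ⌋ (mea {𝕄 = 𝕄} {R = R} qs eq′) = mapᵂ-isDistribution _
      (measure-isDistribution 𝕄 qs ρ (λ m → R [ nat m ]) δ (≡.subst (Unique ∘ Vec.toList) (map-var-injective (trans (sym eq) eq′)) uniq))
    ↝-isDistribution δ ⊢P ⊢R (send _ _) = point-isDistribution _
    ↝-isDistribution δ ⊢P ⊢R (recv _ _) = point-isDistribution _
    ↝-isDistribution δ ⊢P (par _ _ _ _ ⊢R ⊢S) (parˡ s) = mapᵂ-isDistribution _ (↝-isDistribution δ ⊢P ⊢R s)
    ↝-isDistribution δ ⊢P (par _ _ _ _ ⊢R ⊢S) (parʳ s) = mapᵂ-isDistribution _ (↝-isDistribution δ ⊢P ⊢S s)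
    ↝-isDistribution δ ⊢P (cond _ ⊢R ⊢S) (true _ s) = ↝-isDistribution δ ⊢P ⊢R s
    ↝-isDistribution δ ⊢P (cond _ ⊢R ⊢S) (false _ s) = ↝-isDistribution δ ⊢P ⊢S s

    ⇝-isDistribution : ∀ {C π Δ} {Θ : Subset N} → Θ ⊢ᶜ C → C ⇝[ π ] Δ → IsDistribution Δ
    ⇝-isDistribution (conf _ _ _ _ δ ⊢P ⊢R _) (move s) = ↝-isDistribution δ ⊢P ⊢R s
    ⇝-isDistribution ⊢C                       (deadlock _) = point-isDistribution _

  -- Typing under contexts

  ∪-≡∅ : ∀ {n} (p q : Subset n) → p ∪ q ≡ ∅ → p ≡ ∅ × q ≡ ∅
  ∪-≡∅ []          []          eq = refl , refl
  ∪-≡∅ (false ∷ p) (false ∷ q) eq with ∪-≡∅ p q (Vecₚ.∷-injectiveʳ eq)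
  ... | refl , refl = refl , refl

  ∪-disjoint : ∀ {n} (p q s : Subset n) → (p ∪ q) ∩ s ≡ ∅ → p ∩ s ≡ ∅ × q ∩ s ≡ ∅
  ∪-disjoint p q s eq = ∪-≡∅ (p ∩ s) (q ∩ s) (trans (sym (Subsetₚ.∩-distribʳ-∪ s p q)) eq)

  disjoint-∪ : ∀ {n} (p q s : Subset n) → p ∩ q ≡ ∅ → p ∩ s ≡ ∅ → p ∩ (q ∪ s) ≡ ∅
  disjoint-∪ p q s eq eq′ = trans (Subsetₚ.∩-distribˡ-∪ p q s) (trans (cong₂ _∪_ eq eq′) (Subsetₚ.∪-identityˡ ∅))

  module _ {N : ℕ} where
    plug-typed : ∀ {Θ Θ′ : Subset N} {R C} → Context Θ Θ′ R → Θ ⊢ᶜ C → Θ ∪ Θ′ ⊢ᶜ plug R C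
    plug-typed ctx ⊥ = ⊥
    plug-typed {Θ′ = Θ′} ctx (conf Θ₁ Θ₂ refl Θ₁∩Θ₂≡∅ δ ⊢P ⊢S obs) with ∪-disjoint Θ₁ Θ₂ Θ′ (Context.disjoint ctx)
    ... | Θ₁∩Θ′≡∅ , Θ₂∩Θ′≡∅ = conf Θ₁ (Θ₂ ∪ Θ′) (Subsetₚ.∪-assoc Θ₁ Θ₂ Θ′) (disjoint-∪ Θ₁ Θ₂ Θ′ Θ₁∩Θ₂≡∅ Θ₁∩Θ′≡∅)
      δ ⊢P (par Θ₂ Θ′ refl Θ₂∩Θ′≡∅ ⊢S (Context.typed ctx)) (obs ∥ Context.isObserver ctx)

    ‖-typed : ∀ {Θ Θ′ : Subset N} {R Δ} → Context Θ Θ′ R → Θ ⊢ᵈ Δ → Θ ∪ Θ′ ⊢ᵈ Δ ‖ R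
    ‖-typed ctx (dist , ⊢Δ) = mapᵂ-isDistribution (plug _) dist , mapᵂ-supported (supported-map (plug-typed ctx) ⊢Δ)

    -- An observer R followed by a context S is traded for the single context `R ∥ S`, through which
    -- the result for the observer `𝟎` is transferred to R.
    ∥-context : ∀ {Θ Θ′ Θ″ : Subset N} {R S} → IsObserver R → Θ′ ⊩ R → Θ ∩ Θ′ ≡ ∅ → Context (Θ ∪ Θ′) Θ″ S → Context Θ (Θ′ ∪ Θ″) (R ∥ S)
    ∥-context {Θ} {Θ′} {Θ″} obs ⊢R Θ∩Θ′≡∅ ctx with ∪-disjoint Θ Θ′ Θ″ (Context.disjoint ctx)
    ... | Θ∩Θ″≡∅ , Θ′∩Θ″≡∅ = record
      { isObserver = obs ∥ Context.isObserver ctx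
      ; typed      = par Θ′ Θ″ refl Θ′∩Θ″≡∅ ⊢R (Context.typed ctx)
      ; disjoint   = disjoint-∪ Θ Θ′ Θ″ Θ∩Θ′≡∅ Θ∩Θ″≡∅ }

  -- Lifted transitions

  module _ {N : ℕ} where
    Transitions : Set
    Transitions = Weighted (Conf N × Dist N)

    Moves : Index → Transitions → Set
    Moves π = All (λ (_ , C , Ξ) → C ⇝[ π ] Ξ)

    ⟿-resp-≋ : ∀ {π} {X X′ Y Y′ : Dist N} → X ≋ X′ → Y ≋ Y′ → IsDistribution Y′ → X ⟿[ π ] Y → X′ ⟿[ π ] Y′
    ⟿-resp-≋ {X = X} {X′} {Y} {Y′} X≋X′ Y≋Y′ dist s = record
      { parts = parts ; nonneg = nonneg ; moves = moves
      ; source = λ f → trans (sym (X≋X′ f)) (source f)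
      ; isDistribution = dist
      ; target = λ f → trans (sym (Y≋Y′ f)) (target f) }
      where open _⟿[_]_ s

    -- The typing of X passes to every source of nonzero weight, and moves of typed configurations
    -- end in distributions; this settles the field `isDistribution`.
    bind-⟿ : ∀ {π Θ} {X : Dist N} (L : Transitions) → Θ ⊢ᵈ X → Nonneg L → Moves π L → X ≋ mapᵂ proj₁ L → X ⟿[ π ] bind L
    bind-⟿ {π} {Θ} {X} L (dist , ⊢X) 0≤L mv eq = record
      { parts = L ; nonneg = 0≤L ; moves = mv ; source = eq
      ; isDistribution = bind-isDistribution 0≤L total≡1 (typed 0≤L mv (mapᵂ-supported⁻ {g = proj₁} ⊢L))
      ; target = λ f → refl }
      where
      ⊢L : Supported (Θ ⊢ᶜ_) (mapᵂ proj₁ L)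
      ⊢L = supported-≋ (mapᵂ-nonneg proj₁ 0≤L) (≋-sym {Δ = X} {mapᵂ proj₁ L} eq) ⊢X
      total≡1 : totalWeight L ≡ 1ℝ
      total≡1 = trans (sym (expectation-mapᵂ (λ _ → 1ℝ) proj₁ L)) (trans (sym (eq (λ _ → 1ℝ))) (distribution-total dist))
      typed : ∀ {L : Transitions} → Nonneg L → Moves π L → Supported (λ (C , _) → Θ ⊢ᶜ C) L → Supported (λ (_ , Ξ) → IsDistribution Ξ) L
      typed [] [] [] = []
      typed (_ ∷ 0≤L) (m ∷ mv) (⊢C ∷ ⊢L) = (λ w≢0 → ⇝-isDistribution (⊢C w≢0) m) ∷ typed 0≤L mv ⊢L

    some-⇝ : ∀ (C : Conf N) π → ∃[ Ξ ] C ⇝[ π ] Ξ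
    some-⇝ C π with em₀ {∃[ Ξ ] C ↝[ π ] Ξ}
    ... | yes (Ξ , s) = Ξ , move s
    ... | no ¬s       = point ⊥ , deadlock λ Ξ s → ¬s (Ξ , s)

    -- For a component whose coefficient in a mixture is zero: a transition of the mixture says
    -- nothing about it, and any transition will do.
    some-⟿ : ∀ {Θ} {X : Dist N} → Θ ⊢ᵈ X → ∀ π → ∃[ Y ] X ⟿[ π ] Y
    some-⟿ {X = X} ⊢X@((0≤X , _) , _) π = bind L , bind-⟿ L ⊢X (Allₚ.map⁺ 0≤X) (Allₚ.map⁺ (All.universal (λ (_ , C) → proj₂ (some-⇝ C π)) X))
      (λ f → trans (expectation-cong (λ _ → refl) X) (trans (sym (expectation-mapᵂ (f ∘ proj₁) (λ C → C , proj₁ (some-⇝ C π)) X)) (sym (expectation-mapᵂ f proj₁ L))))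
      where
      L : Transitions
      L = mapᵂ (λ C → C , proj₁ (some-⇝ C π)) X

    mix-⟿ : ∀ {π p} {X₁ X₂ Y₁ Y₂ : Dist N} → 0ℝ ≤ p → p ≤ 1ℝ → X₁ ⟿[ π ] Y₁ → X₂ ⟿[ π ] Y₂ → mix p X₁ X₂ ⟿[ π ] mix p Y₁ Y₂
    mix-⟿ {π} {p} {X₁} {X₂} {Y₁} {Y₂} 0≤p p≤1 s₁ s₂ = record
      { parts = mix p S₁.parts S₂.parts
      ; nonneg = Allₚ.++⁺ (scale-nonneg 0≤p S₁.nonneg) (scale-nonneg (x≤y⇒0≤y-x p≤1) S₂.nonneg)
      ; moves = Allₚ.++⁺ (Allₚ.map⁺ S₁.moves) (Allₚ.map⁺ S₂.moves)
      ; source = λ f → trans (mix-cong {Δ = X₁} {mapᵂ proj₁ S₁.parts} {X₂} {mapᵂ proj₁ S₂.parts} p S₁.source S₂.source f) (sym (mapᵂ-mix proj₁ p S₁.parts S₂.parts f))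
      ; isDistribution = mix-isDistribution 0≤p p≤1 S₁.isDistribution S₂.isDistribution
      ; target = λ f → trans (mix-cong {Δ = Y₁} {bind S₁.parts} {Y₂} {bind S₂.parts} p S₁.target S₂.target f) (trans (expectation-mix f p (bind S₁.parts) (bind S₂.parts))
          (trans (cong₂ (λ x y → p * x + (1ℝ + - p) * y) (expectation-bind f S₁.parts) (expectation-bind f S₂.parts))
            (trans (sym (expectation-mix (λ (_ , Ξ) → expectation f Ξ) p S₁.parts S₂.parts)) (sym (expectation-bind f (mix p S₁.parts S₂.parts)))))) }
      where
      module S₁ = _⟿[_]_ s₁
      module S₂ = _⟿[_]_ s₂

    rescale : (Conf N → ℝ) → Transitions → Transitions
    rescale h = map λ (w , C , Ξ) → w * h C , C , Ξ

    expectation-rescale : ∀ f h L → expectation f (rescale h L) ≡ expectation (λ (C , Ξ) → h C * f (C , Ξ)) L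
    expectation-rescale f h []                = refl
    expectation-rescale f h ((w , C , Ξ) ∷ L) = cong₂ _+_ (*-assoc w (h C) (f (C , Ξ))) (expectation-rescale f h L)

    rescale-nonneg : ∀ {h L} → Nonneg L → Supported (λ (C , _) → 0ℝ ≤ h C) L → Nonneg (rescale h L)
    rescale-nonneg [] [] = []
    rescale-nonneg {h} {(w , C , Ξ) ∷ L} (0≤w ∷ 0≤L) (0≤h ∷ 0≤hs) = head ∷ rescale-nonneg 0≤L 0≤hs
      where
      head : 0ℝ ≤ w * h C
      head with em₀ {w ≡ 0ℝ}
      ... | yes refl = ≤-reflexive (sym (zeroˡ _))
      ... | no w≢0   = *-nonneg 0≤w (0≤h w≢0)

    module _ {π : Index} {X Y : Dist N} (0≤X : Nonneg X) (s : X ⟿[ π ] Y) where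
      open _⟿[_]_ s

      -- The density of E with respect to X, a Radon-Nikodym derivative. Where X has no mass its
      -- value is unspecified; `source-mass≢0` keeps parts of nonzero weight away from there.
      ratio : Dist N → Conf N → ℝ
      ratio E C = mass C E * mass C X ⁻¹

      source-mass≢0 : Supported (λ (C , _) → mass C X ≢ 0ℝ) parts
      source-mass≢0 = mapᵂ-supported⁻ {g = proj₁} (supported-≋ (mapᵂ-nonneg proj₁ nonneg) (≋-sym {Δ = X} {mapᵂ proj₁ parts} source) (mass-supported 0≤X))

      -- Every part keeps its move and only changes its weight, so E resolves its choices as X does
      -- in s.
      reweight-⟿ : ∀ {Θ} {E : Dist N} → Θ ⊢ᵈ E → Supported (λ C → mass C X ≢ 0ℝ) E → E ⟿[ π ] bind (rescale (ratio E) parts)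
      reweight-⟿ {E = E} ⊢E E≪X = bind-⟿ (rescale (ratio E) parts) ⊢E
        (rescale-nonneg nonneg (supported-map (λ m≢0 → *-nonneg (mass-nonneg (proj₁ (proj₁ ⊢E))) (⁻¹-nonneg (mass-nonneg 0≤X) m≢0)) source-mass≢0))
        (Allₚ.map⁺ moves)
        (λ f → trans (sym (reweight {Δ = X} {E} {mapᵂ proj₁ parts} source E≪X f)) (trans (expectation-mapᵂ (λ C → ratio E C * f C) proj₁ parts)
          (trans (sym (expectation-rescale (f ∘ proj₁) (ratio E) parts)) (sym (expectation-mapᵂ f proj₁ (rescale (ratio E) parts))))))

    -- Stated through masses, so that it serves for the second component as well, with 1 - p in the
    -- place of p.
    mix-≪ : ∀ {p} {E F X : Dist N} → 0ℝ ≤ p → p ≢ 0ℝ → p ≤ 1ℝ → Nonneg E → Nonneg F →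
            (∀ C → mass C X ≡ p * mass C E + (1ℝ + - p) * mass C F) → Supported (λ C → mass C X ≢ 0ℝ) E
    mix-≪ 0≤p p≢0 p≤1 0≤E 0≤F eq = supported-map (λ {C} m≢0 m≡0 → m≢0 (*-cancelˡ-0 p≢0 (x+y≡0⇒x≡0
      (*-nonneg 0≤p (mass-nonneg 0≤E)) (*-nonneg (x≤y⇒0≤y-x p≤1) (mass-nonneg 0≤F)) (trans (sym (eq C)) m≡0)))) (mass-supported 0≤E)

    -- The parts of the given transition need not separate into parts of X₁ and parts of X₂. When
    -- both coefficients are nonzero, each component is absolutely continuous with respect to the
    -- mixture and takes its share of every part by its density. A component with coefficient zero
    -- may have mass outside the mixture, so it moves on its own.
    mix-⟿⁻ : ∀ {π p Θ} {X₁ X₂ Y : Dist N} → 0ℝ ≤ p → p ≤ 1ℝ → Θ ⊢ᵈ X₁ → Θ ⊢ᵈ X₂ → mix p X₁ X₂ ⟿[ π ] Y →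
             ∃[ Y₁ ] ∃[ Y₂ ] (X₁ ⟿[ π ] Y₁ × X₂ ⟿[ π ] Y₂ × Y ≋ mix p Y₁ Y₂)
    mix-⟿⁻ {π} {p} {X₁ = X₁} {X₂} {Y} 0≤p p≤1 ⊢X₁ ⊢X₂ s with em₀ {p ≡ 0ℝ} | em₀ {1ℝ + - p ≡ 0ℝ}
    ... | yes refl | _ = let Y₁ , s₁ = some-⟿ ⊢X₁ π in
      Y₁ , Y , s₁ , ⟿-resp-≋ (mix-0 X₁ X₂) (λ f → refl) (_⟿[_]_.isDistribution s) s , λ f → sym (mix-0 Y₁ Y f)
      where
      mix-0 : ∀ Δ Θ → mix 0ℝ Δ Θ ≋ Θ
      mix-0 Δ Θ f = trans (expectation-mix f 0ℝ Δ Θ)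
        (solve 2 (λ x y → con (ℤ.+ 0) :* x :+ (con (ℤ.+ 1) :+ :- con (ℤ.+ 0)) :* y := y) refl (expectation f Δ) (expectation f Θ))
        where open ℝ-Solver
    ... | no p≢0 | yes 1-p≡0 = let Y₂ , s₂ = some-⟿ ⊢X₂ π in
      Y , Y₂ , ⟿-resp-≋ (mix-1 X₁ X₂) (λ f → refl) (_⟿[_]_.isDistribution s) s , s₂ , λ f → sym (mix-1 Y Y₂ f)
      where
      mix-1 : ∀ Δ Θ → mix p Δ Θ ≋ Δ
      mix-1 Δ Θ f = trans (expectation-mix f p Δ Θ) (trans (cong (λ q → p * expectation f Δ + q * expectation f Θ) 1-p≡0)
        (trans (cong (λ q → q * expectation f Δ + 0ℝ * expectation f Θ) (trans (solve 1 (λ p → p := con (ℤ.+ 1) :+ :- (con (ℤ.+ 1) :+ :- p)) refl p) (cong (λ q → 1ℝ + - q) 1-p≡0)))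
          (solve 2 (λ x y → (con (ℤ.+ 1) :+ :- con (ℤ.+ 0)) :* x :+ con (ℤ.+ 0) :* y := x) refl (expectation f Δ) (expectation f Θ))))
        where open ℝ-Solver
    ... | no p≢0 | no 1-p≢0 =
      bind (rescale r₁ parts) , bind (rescale r₂ parts) ,
      reweight-⟿ 0≤X s ⊢X₁ (mix-≪ {F = X₂} {X} 0≤p p≢0 p≤1 0≤X₁ 0≤X₂ massX) ,
      reweight-⟿ 0≤X s ⊢X₂ (mix-≪ {F = X₁} {X} (x≤y⇒0≤y-x p≤1) 1-p≢0 1-p≤1 0≤X₂ 0≤X₁ massX′) ,
      λ f → begin
        expectation f Y                                                             ≡⟨ target f ⟩
        expectation f (bind parts)                                                  ≡⟨ expectation-bind f parts ⟩
        expectation (λ (_ , Ξ) → expectation f Ξ) parts                             ≡⟨ expectation-cong-supported (supported-map (λ {(C , Ξ)} → split C (expectation f Ξ)) (source-mass≢0 0≤X s)) ⟩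
        expectation (λ (C , Ξ) → p * (r₁ C * expectation f Ξ) + (1ℝ + - p) * (r₂ C * expectation f Ξ)) parts
          ≡⟨ trans (expectation-+ _ _ parts) (cong₂ _+_ (expectation-* p _ parts) (expectation-* (1ℝ + - p) _ parts)) ⟩
        p * expectation (λ (C , Ξ) → r₁ C * expectation f Ξ) parts + (1ℝ + - p) * expectation (λ (C , Ξ) → r₂ C * expectation f Ξ) parts
          ≡⟨ cong₂ (λ x y → p * x + (1ℝ + - p) * y) (part r₁ f) (part r₂ f) ⟨
        p * expectation f (bind (rescale r₁ parts)) + (1ℝ + - p) * expectation f (bind (rescale r₂ parts))
          ≡⟨ expectation-mix f p (bind (rescale r₁ parts)) (bind (rescale r₂ parts)) ⟨
        expectation f (mix p (bind (rescale r₁ parts)) (bind (rescale r₂ parts))) ∎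
      where
      open ≡-Reasoning
      open ℝ-Solver
      open _⟿[_]_ s
      X = mix p X₁ X₂
      0≤X₁ = proj₁ (proj₁ ⊢X₁)
      0≤X₂ = proj₁ (proj₁ ⊢X₂)
      0≤X : Nonneg X
      0≤X = proj₁ (mix-isDistribution 0≤p p≤1 (proj₁ ⊢X₁) (proj₁ ⊢X₂))
      r₁ = ratio 0≤X s X₁
      r₂ = ratio 0≤X s X₂
      1-p≤1 : 1ℝ + - p ≤ 1ℝ
      1-p≤1 = ≡.subst₂ _≤_ (solve 1 (λ p → con (ℤ.+ 0) :+ (con (ℤ.+ 1) :+ :- p) := con (ℤ.+ 1) :+ :- p) refl p)
        (solve 1 (λ p → p :+ (con (ℤ.+ 1) :+ :- p) := con (ℤ.+ 1)) refl p) (+-monoˡ-≤ (1ℝ + - p) 0≤p)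
      massX : ∀ C → mass C X ≡ p * mass C X₁ + (1ℝ + - p) * mass C X₂
      massX C = expectation-mix (𝟙 (_≡ C)) p X₁ X₂
      massX′ : ∀ C → mass C X ≡ (1ℝ + - p) * mass C X₂ + (1ℝ + - (1ℝ + - p)) * mass C X₁
      massX′ C = trans (massX C) (solve 3 (λ p x y → p :* x :+ (con (ℤ.+ 1) :+ :- p) :* y := (con (ℤ.+ 1) :+ :- p) :* y :+ (con (ℤ.+ 1) :+ :- (con (ℤ.+ 1) :+ :- p)) :* x) refl p (mass C X₁) (mass C X₂))
      -- The two densities, weighted by p and 1 - p, add up to one wherever X has mass, so the
      -- shares recombine into the original part.
      split : ∀ C x → mass C X ≢ 0ℝ → x ≡ p * (r₁ C * x) + (1ℝ + - p) * (r₂ C * x)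
      split C x m≢0 = begin
        x                                                                       ≡⟨ *-identityˡ x ⟨
        1ℝ * x                                                                  ≡⟨ cong (_* x) (inverseʳ (mass C X) m≢0) ⟨
        (mass C X * mass C X ⁻¹) * x                                            ≡⟨ cong (λ m → (m * mass C X ⁻¹) * x) (massX C) ⟩
        ((p * mass C X₁ + (1ℝ + - p) * mass C X₂) * mass C X ⁻¹) * x
          ≡⟨ solve 6 (λ p q a b c x → ((p :* a :+ q :* b) :* c) :* x := p :* ((a :* c) :* x) :+ q :* ((b :* c) :* x)) refl p (1ℝ + - p) (mass C X₁) (mass C X₂) (mass C X ⁻¹) x ⟩
        p * (r₁ C * x) + (1ℝ + - p) * (r₂ C * x)                                ∎
      part : ∀ h f → expectation f (bind (rescale h parts)) ≡ expectation (λ (C , Ξ) → h C * expectation f Ξ) parts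
      part h f = trans (expectation-bind f (rescale h parts)) (expectation-rescale (λ (_ , Ξ) → expectation f Ξ) h parts)

  -- Bisimilarity

  module _ {N : ℕ} where
    sameBarbs : ∀ {Δ Θ : Dist N} → (∀ c → expectation (𝟙 (Barb c)) Δ ≡ expectation (𝟙 (Barb c)) Θ) →
                expectation (𝟙 (_≡ ⊥)) Δ ≡ expectation (𝟙 (_≡ ⊥)) Θ → SameBarbs Δ Θ
    sameBarbs {Δ} {Θ} eq eq⊥ = (λ c → weight-⇔ {Δ = Δ} {Θ} (eq c)) , weight-⇔ {Δ = Δ} {Θ} eq⊥

    sameBarbs-≋ : ∀ {Δ Θ : Dist N} → Δ ≋ Θ → SameBarbs Δ Θ
    sameBarbs-≋ {Δ} {Θ} eq = sameBarbs {Δ} {Θ} (λ c → eq _) (eq _)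

    sameBarbs-trans : ∀ {Δ Θ Ξ : Dist N} → SameBarbs Δ Θ → SameBarbs Θ Ξ → SameBarbs Δ Ξ
    sameBarbs-trans (b , d) (b′ , d′) = (λ c p → ⇔-trans (b c p) (b′ c p)) , λ p → ⇔-trans (d p) (d′ p)

    sameBarbs-mix : ∀ p {Δ Δ′ Θ Θ′ : Dist N} → SameBarbs Δ Δ′ → SameBarbs Θ Θ′ → SameBarbs (mix p Δ Θ) (mix p Δ′ Θ′)
    sameBarbs-mix p {Δ} {Δ′} {Θ} {Θ′} (b , d) (b′ , d′) = sameBarbs {mix p Δ Θ} {mix p Δ′ Θ′}
      (λ c → mixed (weight-⇔⁻¹ {Δ = Δ} {Δ′} (b c)) (weight-⇔⁻¹ {Δ = Θ} {Θ′} (b′ c)))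
      (mixed (weight-⇔⁻¹ {Δ = Δ} {Δ′} d) (weight-⇔⁻¹ {Δ = Θ} {Θ′} d′))
      where
      mixed : ∀ {f} → expectation f Δ ≡ expectation f Δ′ → expectation f Θ ≡ expectation f Θ′ →
              expectation f (mix p Δ Θ) ≡ expectation f (mix p Δ′ Θ′)
      mixed {f} eq eq′ = trans (expectation-mix f p Δ Θ)
        (trans (cong₂ (λ x y → p * x + (1ℝ + - p) * y) eq eq′) (sym (expectation-mix f p Δ′ Θ′)))

    typed-≋ : ∀ {Θ} {Δ Δ′ : Dist N} → IsDistribution Δ′ → Δ′ ≋ Δ → Θ ⊢ᵈ Δ → Θ ⊢ᵈ Δ′
    typed-≋ {Δ = Δ} {Δ′} dist eq (_ , ⊢Δ) = dist , supported-≋ {Δ = Δ′} {Δ} (proj₁ dist) eq ⊢Δ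

    ∼-typedˡ : ∀ {Θ} {Δ₁ Δ₂ : Dist N} → Δ₁ ∼cs[ Θ ] Δ₂ → Θ ⊢ᵈ Δ₁
    ∼-typedˡ (ℛ , bis , rel) = proj₁ (IsBisimulation.typed bis rel)

    ∼-typedʳ : ∀ {Θ} {Δ₁ Δ₂ : Dist N} → Δ₁ ∼cs[ Θ ] Δ₂ → Θ ⊢ᵈ Δ₂
    ∼-typedʳ (ℛ , bis , rel) = proj₂ (IsBisimulation.typed bis rel)

    ∼-barbs : ∀ {Θ} {Δ₁ Δ₂ : Dist N} → Δ₁ ∼cs[ Θ ] Δ₂ → ∀ {Θ′ R} → Context Θ Θ′ R → SameBarbs (Δ₁ ‖ R) (Δ₂ ‖ R)
    ∼-barbs (ℛ , bis , rel) = IsBisimulation.barbs bis rel _ _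

    ∼-forth : ∀ {Θ} {Δ₁ Δ₂ : Dist N} → Δ₁ ∼cs[ Θ ] Δ₂ → ∀ {Θ′ R} → Context Θ Θ′ R → ∀ {π Δ₁′} → Δ₁ ‖ R ⟿[ π ] Δ₁′ →
              ∃[ Δ₂′ ] (Δ₂ ‖ R ⟿[ π ] Δ₂′ × Δ₁′ ∼cs[ Θ ∪ Θ′ ] Δ₂′)
    ∼-forth (ℛ , bis , rel) ctx s with IsBisimulation.forth bis rel _ _ ctx _ _ s
    ... | _ , s′ , rel′ = _ , s′ , ℛ , bis , rel′

    ∼-back : ∀ {Θ} {Δ₁ Δ₂ : Dist N} → Δ₁ ∼cs[ Θ ] Δ₂ → ∀ {Θ′ R} → Context Θ Θ′ R → ∀ {π Δ₂′} → Δ₂ ‖ R ⟿[ π ] Δ₂′ →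
             ∃[ Δ₁′ ] (Δ₁ ‖ R ⟿[ π ] Δ₁′ × Δ₁′ ∼cs[ Θ ∪ Θ′ ] Δ₂′)
    ∼-back (ℛ , bis , rel) ctx s with IsBisimulation.back bis rel _ _ ctx _ _ s
    ... | _ , s′ , rel′ = _ , s′ , ℛ , bis , rel′

    ∼-trans : ∀ {Θ} {Δ₁ Δ₂ Δ₃ : Dist N} → Δ₁ ∼cs[ Θ ] Δ₂ → Δ₂ ∼cs[ Θ ] Δ₃ → Δ₁ ∼cs[ Θ ] Δ₃
    ∼-trans (ℛ , bisℛ , rel) (𝒮 , bis𝒮 , rel′) = 𝒯 , bis , _ , rel , rel′
      where
      module ℛ = IsBisimulation bisℛ
      module 𝒮 = IsBisimulation bis𝒮
      𝒯 : TypedRel N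
      𝒯 Θ Δ₁ Δ₃ = ∃[ Δ₂ ] (ℛ Θ Δ₁ Δ₂ × 𝒮 Θ Δ₂ Δ₃)
      bis : IsBisimulation 𝒯
      bis = record
        { typed = λ (_ , rel , rel′) → proj₁ (ℛ.typed rel) , proj₂ (𝒮.typed rel′)
        ; barbs = λ {Δ₁ = Δ₁} {Δ₃} (Δ₂ , rel , rel′) Θ′ R ctx →
            sameBarbs-trans {Δ₁ ‖ R} {Δ₂ ‖ R} {Δ₃ ‖ R} (ℛ.barbs rel Θ′ R ctx) (𝒮.barbs rel′ Θ′ R ctx)
        ; forth = λ (_ , rel , rel′) Θ′ R ctx π Δ₁′ s →
            let Δ₂′ , s₂ , rel₂ = ℛ.forth rel Θ′ R ctx π Δ₁′ s
                Δ₃′ , s₃ , rel₃ = 𝒮.forth rel′ Θ′ R ctx π Δ₂′ s₂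
            in Δ₃′ , s₃ , Δ₂′ , rel₂ , rel₃
        ; back = λ (_ , rel , rel′) Θ′ R ctx π Δ₃′ s →
            let Δ₂′ , s₂ , rel₂ = 𝒮.back rel′ Θ′ R ctx π Δ₃′ s
                Δ₁′ , s₁ , rel₁ = ℛ.back rel Θ′ R ctx π Δ₂′ s₂
            in Δ₁′ , s₁ , Δ₂′ , rel₁ , rel₂
        }

    -- `≋` lets weights cancel and so does not preserve nonnegativity of the listed weights; hence
    -- the relation records that the left side is a distribution.
    ∼-respˡ-≋ : ∀ {Θ} {Δ₁ Δ₁′ Δ₂ : Dist N} → IsDistribution Δ₁′ → Δ₁′ ≋ Δ₁ → Δ₁ ∼cs[ Θ ] Δ₂ → Δ₁′ ∼cs[ Θ ] Δ₂
    ∼-respˡ-≋ dist eq (ℛ , bisℛ , rel) = 𝒯 , bis , dist , _ , eq , rel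
      where
      module ℛ = IsBisimulation bisℛ
      𝒯 : TypedRel N
      𝒯 Θ Δ₁′ Δ₂ = IsDistribution Δ₁′ × ∃[ Δ₁ ] (Δ₁′ ≋ Δ₁ × ℛ Θ Δ₁ Δ₂)
      bis : IsBisimulation 𝒯
      bis = record
        { typed = λ (dist , _ , eq , rel) → typed-≋ dist eq (proj₁ (ℛ.typed rel)) , proj₂ (ℛ.typed rel)
        ; barbs = λ {Δ₁ = Δ₁′} {Δ₂} (_ , Δ₁ , eq , rel) Θ′ R ctx → sameBarbs-trans {Δ₁′ ‖ R} {Δ₁ ‖ R} {Δ₂ ‖ R}
            (sameBarbs-≋ {Δ₁′ ‖ R} {Δ₁ ‖ R} (mapᵂ-≋ (plug R) {Δ₁′} {Δ₁} eq)) (ℛ.barbs rel Θ′ R ctx)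
        ; forth = λ {Δ₁ = Δ₁′} (_ , Δ₁ , eq , rel) Θ′ R ctx π Ξ s →
            let Ξ₂ , s₂ , rel₂ = ℛ.forth rel Θ′ R ctx π Ξ
                  (⟿-resp-≋ {X = Δ₁′ ‖ R} {Δ₁ ‖ R} {Ξ} {Ξ} (mapᵂ-≋ (plug R) {Δ₁′} {Δ₁} eq) (λ f → refl) (_⟿[_]_.isDistribution s) s)
            in Ξ₂ , s₂ , _⟿[_]_.isDistribution s , Ξ , (λ f → refl) , rel₂
        ; back = λ {Δ₁ = Δ₁′} (_ , Δ₁ , eq , rel) Θ′ R ctx π Ξ₂ s →
            let Ξ , s₁ , rel₁ = ℛ.back rel Θ′ R ctx π Ξ₂ s
            in Ξ , ⟿-resp-≋ {X = Δ₁ ‖ R} {Δ₁′ ‖ R} {Ξ} {Ξ} (λ f → sym (mapᵂ-≋ (plug R) {Δ₁′} {Δ₁} eq f)) (λ f → refl) (_⟿[_]_.isDistribution s₁) s₁ ,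
               _⟿[_]_.isDistribution s₁ , Ξ , (λ f → refl) , rel₁
        }

    mix-‖-⟿ : ∀ {Θ Θ′ π p R} {Δ₁ Δ₂ Y : Dist N} → 0ℝ ≤ p → p ≤ 1ℝ → Context Θ Θ′ R → Θ ⊢ᵈ Δ₁ → Θ ⊢ᵈ Δ₂ → mix p Δ₁ Δ₂ ‖ R ⟿[ π ] Y →
              ∃[ Y₁ ] ∃[ Y₂ ] (Δ₁ ‖ R ⟿[ π ] Y₁ × Δ₂ ‖ R ⟿[ π ] Y₂ × Y ≋ mix p Y₁ Y₂)
    mix-‖-⟿ {p = p} {R} {Δ₁} {Δ₂} {Y} 0≤p p≤1 ctx ⊢Δ₁ ⊢Δ₂ s = mix-⟿⁻ 0≤p p≤1 (‖-typed ctx ⊢Δ₁) (‖-typed ctx ⊢Δ₂)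
      (⟿-resp-≋ {X = mix p Δ₁ Δ₂ ‖ R} {mix p (Δ₁ ‖ R) (Δ₂ ‖ R)} {Y} {Y} (mapᵂ-mix (plug R) p Δ₁ Δ₂) (λ f → refl) (_⟿[_]_.isDistribution s) s)

    ‖-mix-⟿ : ∀ {π p R} {Δ₁ Δ₂ Y₁ Y₂ : Dist N} → 0ℝ ≤ p → p ≤ 1ℝ → Δ₁ ‖ R ⟿[ π ] Y₁ → Δ₂ ‖ R ⟿[ π ] Y₂ → mix p Δ₁ Δ₂ ‖ R ⟿[ π ] mix p Y₁ Y₂
    ‖-mix-⟿ {p = p} {R} {Δ₁} {Δ₂} {Y₁} {Y₂} 0≤p p≤1 s₁ s₂ = let s = mix-⟿ 0≤p p≤1 s₁ s₂ in
      ⟿-resp-≋ {X = mix p (Δ₁ ‖ R) (Δ₂ ‖ R)} {mix p Δ₁ Δ₂ ‖ R} {mix p Y₁ Y₂} {mix p Y₁ Y₂} (λ f → sym (mapᵂ-mix (plug R) p Δ₁ Δ₂ f)) (λ f → refl) (_⟿[_]_.isDistribution s) s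

    mix-typed : ∀ {Θ p} {Δ₁ Δ₂ : Dist N} → 0ℝ ≤ p → p ≤ 1ℝ → Θ ⊢ᵈ Δ₁ → Θ ⊢ᵈ Δ₂ → Θ ⊢ᵈ mix p Δ₁ Δ₂
    mix-typed 0≤p p≤1 (d₁ , ⊢Δ₁) (d₂ , ⊢Δ₂) = mix-isDistribution 0≤p p≤1 d₁ d₂ , mix-supported ⊢Δ₁ ⊢Δ₂

    -- The coefficient p stays fixed along all transitions. The relation is closed under `≋` because
    -- `mix-⟿⁻` recovers the target of a mixture only up to `≋`, and it carries the typings because
    -- `≋` alone does not transport them.
    ∼-mix : ∀ {Θ p} {Δ₁ Δ₂ Δ₁′ Δ₂′ : Dist N} → 0ℝ ≤ p → p ≤ 1ℝ → Δ₁ ∼cs[ Θ ] Δ₁′ → Δ₂ ∼cs[ Θ ] Δ₂′ →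
            mix p Δ₁ Δ₂ ∼cs[ Θ ] mix p Δ₁′ Δ₂′
    ∼-mix {p = p} 0≤p p≤1 rel₁@(ℛ , bisℛ , r₁) rel₂@(𝒮 , bis𝒮 , r₂) = 𝒯 , bis ,
      mix-typed 0≤p p≤1 (∼-typedˡ rel₁) (∼-typedˡ rel₂) , mix-typed 0≤p p≤1 (∼-typedʳ rel₁) (∼-typedʳ rel₂) ,
      _ , _ , _ , _ , (λ f → refl) , (λ f → refl) , r₁ , r₂
      where
      module ℛ = IsBisimulation bisℛ
      module 𝒮 = IsBisimulation bis𝒮
      𝒯 : TypedRel N
      𝒯 Θ X Y = Θ ⊢ᵈ X × Θ ⊢ᵈ Y × ∃[ Δ₁ ] ∃[ Δ₂ ] ∃[ Δ₁′ ] ∃[ Δ₂′ ]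
        (X ≋ mix p Δ₁ Δ₂ × Y ≋ mix p Δ₁′ Δ₂′ × ℛ Θ Δ₁ Δ₁′ × 𝒮 Θ Δ₂ Δ₂′)
      resp : ∀ {π R Δ₁ Δ₂ Ξ} {X : Dist N} → X ≋ mix p Δ₁ Δ₂ → X ‖ R ⟿[ π ] Ξ → mix p Δ₁ Δ₂ ‖ R ⟿[ π ] Ξ
      resp {R = R} {Δ₁} {Δ₂} {Ξ} {X} eq s = ⟿-resp-≋ {X = X ‖ R} {mix p Δ₁ Δ₂ ‖ R} {Ξ} {Ξ} (mapᵂ-≋ (plug R) {X} {mix p Δ₁ Δ₂} eq) (λ f → refl) (_⟿[_]_.isDistribution s) s
      resp⁻¹ : ∀ {π R Δ₁ Δ₂ Ξ} {X : Dist N} → X ≋ mix p Δ₁ Δ₂ → mix p Δ₁ Δ₂ ‖ R ⟿[ π ] Ξ → X ‖ R ⟿[ π ] Ξ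
      resp⁻¹ {R = R} {Δ₁} {Δ₂} {Ξ} {X} eq s = ⟿-resp-≋ {X = mix p Δ₁ Δ₂ ‖ R} {X ‖ R} {Ξ} {Ξ} (λ f → sym (mapᵂ-≋ (plug R) {X} {mix p Δ₁ Δ₂} eq f)) (λ f → refl) (_⟿[_]_.isDistribution s) s
      bis : IsBisimulation 𝒯
      bis = record
        { typed = λ (⊢X , ⊢Y , _) → ⊢X , ⊢Y
        ; barbs = λ {Δ₁ = X} {Y} (_ , _ , Δ₁ , Δ₂ , Δ₁′ , Δ₂′ , eqX , eqY , r₁ , r₂) Θ′ R ctx →
            sameBarbs-trans {X ‖ R} {mix p (Δ₁ ‖ R) (Δ₂ ‖ R)} {Y ‖ R}
              (sameBarbs-≋ {X ‖ R} {mix p (Δ₁ ‖ R) (Δ₂ ‖ R)} λ f → trans (mapᵂ-≋ (plug R) {X} {mix p Δ₁ Δ₂} eqX f) (mapᵂ-mix (plug R) p Δ₁ Δ₂ f))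
              (sameBarbs-trans {mix p (Δ₁ ‖ R) (Δ₂ ‖ R)} {mix p (Δ₁′ ‖ R) (Δ₂′ ‖ R)} {Y ‖ R}
                (sameBarbs-mix p {Δ₁ ‖ R} {Δ₁′ ‖ R} {Δ₂ ‖ R} {Δ₂′ ‖ R} (ℛ.barbs r₁ Θ′ R ctx) (𝒮.barbs r₂ Θ′ R ctx))
                (sameBarbs-≋ {mix p (Δ₁′ ‖ R) (Δ₂′ ‖ R)} {Y ‖ R} λ f → sym (trans (mapᵂ-≋ (plug R) {Y} {mix p Δ₁′ Δ₂′} eqY f) (mapᵂ-mix (plug R) p Δ₁′ Δ₂′ f))))
        ; forth = λ {Δ₁ = X} {Y} (_ , _ , Δ₁ , Δ₂ , Δ₁′ , Δ₂′ , eqX , eqY , r₁ , r₂) Θ′ R ctx π Ξ s →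
            let Ξ₁ , Ξ₂ , s₁ , s₂ , eqΞ = mix-‖-⟿ 0≤p p≤1 ctx (proj₁ (ℛ.typed r₁)) (proj₁ (𝒮.typed r₂)) (resp {Δ₁ = Δ₁} {Δ₂} {Ξ} {X} eqX s)
                Ξ₁′ , s₁′ , r₁′ = ℛ.forth r₁ Θ′ R ctx π Ξ₁ s₁
                Ξ₂′ , s₂′ , r₂′ = 𝒮.forth r₂ Θ′ R ctx π Ξ₂ s₂
            in mix p Ξ₁′ Ξ₂′ , resp⁻¹ {Δ₁ = Δ₁′} {Δ₂′} {mix p Ξ₁′ Ξ₂′} {Y} eqY (‖-mix-⟿ 0≤p p≤1 s₁′ s₂′) ,
               typed-≋ {Δ = mix p Ξ₁ Ξ₂} {Ξ} (_⟿[_]_.isDistribution s) eqΞ (mix-typed 0≤p p≤1 (proj₁ (ℛ.typed r₁′)) (proj₁ (𝒮.typed r₂′))) ,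
               mix-typed 0≤p p≤1 (proj₂ (ℛ.typed r₁′)) (proj₂ (𝒮.typed r₂′)) ,
               Ξ₁ , Ξ₂ , Ξ₁′ , Ξ₂′ , eqΞ , (λ f → refl) , r₁′ , r₂′
        ; back = λ {Δ₁ = X} {Y} (_ , _ , Δ₁ , Δ₂ , Δ₁′ , Δ₂′ , eqX , eqY , r₁ , r₂) Θ′ R ctx π Ξ s →
            let Ξ₁′ , Ξ₂′ , s₁′ , s₂′ , eqΞ = mix-‖-⟿ 0≤p p≤1 ctx (proj₂ (ℛ.typed r₁)) (proj₂ (𝒮.typed r₂)) (resp {Δ₁ = Δ₁′} {Δ₂′} {Ξ} {Y} eqY s)
                Ξ₁ , s₁ , r₁′ = ℛ.back r₁ Θ′ R ctx π Ξ₁′ s₁′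
                Ξ₂ , s₂ , r₂′ = 𝒮.back r₂ Θ′ R ctx π Ξ₂′ s₂′
            in mix p Ξ₁ Ξ₂ , resp⁻¹ {Δ₁ = Δ₁} {Δ₂} {mix p Ξ₁ Ξ₂} {X} eqX (‖-mix-⟿ 0≤p p≤1 s₁ s₂) ,
               mix-typed 0≤p p≤1 (proj₁ (ℛ.typed r₁′)) (proj₁ (𝒮.typed r₂′)) ,
               typed-≋ {Δ = mix p Ξ₁′ Ξ₂′} {Ξ} (_⟿[_]_.isDistribution s) eqΞ (mix-typed 0≤p p≤1 (proj₂ (ℛ.typed r₁′)) (proj₂ (𝒮.typed r₂′))) ,
               Ξ₁ , Ξ₂ , Ξ₁′ , Ξ₂′ , (λ f → refl) , eqΞ , r₁′ , r₂′
        }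

  -- Transitions uniform in the quantum state

  -- The invariant between corresponding branches from ρ, from σ and from their mixture. States are
  -- compared after weighting only, since measurements normalise them by three different
  -- probabilities.
  record Balanced {d} (a : ℝ) (s : Matrix d) (b : ℝ) (t : Matrix d) (c : ℝ) (u : Matrix d) : Set where
    constructor balanced
    field
      weights : a + b ≡ c
      states  : a ·ᴹ s +ᴹ b ·ᴹ t ≡ c ·ᴹ u

  -- A branch of weight zero may hold a matrix that is not a state, such as one multiplied by the
  -- unspecified inverse of zero.
  record Good {d} (a : ℝ) (s : Matrix d) : Set where
    constructor good
    field
      density : a ≢ 0ℝ → IsDensity s

  -- One outcome of a transition as a function of the state before it: its probability, the state
  -- after it, and the part that does not depend on the state.
  Branch : ℕ → Set → Set
  Branch N A = (State N → ℝ) × (State N → State N) × A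

  -- A state transformer whose outcome is weighted by w acts linearly on
  -- unnormalised states.
  record Lawful {N} {A : Set} (branch : Branch N A) : Set where
    constructor lawful
    private
      w = proj₁ branch
      f = proj₁ (proj₂ branch)
    field
      balance : ∀ {a b c s t u} → Good a s → Good b t → Good c u → Balanced a s b t c u →
                Balanced (a * w s) (f s) (b * w t) (f t) (c * w u) (f u)


  -- If the trace vanishes then so does the matrix, hence the unspecified 0 ⁻¹ is
  -- harmless.
  normalise-psd : ∀ {d} a (A : Matrix d) → (a ≢ 0ℝ → PositiveSemidefinite A) →
                  (a * re (trace A)) ·ᴹ (re (trace A) ⁻¹ ·ᴹ A) ≡ a ·ᴹ A
  normalise-psd a A psd = by-cases em₀ em₀
    where
    open ≡-Reasoning
    tr = re (trace A)
    by-cases : Dec (a ≡ 0ℝ) → Dec (tr ≡ 0ℝ) → (a * tr) ·ᴹ (tr ⁻¹ ·ᴹ A) ≡ a ·ᴹ A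
    by-cases (yes a≡0) _ = begin
      (a * tr) ·ᴹ (tr ⁻¹ ·ᴹ A)    ≡⟨ cong (_·ᴹ (tr ⁻¹ ·ᴹ A)) (trans (cong (_* tr) a≡0) (zeroˡ tr)) ⟩
      0ℝ ·ᴹ (tr ⁻¹ ·ᴹ A)          ≡⟨ Mat.·-zeroˡ (tr ⁻¹ ·ᴹ A) ⟩
      0ᴹ                          ≡⟨ Mat.·-zeroˡ A ⟨
      0ℝ ·ᴹ A                     ≡⟨ cong (_·ᴹ A) a≡0 ⟨
      a ·ᴹ A                      ∎
    by-cases (no a≢0) (yes tr≡0) = begin
      (a * tr) ·ᴹ (tr ⁻¹ ·ᴹ A)    ≡⟨ cong (_·ᴹ (tr ⁻¹ ·ᴹ A)) (trans (cong (a *_) tr≡0) (zeroʳ a)) ⟩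
      0ℝ ·ᴹ (tr ⁻¹ ·ᴹ A)          ≡⟨ Mat.·-zeroˡ (tr ⁻¹ ·ᴹ A) ⟩
      0ᴹ                          ≡⟨ Mat.·-zeroʳ (ι a) ⟨
      a ·ᴹ 0ᴹ                     ≡⟨ cong (a ·ᴹ_) (psd∧trace≡0⇒≡0 A (psd a≢0) tr≡0) ⟨
      a ·ᴹ A                      ∎
    by-cases (no a≢0) (no tr≢0) = begin
      (a * tr) ·ᴹ (tr ⁻¹ ·ᴹ A)    ≡⟨ ·ᴹ-assoc (a * tr) (tr ⁻¹) A ⟩
      ((a * tr) * tr ⁻¹) ·ᴹ A     ≡⟨ cong (_·ᴹ A) (trans (*-assoc a tr (tr ⁻¹)) (trans (cong (a *_) (inverseʳ tr tr≢0)) (*-identityʳ a))) ⟩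
      a ·ᴹ A                      ∎

  -- Taking traces of the hypothesis gives the equation of weights, and `normalise-psd` undoes the
  -- normalisation in the equation of states.
  normalise-balanced : ∀ {d a b c} {A B C : Matrix d} →
    (a ≢ 0ℝ → PositiveSemidefinite A) → (b ≢ 0ℝ → PositiveSemidefinite B) → (c ≢ 0ℝ → PositiveSemidefinite C) →
    a ·ᴹ A +ᴹ b ·ᴹ B ≡ c ·ᴹ C →
    Balanced (a * re (trace A)) (re (trace A) ⁻¹ ·ᴹ A) (b * re (trace B)) (re (trace B) ⁻¹ ·ᴹ B)
             (c * re (trace C)) (re (trace C) ⁻¹ ·ᴹ C)
  normalise-balanced {a = a} {b} {c} {A} {B} {C} psd-A psd-B psd-C eq = balanced
    (trans (sym (re-trace-·+· a b A B)) (trans (cong (λ X → re (trace X)) eq) (re-trace-· c C)))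
    (trans (cong₂ _+ᴹ_ (normalise-psd a A psd-A) (normalise-psd b B psd-B)) (trans eq (sym (normalise-psd c C psd-C))))

  linear-balanced : ∀ {d} (L : Matrix d → Matrix d) → Linear L → ∀ {a b c s t u} → Balanced a s b t c u → Balanced a (L s) b (L t) c (L u)
  linear-balanced L lin {a} {b} {c} {s} {t} {u} (balanced a+b≡c eq) =
    balanced a+b≡c (trans (sym (lin a b s t)) (trans (cong L eq) (linear-· L lin c u)))

  conjugate-balanced : ∀ {d} (M : Matrix d) {a b c s t u} → Good a s → Good b t → Good c u → Balanced a s b t c u →
    Balanced (a * re (trace (conjugate M s))) (re (trace (conjugate M s)) ⁻¹ ·ᴹ conjugate M s)
             (b * re (trace (conjugate M t))) (re (trace (conjugate M t)) ⁻¹ ·ᴹ conjugate M t)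
             (c * re (trace (conjugate M u))) (re (trace (conjugate M u)) ⁻¹ ·ᴹ conjugate M u)
  conjugate-balanced M {s = s} {t} {u} (good s-density) (good t-density) (good u-density) bal = normalise-balanced {A = conjugate M s} {conjugate M t} {conjugate M u}
    (λ a≢0 → conjugate-psd M s (proj₁ (s-density a≢0)))
    (λ b≢0 → conjugate-psd M t (proj₁ (t-density b≢0)))
    (λ c≢0 → conjugate-psd M u (proj₁ (u-density c≢0)))
    (Balanced.states (linear-balanced (conjugate M) (conjugate-linear M) bal))

  module _ {N : ℕ} where
    sure : ∀ {A : Set} → (State N → State N) → A → List (Branch N A)
    sure f a = ((λ _ → 1ℝ) , f , a) ∷ []

    balanced-*1 : ∀ {d a b c} {s t u : Matrix d} → Balanced a s b t c u → Balanced (a * 1ℝ) s (b * 1ℝ) t (c * 1ℝ) u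
    balanced-*1 {a = a} {b} {c} bal rewrite *-identityʳ a | *-identityʳ b | *-identityʳ c = bal

    sure-lawful : ∀ {A : Set} {f : State N → State N} {a : A} → Linear f → All (Lawful {N}) (sure f a)
    sure-lawful {f = f} lin = lawful (λ _ _ _ bal → balanced-*1 (linear-balanced f lin bal)) ∷ []

    id-linear : Linear {2 ℕ.^ N} id
    id-linear a b A B = refl

    measure-lawful : ∀ {k} (𝕄 : Measurement k) (qs : Vec (Fin N) k) m {A : Set} {x : A} →
                     Lawful {N} ((λ s → probability 𝕄 qs s m) , (λ s → postState 𝕄 qs s m) , x)
    measure-lawful 𝕄 qs m = lawful (conjugate-balanced (onQubits qs (lookup (operator 𝕄) m)))

    run : ∀ {A B : Set} → (State N → A → B) → List (Branch N A) → State N → Weighted B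
    run g bs s = map (λ (w , f , a) → w s , g (f s) a) bs

    mapᴮ : ∀ {A B : Set} → (A → B) → List (Branch N A) → List (Branch N B)
    mapᴮ g = map λ (w , f , a) → w , f , g a

    run-mapᴮ : ∀ {A B C : Set} (h : State N → B → C) (g : A → B) bs s → run h (mapᴮ g bs) s ≡ run (λ t a → h t (g a)) bs s
    run-mapᴮ h g bs s = sym (Listₚ.map-∘ bs)

    mapᵂ-run : ∀ {A B C : Set} (h : B → C) (g : State N → A → B) bs s → mapᵂ h (run g bs s) ≡ run (λ t a → h (g t a)) bs s
    mapᵂ-run h g bs s = sym (Listₚ.map-∘ bs)

    mapᴮ-lawful : ∀ {A B : Set} {g : A → B} {bs} → All (Lawful {N}) bs → All (Lawful {N}) (mapᴮ g bs)
    mapᴮ-lawful []       = []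
    mapᴮ-lawful (lawful l ∷ ls) = lawful l ∷ mapᴮ-lawful ls

    measurement : ∀ {A : Set} {k} (𝕄 : Measurement k) (qs : Vec (Fin N) k) → (ℕ → A) → List (Branch N A)
    measurement 𝕄 qs f = List.tabulate λ m → (λ s → probability 𝕄 qs s m) , (λ s → postState 𝕄 qs s m) , f (Fin.toℕ m)

    measurement-lawful : ∀ {A : Set} {k} (𝕄 : Measurement k) (qs : Vec (Fin N) k) (f : ℕ → A) → All (Lawful {N}) (measurement 𝕄 qs f)
    measurement-lawful 𝕄 qs f = Allₚ.tabulate⁺ λ m → measure-lawful 𝕄 qs m

    run-measurement : ∀ {A : Set} {k} (𝕄 : Measurement k) (qs : Vec (Fin N) k) (f : ℕ → A) s →
                      run _,_ (measurement 𝕄 qs f) s ≡ measure 𝕄 qs s f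
    run-measurement 𝕄 qs f s = Listₚ.map-tabulate {n = outcomes 𝕄} _ _

    -- The rules never inspect the quantum state, so a transition from one state
    -- yields a family of transitions from all of them.
    ⟶-uniform : ∀ {ρ : State N} {P : Proc N} {Δ} → (ρ , P) ⟶ Δ →
                ∃[ bs ] (All (Lawful {N}) bs × ∀ s → (s , P) ⟶ run _,_ bs s)
    ⟶-uniform (τ∙ {P = P})      = sure id P , sure-lawful id-linear , λ s → τ∙
    ⟶-uniform (op {E = E} {P = P} qs eq) = sure (applyOp E qs) P , sure-lawful (applyOp-linear E qs) , λ s → op qs eq
    ⟶-uniform (mea {𝕄 = 𝕄} {P = P} qs eq) = measurement 𝕄 qs (λ m → P [ nat m ]) , measurement-lawful 𝕄 qs (λ m → P [ nat m ]) ,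
      λ s → ≡.subst (_ ⟶_) (sym (run-measurement 𝕄 qs (λ m → P [ nat m ]) s)) (mea qs eq)
    ⟶-uniform (sumˡ st) with ⟶-uniform st
    ... | bs , law , st′ = bs , law , λ s → sumˡ (st′ s)
    ⟶-uniform (sumʳ st) with ⟶-uniform st
    ... | bs , law , st′ = bs , law , λ s → sumʳ (st′ s)
    ⟶-uniform (comˡ x y) = sure id _ , sure-lawful id-linear , λ s → comˡ x y
    ⟶-uniform (comʳ x y) = sure id _ , sure-lawful id-linear , λ s → comʳ x y
    ⟶-uniform (parˡ {Q = Q} st) with ⟶-uniform st
    ... | bs , law , st′ = mapᴮ (_∥ Q) bs , mapᴮ-lawful law ,
      λ s → ≡.subst (_ ⟶_) (trans (mapᵂ-run (map₂ (_∥ Q)) _,_ bs s) (sym (run-mapᴮ _,_ (_∥ Q) bs s))) (parˡ (st′ s))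
    ⟶-uniform (parʳ {P = P} st) with ⟶-uniform st
    ... | bs , law , st′ = mapᴮ (P ∥_) bs , mapᴮ-lawful law ,
      λ s → ≡.subst (_ ⟶_) (trans (mapᵂ-run (map₂ (P ∥_)) _,_ bs s) (sym (run-mapᴮ _,_ (P ∥_) bs s))) (parʳ (st′ s))
    ⟶-uniform (res {c = c} st) with ⟶-uniform st
    ... | bs , law , st′ = mapᴮ (_∖ c) bs , mapᴮ-lawful law ,
      λ s → ≡.subst (_ ⟶_) (trans (mapᵂ-run (map₂ (_∖ c)) _,_ bs s) (sym (run-mapᴮ _,_ (_∖ c) bs s))) (res (st′ s))
    ⟶-uniform (true e st) with ⟶-uniform st
    ... | bs , law , st′ = bs , law , λ s → true e (st′ s)
    ⟶-uniform (false e st) with ⟶-uniform st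
    ... | bs , law , st′ = bs , law , λ s → false e (st′ s)

    ⟪⟫ : State N → Proc N × Proc N → Conf N
    ⟪⟫ s (P , R) = ⟪ s , P , R ⟫

    ↝-uniform : ∀ {ρ : State N} {P R : Proc N} {π Δ} → ⟪ ρ , P , R ⟫ ↝[ π ] Δ →
                ∃[ bs ] (All (Lawful {N}) bs × ∀ s → ⟪ s , P , R ⟫ ↝[ π ] run ⟪⟫ bs s)
    ↝-uniform (proc {R = R} st) with ⟶-uniform st
    ... | bs , law , st′ = mapᴮ (_, R) bs , mapᴮ-lawful law ,
      λ s → ≡.subst (_ ↝[ _ ]_) (trans (mapᵂ-run _ _,_ bs s) (sym (run-mapᴮ ⟪⟫ (_, R) bs s))) (proc (st′ s))
    ↝-uniform (op {P = P} {E = E} {R = R} qs eq) = sure (applyOp E qs) (P , R) , sure-lawful (applyOp-linear E qs) , λ s → op qs eq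
    ↝-uniform (mea {P = P} {𝕄 = 𝕄} {R = R} qs eq) = mapᴮ (P ,_) ms , mapᴮ-lawful (measurement-lawful 𝕄 qs (λ m → R [ nat m ])) ,
      λ s → ≡.subst (_ ↝[ _ ]_) (trans (cong (mapᵂ _) (sym (run-measurement 𝕄 qs (λ m → R [ nat m ]) s)))
        (trans (mapᵂ-run (λ (ρ , R) → ⟪ ρ , P , R ⟫) _,_ ms s) (sym (run-mapᴮ ⟪⟫ (P ,_) ms s)))) (mea qs eq)
      where
      ms : List (Branch N (Proc N))
      ms = measurement 𝕄 qs (λ m → R [ nat m ])
    ↝-uniform (send x y) = sure id _ , sure-lawful id-linear , λ s → send x y
    ↝-uniform (recv x y) = sure id _ , sure-lawful id-linear , λ s → recv x y
    ↝-uniform (parˡ {S = S} st) with ↝-uniform st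
    ... | bs , law , st′ = mapᴮ (map₂ (_∥ S)) bs , mapᴮ-lawful law ,
      λ s → ≡.subst (_ ↝[ _ ]_) (trans (mapᵂ-run (plug S) ⟪⟫ bs s) (sym (run-mapᴮ ⟪⟫ (map₂ (_∥ S)) bs s))) (parˡ (st′ s))
    ↝-uniform (parʳ {R = R} st) with ↝-uniform st
    ... | bs , law , st′ = mapᴮ (map₂ (R ∥_)) bs , mapᴮ-lawful law ,
      λ s → ≡.subst (_ ↝[ _ ]_) (trans (mapᵂ-run (plugʳ R) ⟪⟫ bs s) (sym (run-mapᴮ ⟪⟫ (map₂ (R ∥_)) bs s))) (parʳ (st′ s))
    ↝-uniform (true e st) with ↝-uniform st
    ... | bs , law , st′ = bs , law , λ s → true e (st′ s)
    ↝-uniform (false e st) with ↝-uniform st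
    ... | bs , law , st′ = bs , law , λ s → false e (st′ s)

    -- A configuration without its quantum state; nothing stands for ⊥.
    Template : Set
    Template = Maybe (Proc N × Proc N)

    configure : State N → Template → Conf N
    configure s (just PR) = ⟪⟫ s PR
    configure s nothing   = ⊥

    -- By `↝-uniform` the ability to move is independent of the state, so it can be decided at an
    -- arbitrary matrix, here `0ᴹ`. The branches thus depend on the template and the index alone,
    -- also for deadlocks.
    ⇝-uniform : ∀ (t : Template) π → ∃[ bs ] (All (Lawful {N}) bs × ∀ s → configure s t ⇝[ π ] run configure bs s)
    ⇝-uniform nothing π = sure id nothing , sure-lawful id-linear , λ s → deadlock λ Δ ()
    ⇝-uniform (just (P , R)) π with em₀ {∃[ Ξ ] ⟪ 0ᴹ , P , R ⟫ ↝[ π ] Ξ}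
    ... | yes (_ , st) with ↝-uniform st
    ...   | bs , law , st′ = mapᴮ just bs , mapᴮ-lawful law ,
      λ s → move (≡.subst (_ ↝[ π ]_) (sym (run-mapᴮ configure just bs s)) (st′ s))
    ⇝-uniform (just (P , R)) π | no ¬st = sure id nothing , sure-lawful id-linear ,
      λ s → deadlock λ Δ st → ¬st (_ , proj₂ (proj₂ (↝-uniform st)) 0ᴹ)

  -- Families of distributions sharing one resolution of their choices

  module _ {N : ℕ} where
    plugᵀ : Proc N → Template → Template
    plugᵀ R = Maybe.map (map₂ (_∥ R))

    configure-plugᵀ : ∀ R s t → configure s (plugᵀ R t) ≡ plug R (configure s t)
    configure-plugᵀ R s (just _) = refl
    configure-plugᵀ R s nothing  = refl

    -- Fixes one resolution of the nondeterminism for each template and index, common to all states.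
    branches : Template → Index → List (Branch N (Template {N}))
    branches t π = proj₁ (⇝-uniform t π)

  -- The weighted configurations reached from a family of initial states indexed by I
  -- when all members of the family resolve their choices alike.
  module _ {I : Set} {N : ℕ} where
    Item : Set
    Item = (I → ℝ) × (I → State N) × Template {N}

    instantiate : List Item → I → Dist N
    instantiate L x = map (λ (w , s , t) → w x , configure (s x) t) L

    continue : (I → ℝ) → (I → State N) → Branch N (Template {N}) → Item
    continue w s (v , f , t) = (λ x → w x * v (s x)) , (λ x → f (s x)) , t

    next : Proc N → Index → List Item → List Item
    next R π = concatMap λ (w , s , t) → map (continue w s) (branches (plugᵀ R t) π)

    transitions : Proc N → Index → List Item → I → Transitions {N}
    transitions R π L x = map (λ (w , s , t) → w x , plug R (configure (s x) t) , run {N} configure (branches (plugᵀ R t) π) (s x)) L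

    instantiate-next : ∀ R π L x → bind (transitions R π L x) ≡ instantiate (next R π L) x
    instantiate-next R π []                x = refl
    instantiate-next R π ((w , s , t) ∷ L) x = begin
      scale (w x) (run {N} configure bs (s x)) ++ bind (transitions R π L x)
        ≡⟨ cong₂ _++_ (trans (sym (Listₚ.map-∘ bs)) (Listₚ.map-∘ bs)) (instantiate-next R π L x) ⟩
      instantiate (map (continue w s) bs) x ++ instantiate (next R π L) x
        ≡⟨ Listₚ.map-++ _ (map (continue w s) bs) (next R π L) ⟨
      instantiate (map (continue w s) bs ++ next R π L) x ∎
      where
      open ≡-Reasoning
      bs = branches (plugᵀ R t) π

    transitions-moves : ∀ R π L x → Moves π (transitions R π L x)
    transitions-moves R π L x = Allₚ.map⁺ (All.universal (λ (w , s , t) →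
      ≡.subst (_⇝[ π ] run {N} configure (branches (plugᵀ R t) π) (s x)) (configure-plugᵀ R (s x) t) (proj₂ (proj₂ (⇝-uniform (plugᵀ R t) π)) (s x))) L)

    instantiate-⟿ : ∀ {Θ Θ′ R} → Context Θ Θ′ R → ∀ π L x → Θ ⊢ᵈ instantiate L x →
                    instantiate L x ‖ R ⟿[ π ] instantiate (next R π L) x
    instantiate-⟿ {R = R} ctx π L x ⊢Γ@((0≤Γ , _) , _) = ≡.subst (instantiate L x ‖ R ⟿[ π ]_) (instantiate-next R π L x)
      (bind-⟿ (transitions R π L x) (‖-typed ctx ⊢Γ) (Allₚ.map⁺ (Allₚ.map⁻ 0≤Γ)) (transitions-moves R π L x)
        (≡⇒≋ (trans (sym (Listₚ.map-∘ L)) (Listₚ.map-∘ L))))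

  -- The bisimulation between mixtures of distributions and mixtures of states

  module _ {p : ℝ} (0≤p : 0ℝ ≤ p) (p≤1 : p ≤ 1ℝ) {N : ℕ} where
    private
      -- The members of the family that start from ρ, from σ and from their convex combination.
      ρ₀ σ₀ τ₀ : Fin 3
      ρ₀ = Fin.zero
      σ₀ = Fin.suc Fin.zero
      τ₀ = Fin.suc (Fin.suc Fin.zero)

    BalancedItem : Item {Fin 3} {N} → Set
    BalancedItem (w , s , _) = Balanced (p * w ρ₀) (s ρ₀) ((1ℝ + - p) * w σ₀) (s σ₀) (w τ₀) (s τ₀)

    state-density : ∀ {Θ : Subset N} {s PR} → Θ ⊢ᶜ configure s (just PR) → IsDensity s
    state-density (conf _ _ _ _ δ _ _ _) = δ

    reassociate : ∀ {d} {q r a b c v₀ v₁ v₂} {s t u : Matrix d} →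
                  Balanced ((q * a) * v₀) s ((r * b) * v₁) t (c * v₂) u → Balanced (q * (a * v₀)) s (r * (b * v₁)) t (c * v₂) u
    reassociate {q = q} {r′} {a} {b} {c} {v₀} {v₁} bal rewrite *-assoc q a v₀ | *-assoc r′ b v₁ = bal

    -- Typing provides a density operator for each member of nonzero weight, which is the form that
    -- `Good` asks for; `⊥` continues as a single `⊥` of the same weight.
    continue-balanced : ∀ {R π w s t} (Θ : Subset N) → BalancedItem (w , s , t) →
                        (∀ x → w x ≢ 0ℝ → Θ ⊢ᶜ configure (s x) t) →
                        All BalancedItem (map (continue w s) (branches (plugᵀ R t) π))
    continue-balanced {t = nothing}      Θ bal ⊢C = reassociate (balanced-*1 {N} bal) ∷ []
    continue-balanced {R} {π} {w} {s} {just PR} Θ bal ⊢C = Allₚ.map⁺ (All.map preserve (proj₁ (proj₂ (⇝-uniform (plugᵀ R (just PR)) π))))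
      where
      preserve : ∀ {br} → Lawful {N} br → BalancedItem (continue w s br)
      preserve (lawful law) = reassociate (law
        (good λ pw≢0 → state-density (⊢C ρ₀ (x*y≢0⇒y≢0 pw≢0)))
        (good λ pw≢0 → state-density (⊢C σ₀ (x*y≢0⇒y≢0 pw≢0)))
        (good λ w≢0 → state-density (⊢C τ₀ w≢0)) bal)

    next-balanced : ∀ {R π L} {Θ : Subset N} → All BalancedItem L → (∀ x → Supported (Θ ⊢ᶜ_) (instantiate L x)) → All BalancedItem (next R π L)
    next-balanced []           ⊢L = []
    next-balanced {Θ = Θ} (bal ∷ bals) ⊢L = Allₚ.++⁺ (continue-balanced Θ bal (All.head ∘ ⊢L)) (next-balanced bals (All.tail ∘ ⊢L))

    -- A function that ignores the state takes one value per item, so the weight equations of the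
    -- items add up. Barbs and deadlock are such functions.
    expectation-balanced : ∀ {f : Conf N → ℝ} → (∀ s s′ t → f (configure s t) ≡ f (configure s′ t)) → ∀ {L} → All BalancedItem L →
      p * expectation f (instantiate L ρ₀) + (1ℝ + - p) * expectation f (instantiate L σ₀) ≡ expectation f (instantiate L τ₀)
    expectation-balanced {f} const [] = solve 2 (λ p q → p :* con (ℤ.+ 0) :+ q :* con (ℤ.+ 0) := con (ℤ.+ 0)) refl p (1ℝ + - p)
      where open ℝ-Solver
    expectation-balanced {f} const {(w , s , t) ∷ L} (bal ∷ bals) = begin
      p * (w ρ₀ * f (configure (s ρ₀) t) + E ρ₀) + (1ℝ + - p) * (w σ₀ * f (configure (s σ₀) t) + E σ₀)
        ≡⟨ cong₂ (λ x y → p * (w ρ₀ * x + E ρ₀) + (1ℝ + - p) * (w σ₀ * y + E σ₀)) (const (s ρ₀) (s τ₀) t) (const (s σ₀) (s τ₀) t) ⟩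
      p * (w ρ₀ * x + E ρ₀) + (1ℝ + - p) * (w σ₀ * x + E σ₀)
        ≡⟨ solve 7 (λ p q a b x u v → p :* (a :* x :+ u) :+ q :* (b :* x :+ v) := (p :* a :+ q :* b) :* x :+ (p :* u :+ q :* v)) refl
             p (1ℝ + - p) (w ρ₀) (w σ₀) x (E ρ₀) (E σ₀) ⟩
      (p * w ρ₀ + (1ℝ + - p) * w σ₀) * x + (p * E ρ₀ + (1ℝ + - p) * E σ₀)
        ≡⟨ cong₂ (λ y z → y * x + z) (Balanced.weights bal) (expectation-balanced const bals) ⟩
      w τ₀ * x + E τ₀ ∎
      where
      open ≡-Reasoning
      open ℝ-Solver
      x = f (configure (s τ₀) t)
      E : Fin 3 → ℝ
      E i = expectation f (instantiate L i)

    𝟙-⇔ : ∀ {A : Set} {Q : A → Set} {a b} → Q a ⇔ Q b → 𝟙 Q a ≡ 𝟙 Q b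
    𝟙-⇔ Qa⇔Qb = cong (if_then 1ℝ else 0ℝ) (does-⇔ Qa⇔Qb em₀ em₀)

    plug-barb-const : ∀ {c R} s s′ (t : Template {N}) → Barb c (plug R (configure s t)) → Barb c (plug R (configure s′ t))
    plug-barb-const s s′ (just _) (process b)  = process b
    plug-barb-const s s′ (just _) (observer b) = observer b

    plug-⊥-const : ∀ {R} s s′ (t : Template {N}) → plug R (configure s t) ≡ ⊥ → plug R (configure s′ t) ≡ ⊥
    plug-⊥-const s s′ nothing eq = refl

    balanced-barbs : ∀ {L} → All BalancedItem L → ∀ R → SameBarbs (mix p (instantiate L ρ₀) (instantiate L σ₀) ‖ R) (instantiate L τ₀ ‖ R)
    balanced-barbs {L} bals R = sameBarbs {Δ = mix p (instantiate L ρ₀) (instantiate L σ₀) ‖ R} {instantiate L τ₀ ‖ R}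
      (λ c → same (λ s s′ t → 𝟙-⇔ {Q = Barb c} (mk⇔ (plug-barb-const s s′ t) (plug-barb-const s′ s t))))
      (same (λ s s′ t → 𝟙-⇔ {Q = _≡ ⊥} (mk⇔ (plug-⊥-const s s′ t) (plug-⊥-const s′ s t))))
      where
      same : ∀ {f} → (∀ s s′ t → f (plug R (configure s t)) ≡ f (plug R (configure s′ t))) →
             expectation f (mix p (instantiate L ρ₀) (instantiate L σ₀) ‖ R) ≡ expectation f (instantiate L τ₀ ‖ R)
      same {f} const = trans (expectation-mapᵂ f (plug R) (mix p (instantiate L ρ₀) (instantiate L σ₀)))
        (trans (expectation-mix (f ∘ plug R) p (instantiate L ρ₀) (instantiate L σ₀))
          (trans (expectation-balanced {f ∘ plug R} const bals) (sym (expectation-mapᵂ f (plug R) (instantiate L τ₀)))))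

    -- Determinism of P yields a deterministic set for each initial state separately.
    module _ (𝒜 : Fin 3 → Subset N → Dist N → Set) (det : (x : Fin 3) → IsDeterministicSet (𝒜 x)) where
      private
        module Det x = IsDeterministicSet (det x)

      -- Determinism makes an arbitrary successor only bisimilar to the one obtained by
      -- next, which is why the relation is closed under ∼cs on both sides.
      Related : TypedRel N
      Related Θ Δ₁ Δ₂ = ∃[ L ] (All BalancedItem L × (∀ x → 𝒜 x Θ (instantiate L x)) ×
        Squash (Δ₁ ∼cs[ Θ ] mix p (instantiate L ρ₀) (instantiate L σ₀)) × Squash (instantiate L τ₀ ∼cs[ Θ ] Δ₂))

      module _ {Θ Θ′ : Subset N} {R : Proc N} (ctx : Context Θ Θ′ R) (π : Index) {L : List (Item {Fin 3} {N})} (member : ∀ x → 𝒜 x Θ (instantiate L x)) where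
        step : ∀ x → instantiate L x ‖ R ⟿[ π ] instantiate (next R π L) x
        step x = instantiate-⟿ ctx π L x (Det.typed x (member x))

        -- Determinism applied to the same transition twice gives closure of the set under
        -- transitions.
        next-member : ∀ x → 𝒜 x (Θ ∪ Θ′) (instantiate (next R π L) x)
        next-member x = proj₁ (proj₂ (Det.deterministic x (member x) Θ′ R ctx π _ _ (step x) (step x)))

        unique : ∀ x {Ξ} → instantiate L x ‖ R ⟿[ π ] Ξ → Ξ ∼cs[ Θ ∪ Θ′ ] instantiate (next R π L) x
        unique x s = proj₁ (Det.deterministic x (member x) Θ′ R ctx π _ _ s (step x))

        unique′ : ∀ x {Ξ} → instantiate L x ‖ R ⟿[ π ] Ξ → instantiate (next R π L) x ∼cs[ Θ ∪ Θ′ ] Ξ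
        unique′ x s = proj₁ (Det.deterministic x (member x) Θ′ R ctx π _ _ (step x) s)

        mix-step : mix p (instantiate L ρ₀) (instantiate L σ₀) ‖ R ⟿[ π ] mix p (instantiate (next R π L) ρ₀) (instantiate (next R π L) σ₀)
        mix-step = ‖-mix-⟿ 0≤p p≤1 (step ρ₀) (step σ₀)

        mix-unique : ∀ {Ξ} → mix p (instantiate L ρ₀) (instantiate L σ₀) ‖ R ⟿[ π ] Ξ →
                     Ξ ∼cs[ Θ ∪ Θ′ ] mix p (instantiate (next R π L) ρ₀) (instantiate (next R π L) σ₀)
        mix-unique s with mix-‖-⟿ 0≤p p≤1 ctx (Det.typed ρ₀ (member ρ₀)) (Det.typed σ₀ (member σ₀)) s
        ... | Ξ₁ , Ξ₂ , s₁ , s₂ , eq = ∼-respˡ-≋ (_⟿[_]_.isDistribution s) eq (∼-mix 0≤p p≤1 (unique ρ₀ s₁) (unique σ₀ s₂))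

        next-balanced′ : All BalancedItem L → All BalancedItem (next R π L)
        next-balanced′ bals = next-balanced bals (λ x → proj₂ (Det.typed x (member x)))

      related-isBisimulation : IsBisimulation Related
      related-isBisimulation = record
        { typed = λ (L , bals , member , rel₁ , rel₂) → ∼-typedˡ (unsquash rel₁) , ∼-typedʳ (unsquash rel₂)
        ; barbs = λ {Δ₁ = Δ₁} {Δ₂} (L , bals , member , rel₁ , rel₂) Θ′ R ctx →
            sameBarbs-trans {Δ = Δ₁ ‖ R} {mix p (instantiate L ρ₀) (instantiate L σ₀) ‖ R} {Δ₂ ‖ R} (∼-barbs (unsquash rel₁) ctx)
              (sameBarbs-trans {Δ = mix p (instantiate L ρ₀) (instantiate L σ₀) ‖ R} {instantiate L τ₀ ‖ R} {Δ₂ ‖ R}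
                (balanced-barbs bals R) (∼-barbs (unsquash rel₂) ctx))
        ; forth = λ (L , bals , member , rel₁ , rel₂) Θ′ R ctx π Δ₁′ s₁ →
            let Ξ , s , Δ₁′∼Ξ = ∼-forth (unsquash rel₁) ctx s₁
                -- The answer matches the step of the third member given by `next`, whichever
                -- transition was taken on the left; uniqueness accounts for the difference.
                Δ₂′ , s₂ , τ∼Δ₂′ = ∼-forth (unsquash rel₂) ctx (step ctx π member τ₀)
            in Δ₂′ , s₂ , next R π L , next-balanced′ ctx π member bals , next-member ctx π member ,
               squash (∼-trans Δ₁′∼Ξ (mix-unique ctx π member s)) , squash τ∼Δ₂′
        ; back = λ (L , bals , member , rel₁ , rel₂) Θ′ R ctx π Δ₂′ s₂ →
            let Ξ , s , Ξ∼Δ₂′ = ∼-back (unsquash rel₂) ctx s₂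
                Δ₁′ , s₁ , Δ₁′∼mix = ∼-back (unsquash rel₁) ctx (mix-step ctx π member)
            in Δ₁′ , s₁ , next R π L , next-balanced′ ctx π member bals , next-member ctx π member ,
               squash Δ₁′∼mix , squash (∼-trans (unique′ ctx π member τ₀ s) Ξ∼Δ₂′)
        }

      -- A bisimulation relates typed distributions only. A deterministic set is typed and closed
      -- under transitions, so the identity restricted to it is a bisimulation.
      member-refl : ∀ x {Θ Δ} → 𝒜 x Θ Δ → Δ ∼cs[ Θ ] Δ
      member-refl x mem = 𝒯 , bis , refl , mem
        where
        𝒯 : TypedRel N
        𝒯 Θ Δ₁ Δ₂ = Δ₁ ≡ Δ₂ × 𝒜 x Θ Δ₁
        bis : IsBisimulation 𝒯
        bis = record
          { typed = λ { (refl , mem) → Det.typed x mem , Det.typed x mem }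
          ; barbs = λ { {Δ₁ = Δ} (refl , mem) Θ′ R ctx → sameBarbs-≋ {Δ = Δ ‖ R} {Δ ‖ R} (λ f → refl) }
          ; forth = λ { (refl , mem) Θ′ R ctx π Δ′ s → Δ′ , s , refl , proj₁ (proj₂ (Det.deterministic x mem Θ′ R ctx π Δ′ Δ′ s s)) }
          ; back = λ { (refl , mem) Θ′ R ctx π Δ′ s → Δ′ , s , refl , proj₁ (proj₂ (Det.deterministic x mem Θ′ R ctx π Δ′ Δ′ s s)) }
          }

      balanced-∼ : ∀ {Θ L} → All BalancedItem L → (∀ x → 𝒜 x Θ (instantiate L x)) →
                   mix p (instantiate L ρ₀) (instantiate L σ₀) ∼cs[ Θ ] instantiate L τ₀
      balanced-∼ {L = L} bals member = Related , related-isBisimulation , L , bals , member ,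
        squash (∼-mix 0≤p p≤1 (member-refl ρ₀ (member ρ₀)) (member-refl σ₀ (member σ₀))) , squash (member-refl τ₀ (member τ₀))

  -- Padded observers

  module _ {N : ℕ} where
    sameBarbs-sym : ∀ {Δ Θ : Dist N} → SameBarbs Δ Θ → SameBarbs Θ Δ
    sameBarbs-sym (b , d) = (λ c p → ⇔-sym (b c p)) , λ p → ⇔-sym (d p)

    ∼-sym : ∀ {Θ} {Δ₁ Δ₂ : Dist N} → Δ₁ ∼cs[ Θ ] Δ₂ → Δ₂ ∼cs[ Θ ] Δ₁
    ∼-sym (ℛ , bis , rel) = (λ Θ Δ₁ Δ₂ → ℛ Θ Δ₂ Δ₁) , record
      { typed = λ rel → swap (typed rel)
      ; barbs = λ {Δ₁ = Δ₁} {Δ₂} rel Θ′ R ctx → sameBarbs-sym {Δ₂ ‖ R} {Δ₁ ‖ R} (barbs rel Θ′ R ctx)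
      ; forth = back
      ; back = forth } , rel
      where open IsBisimulation bis

    ∼-respʳ-≋ : ∀ {Θ} {Δ₁ Δ₂ Δ₂′ : Dist N} → IsDistribution Δ₂′ → Δ₂′ ≋ Δ₂ → Δ₁ ∼cs[ Θ ] Δ₂ → Δ₁ ∼cs[ Θ ] Δ₂′
    ∼-respʳ-≋ dist eq rel = ∼-sym (∼-respˡ-≋ dist eq (∼-sym rel))

    -- Determinism of P only concerns observers obtained by plugging 𝟎 into a context.
    -- Their transitions carry other indices than those of the unpadded observers: at
    -- depth d, below d contexts, an extra r has to be inserted.
    pad : ℕ → Proc N → Proc N
    pad ℕ.zero    R          = 𝟎 ∥ R
    pad (ℕ.suc d) (R ∥ S)    = pad d R ∥ S
    pad (ℕ.suc d) ⌊ K ⌋      = ⌊ K ⌋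
    pad (ℕ.suc d) (R ∖ c)    = R ∖ c
    pad (ℕ.suc d) (cond e R S) = cond e R S

    -- A left inverse of `pad`, through which equivalences between padded distributions are pulled
    -- back.
    unpad : ℕ → Proc N → Proc N
    unpad ℕ.zero    (_ ∥ R)      = R
    unpad (ℕ.suc d) (R ∥ S)      = unpad d R ∥ S
    unpad _         ⌊ K ⌋        = ⌊ K ⌋
    unpad _         (R ∖ c)      = R ∖ c
    unpad _         (cond e R S) = cond e R S

    unpad-pad : ∀ d R → unpad d (pad d R) ≡ R
    unpad-pad ℕ.zero    R            = refl
    unpad-pad (ℕ.suc d) (R ∥ S)      = cong (_∥ S) (unpad-pad d R)
    unpad-pad (ℕ.suc d) ⌊ K ⌋        = refl
    unpad-pad (ℕ.suc d) (R ∖ c)      = refl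
    unpad-pad (ℕ.suc d) (cond e R S) = refl

    route : ℕ → List Side → List Side
    route ℕ.zero    π       = r ∷ π
    -- Below a context the observer is a parallel composition, which has no move at the empty
    -- position; so both the original and the padded observer are stuck here.
    route (ℕ.suc d) []      = []
    route (ℕ.suc d) (ℓ ∷ π) = ℓ ∷ route d π
    route (ℕ.suc d) (r ∷ π) = r ∷ π

    routeᴵ : ℕ → Index → Index
    routeᴵ d ◇      = ◇
    routeᴵ d (at π) = at (route d π)

    -- At least d contexts have been plugged in, so that `pad d` reaches the place where the
    -- original observer sits.
    data Spine : ℕ → Proc N → Set where
      root : ∀ {R} → Spine ℕ.zero R
      left : ∀ {d R S} → Spine d R → Spine (ℕ.suc d) (R ∥ S)

    padᶜ unpadᶜ : ℕ → Conf N → Conf N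
    padᶜ d ⟪ ρ , P , R ⟫ = ⟪ ρ , P , pad d R ⟫
    padᶜ d ⊥             = ⊥
    unpadᶜ d ⟪ ρ , P , R ⟫ = ⟪ ρ , P , unpad d R ⟫
    unpadᶜ d ⊥             = ⊥

    unpadᶜ-padᶜ : ∀ d C → unpadᶜ d (padᶜ d C) ≡ C
    unpadᶜ-padᶜ d ⟪ ρ , P , R ⟫ = cong ⟪ ρ , P ,_⟫ (unpad-pad d R)
    unpadᶜ-padᶜ d ⊥             = refl

    Spineᶜ : ℕ → Conf N → Set
    Spineᶜ d ⟪ ρ , P , R ⟫ = Spine d R
    Spineᶜ d ⊥             = ⊤

    spineᶜ-zero : ∀ C → Spineᶜ 0 C
    spineᶜ-zero ⟪ _ , _ , _ ⟫ = root
    spineᶜ-zero ⊥             = tt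

    spineᶜ-plug : ∀ {d S C} → Spineᶜ d C → Spineᶜ (ℕ.suc d) (plug S C)
    spineᶜ-plug {C = ⟪ _ , _ , _ ⟫} sp = left sp
    spineᶜ-plug {C = ⊥}             sp = tt

    spineᶜ-plugʳ : ∀ {d R} → Spine d R → ∀ C → Spineᶜ (ℕ.suc d) (plugʳ R C)
    spineᶜ-plugʳ sp ⟪ _ , _ , _ ⟫ = left sp
    spineᶜ-plugʳ sp ⊥             = tt

    plugʳ-𝟎 : ∀ C → plugʳ 𝟎 C ≡ padᶜ 0 C
    plugʳ-𝟎 ⟪ _ , _ , _ ⟫ = refl
    plugʳ-𝟎 ⊥             = refl

    padᶜ-plug : ∀ d S C → padᶜ (ℕ.suc d) (plug S C) ≡ plug S (padᶜ d C)
    padᶜ-plug d S ⟪ _ , _ , _ ⟫ = refl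
    padᶜ-plug d S ⊥             = refl

    padᶜ-plugʳ : ∀ d R C → padᶜ (ℕ.suc d) (plugʳ R C) ≡ plugʳ (pad d R) C
    padᶜ-plugʳ d R ⟪ _ , _ , _ ⟫ = refl
    padᶜ-plugʳ d R ⊥             = refl

    mapᵂ-cong : ∀ {A B : Set} {g h : A → B} → (∀ a → g a ≡ h a) → ∀ Δ → mapᵂ g Δ ≡ mapᵂ h Δ
    mapᵂ-cong g≗h = Listₚ.map-cong λ (w , a) → cong (w ,_) (g≗h a)

    mapᵂ-∘ : ∀ {A B C : Set} (g : B → C) (h : A → B) Δ → mapᵂ g (mapᵂ h Δ) ≡ mapᵂ (g ∘ h) Δ
    mapᵂ-∘ g h Δ = sym (Listₚ.map-∘ Δ)

    padᶜ-‖ : ∀ d S Δ → mapᵂ (padᶜ (ℕ.suc d)) (Δ ‖ S) ≡ mapᵂ (padᶜ d) Δ ‖ S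
    padᶜ-‖ d S Δ = trans (mapᵂ-∘ (padᶜ (ℕ.suc d)) (plug S) Δ) (trans (mapᵂ-cong (padᶜ-plug d S) Δ) (sym (mapᵂ-∘ (plug S) (padᶜ d) Δ)))

    padᶜ-mapᵂ-plugʳ : ∀ d R Δ → mapᵂ (padᶜ (ℕ.suc d)) (mapᵂ (plugʳ R) Δ) ≡ mapᵂ (plugʳ (pad d R)) Δ
    padᶜ-mapᵂ-plugʳ d R Δ = trans (mapᵂ-∘ (padᶜ (ℕ.suc d)) (plugʳ R) Δ) (mapᵂ-cong (padᶜ-plugʳ d R) Δ)

    -- An observer moves inside one of its parallel components and leaves the compositions above it
    -- in place.
    ↝-spine : ∀ {d ρ P R π Δ} → Spine d R → ⟪ ρ , P , R ⟫ ↝[ π ] Δ → All (λ (_ , C) → Spineᶜ d C) Δ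
    ↝-spine sp        (proc {Δ = Δ} s) = Allₚ.map⁺ (All.universal (λ _ → sp) Δ)
    ↝-spine root      s                = All.universal (λ (_ , C) → spineᶜ-zero C) _
    ↝-spine (left sp) (parˡ s)         = Allₚ.map⁺ (All.map (λ {(_ , C)} → spineᶜ-plug {C = C}) (↝-spine sp s))
    ↝-spine (left sp) (parʳ {Δ = Δ} s) = Allₚ.map⁺ (All.universal (λ (_ , C) → spineᶜ-plugʳ sp C) Δ)

    pad-↝ : ∀ {d ρ P R π Δ} → Spine d R → ⟪ ρ , P , R ⟫ ↝[ π ] Δ → ⟪ ρ , P , pad d R ⟫ ↝[ routeᴵ d π ] mapᵂ (padᶜ d) Δ
    pad-↝ {d} {R = R} sp (proc {Δ = Δ} s) = ≡.subst (_ ↝[ ◇ ]_) (sym (mapᵂ-∘ (padᶜ d) _ Δ)) (proc s)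
    pad-↝ {π = at π} {Δ} root s = ≡.subst (_ ↝[ _ ]_) (mapᵂ-cong plugʳ-𝟎 Δ) (parʳ s)
    pad-↝ {ℕ.suc d} (left sp) (parˡ {S = S} {Δ = Δ} s) = ≡.subst (_ ↝[ _ ]_) (sym (padᶜ-‖ d S Δ)) (parˡ (pad-↝ sp s))
    pad-↝ {ℕ.suc d} (left sp) (parʳ {R = R} {Δ = Δ} s) = ≡.subst (_ ↝[ _ ]_) (sym (padᶜ-mapᵂ-plugʳ d R Δ)) (parʳ s)

    -- A routed index leads past the inserted `𝟎`, so inversion meets only moves that the unpadded
    -- configuration has as well.
    pad-↝⁻ : ∀ {d ρ P R} π {Ξ} → Spine d R → ⟪ ρ , P , pad d R ⟫ ↝[ routeᴵ d π ] Ξ →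
             ∃[ Δ ] (⟪ ρ , P , R ⟫ ↝[ π ] Δ × Ξ ≡ mapᵂ (padᶜ d) Δ)
    pad-↝⁻ {d} ◇ sp (proc {Δ = Δ} s) = _ , proc s , sym (mapᵂ-∘ (padᶜ d) _ Δ)
    pad-↝⁻ (at π) root (parʳ {Δ = Δ} s) = Δ , s , mapᵂ-cong plugʳ-𝟎 Δ
    pad-↝⁻ {ℕ.suc d} (at (ℓ ∷ π)) (left sp) (parˡ {S = S} s) with pad-↝⁻ (at π) sp s
    ... | Δ , s′ , refl = _ , parˡ s′ , sym (padᶜ-‖ d S Δ)
    pad-↝⁻ {ℕ.suc d} {R = R ∥ _} (at (r ∷ π)) (left sp) (parʳ {Δ = Δ} s) = _ , parʳ s , sym (padᶜ-mapᵂ-plugʳ d R Δ)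

    ⇝-spine : ∀ {d C π Δ} → Spineᶜ d C → C ⇝[ π ] Δ → All (λ (_ , C) → Spineᶜ d C) Δ
    ⇝-spine {C = ⟪ _ , _ , _ ⟫} sp (move s)     = ↝-spine sp s
    ⇝-spine                     sp (deadlock _) = tt ∷ []

    -- Being stuck is a negative condition: the deadlock case rests on `pad-↝⁻`, that padded moves
    -- come from unpadded ones.
    pad-⇝ : ∀ {d C π Δ} → Spineᶜ d C → C ⇝[ π ] Δ → padᶜ d C ⇝[ routeᴵ d π ] mapᵂ (padᶜ d) Δ
    pad-⇝ {C = ⟪ _ , _ , _ ⟫} sp (move s)               = move (pad-↝ sp s)
    pad-⇝ {C = ⟪ _ , _ , _ ⟫} {π} sp (deadlock stuck)   = deadlock λ Ξ s → stuck _ (proj₁ (proj₂ (pad-↝⁻ π sp s)))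
    pad-⇝ {C = ⊥}             sp (deadlock stuck)       = deadlock λ Ξ ()

    pad-⇝⁻ : ∀ {d C} π {Ξ} → Spineᶜ d C → padᶜ d C ⇝[ routeᴵ d π ] Ξ → ∃[ Δ ] (C ⇝[ π ] Δ × Ξ ≡ mapᵂ (padᶜ d) Δ)
    pad-⇝⁻ {C = ⟪ _ , _ , _ ⟫} π sp (move s) with pad-↝⁻ π sp s
    ... | Δ , s′ , eq = Δ , move s′ , eq
    pad-⇝⁻ {C = ⟪ _ , _ , _ ⟫} π sp (deadlock stuck) = _ , deadlock (λ Δ s → stuck _ (pad-↝ sp s)) , refl
    pad-⇝⁻ {C = ⊥} π sp (deadlock _) = _ , deadlock (λ Δ ()) , refl

    -- Parts of weight zero may start from configurations outside the support of X, of which neither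
    -- a spine nor a padded shape is known; they are dropped before the parts are treated one by
    -- one.
    nonzero-parts : ∀ {A : Set} → Weighted A → Weighted A
    nonzero-parts []            = []
    nonzero-parts ((w , a) ∷ Δ) with em₀ {w ≡ 0ℝ}
    ... | yes _ = nonzero-parts Δ
    ... | no _  = (w , a) ∷ nonzero-parts Δ

    nonzero-≋ : ∀ {A : Set} (Δ : Weighted A) → nonzero-parts Δ ≋ Δ
    nonzero-≋ []            f = refl
    nonzero-≋ ((w , a) ∷ Δ) f with em₀ {w ≡ 0ℝ}
    ... | yes refl = trans (nonzero-≋ Δ f) (trans (sym (+-identityˡ _)) (cong (_+ expectation f Δ) (sym (zeroˡ _))))
    ... | no _     = cong (w * f a +_) (nonzero-≋ Δ f)

    nonzero-All : ∀ {A : Set} {Q : ℝ × A → Set} {Δ} → All Q Δ → All (λ (w , a) → w ≢ 0ℝ × Q (w , a)) (nonzero-parts Δ)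
    nonzero-All [] = []
    nonzero-All {Δ = (w , _) ∷ _} (q ∷ qs) with em₀ {w ≡ 0ℝ}
    ... | yes _  = nonzero-All qs
    ... | no w≢0 = (w≢0 , q) ∷ nonzero-All qs

    record Steps (X : Dist N) (π : Index) (Y : Dist N) : Set where
      field
        steps   : Transitions {N}
        nonneg  : Nonneg steps
        moves   : Moves π steps
        nonzero : All (λ (w , _) → w ≢ 0ℝ) steps
        source  : X ≋ mapᵂ proj₁ steps
        target  : Y ≋ bind steps

    nonzero-steps : ∀ {X π Y} → X ⟿[ π ] Y → Steps X π Y
    nonzero-steps {X} {π} {Y} s = record
      { steps = nonzero-parts parts
      ; nonneg = All.map proj₂ (nonzero-All nonneg)
      ; moves = All.map proj₂ (nonzero-All moves)
      ; nonzero = All.map proj₁ (nonzero-All nonneg)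
      ; source = λ f → trans (source f) (trans (expectation-mapᵂ f proj₁ parts)
          (trans (sym (nonzero-≋ parts (f ∘ proj₁))) (sym (expectation-mapᵂ f proj₁ (nonzero-parts parts)))))
      ; target = λ f → trans (target f) (trans (expectation-bind f parts)
          (trans (sym (nonzero-≋ parts _)) (sym (expectation-bind f (nonzero-parts parts))))) }
      where open _⟿[_]_ s

    module _ {X : Dist N} {π : Index} {Y : Dist N} (st : Steps X π Y) where
      open Steps st

      sources-satisfy : ∀ {Q} → Supported Q X → All (λ (_ , C , _) → Q C) steps
      sources-satisfy q = All.zipWith (λ (w≢0 , h) → h w≢0)
        (nonzero , mapᵂ-supported⁻ {g = proj₁} (supported-≋ (mapᵂ-nonneg proj₁ nonneg) (≋-sym {Δ = X} {mapᵂ proj₁ steps} source) q))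

    padᵗ : ℕ → Transitions {N} → Transitions {N}
    padᵗ d = mapᵂ λ (C , Ξ) → padᶜ d C , mapᵂ (padᶜ d) Ξ

    padᵗ-source : ∀ d L → mapᵂ proj₁ (padᵗ d L) ≋ mapᵂ (padᶜ d) (mapᵂ proj₁ L)
    padᵗ-source d L = ≡⇒≋ (trans (mapᵂ-∘ proj₁ _ L) (sym (mapᵂ-∘ (padᶜ d) proj₁ L)))

    padᵗ-bind : ∀ d L → bind (padᵗ d L) ≋ mapᵂ (padᶜ d) (bind L)
    padᵗ-bind d L f = begin
      expectation f (bind (padᵗ d L))                                           ≡⟨ expectation-bind f (padᵗ d L) ⟩
      expectation (λ (_ , Ξ) → expectation f Ξ) (padᵗ d L)                      ≡⟨ expectation-mapᵂ _ _ L ⟩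
      expectation (λ (_ , Ξ) → expectation f (mapᵂ (padᶜ d) Ξ)) L               ≡⟨ expectation-cong (λ (_ , Ξ) → expectation-mapᵂ f (padᶜ d) Ξ) L ⟩
      expectation (λ (_ , Ξ) → expectation (f ∘ padᶜ d) Ξ) L                    ≡⟨ expectation-bind (f ∘ padᶜ d) L ⟨
      expectation (f ∘ padᶜ d) (bind L)                                         ≡⟨ expectation-mapᵂ f (padᶜ d) (bind L) ⟨
      expectation f (mapᵂ (padᶜ d) (bind L))                                    ∎
      where open ≡-Reasoning

    steps-spine : ∀ {d π} {L : Transitions {N}} → All (λ (_ , C , _) → Spineᶜ d C) L → Moves π L → Supported (Spineᶜ d) (bind L)
    steps-spine sp mv = bind-supported (All.zipWith (λ (sp , m) _ → All.map (λ s _ → s) (⇝-spine sp m)) (sp , mv))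

    pad-⟿ : ∀ {d π} {X Y : Dist N} → Supported (Spineᶜ d) X → X ⟿[ π ] Y →
            mapᵂ (padᶜ d) X ⟿[ routeᴵ d π ] mapᵂ (padᶜ d) Y × Supported (Spineᶜ d) Y
    pad-⟿ {d} {π} {X} {Y} sp s = record
      { parts = padᵗ d steps
      ; nonneg = mapᵂ-nonneg _ nonneg
      ; moves = Allₚ.map⁺ (All.zipWith (λ (sp , m) → pad-⇝ sp m) (sources-spine , moves))
      ; source = λ f → trans (mapᵂ-≋ (padᶜ d) {X} {mapᵂ proj₁ steps} source f) (sym (padᵗ-source d steps f))
      ; isDistribution = mapᵂ-isDistribution (padᶜ d) (_⟿[_]_.isDistribution s)
      ; target = λ f → trans (mapᵂ-≋ (padᶜ d) {Y} {bind steps} target f) (sym (padᵗ-bind d steps f))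
      } , supported-≋ {Δ = Y} {bind steps} (proj₁ (_⟿[_]_.isDistribution s)) target (steps-spine sources-spine moves)
      where
      st = nonzero-steps s
      open Steps st
      sources-spine = sources-satisfy st sp

    -- The sources of s are only equivalent to the padded X, but each source of nonzero weight lies
    -- in its support and so is a padded configuration, which allows every part to be unpadded
    -- separately.
    pad-⟿⁻ : ∀ {d Θ} π {X Y : Dist N} → Θ ⊢ᵈ X → Supported (Spineᶜ d) X → mapᵂ (padᶜ d) X ⟿[ routeᴵ d π ] Y →
             ∃[ Y′ ] (X ⟿[ π ] Y′ × Supported (Spineᶜ d) Y′ × mapᵂ (padᶜ d) Y′ ≋ Y)
    pad-⟿⁻ {d} π {X} {Y} ⊢X sp s with unpad-steps (sources-satisfy st sources) moves
      where
      st = nonzero-steps s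
      open Steps st
      Padded : Conf N → Set
      Padded C̃ = ∃[ C ] (C̃ ≡ padᶜ d C × Spineᶜ d C)
      sources : Supported Padded (mapᵂ (padᶜ d) X)
      sources = mapᵂ-supported (supported-map (λ {C} sp → C , refl , sp) sp)
      unpad-steps : ∀ {L} → All (λ (_ , C̃ , _) → Padded C̃) L → Moves (routeᴵ d π) L →
                    ∃[ L′ ] (L ≡ padᵗ d L′ × All (λ (_ , C , _) → Spineᶜ d C) L′ × Moves π L′)
      unpad-steps [] [] = [] , refl , [] , []
      unpad-steps ((C , refl , sp) ∷ ps) (m ∷ ms) with pad-⇝⁻ π sp m | unpad-steps ps ms
      ... | Δ , m′ , refl | L′ , refl , sps , ms′ = (_ , C , Δ) ∷ L′ , refl , sp ∷ sps , m′ ∷ ms′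
    ... | L , eq , sps , ms = bind L , bind-⟿ L ⊢X 0≤L ms source′ , steps-spine sps ms ,
      λ f → sym (trans (target f) (trans (cong (λ L → expectation f (bind L)) eq) (padᵗ-bind d L f)))
      where
      open Steps (nonzero-steps s)
      0≤L : Nonneg L
      0≤L = Allₚ.map⁻ (≡.subst Nonneg eq nonneg)
      -- Every test function f factors through `padᶜ d` as `f ∘ unpadᶜ d`, so the equivalence of the
      -- padded sources reflects to the unpadded ones.
      source′ : X ≋ mapᵂ proj₁ L
      source′ f = begin
        expectation f X                                                     ≡⟨ expectation-cong (λ C → cong f (sym (unpadᶜ-padᶜ d C))) X ⟩
        expectation (f ∘ unpadᶜ d ∘ padᶜ d) X                               ≡⟨ expectation-mapᵂ (f ∘ unpadᶜ d) (padᶜ d) X ⟨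
        expectation (f ∘ unpadᶜ d) (mapᵂ (padᶜ d) X)                        ≡⟨ source (f ∘ unpadᶜ d) ⟩
        expectation (f ∘ unpadᶜ d) (mapᵂ proj₁ steps)                       ≡⟨ cong (λ L → expectation (f ∘ unpadᶜ d) (mapᵂ proj₁ L)) eq ⟩
        expectation (f ∘ unpadᶜ d) (mapᵂ proj₁ (padᵗ d L))                  ≡⟨ padᵗ-source d L (f ∘ unpadᶜ d) ⟩
        expectation (f ∘ unpadᶜ d) (mapᵂ (padᶜ d) (mapᵂ proj₁ L))           ≡⟨ expectation-mapᵂ (f ∘ unpadᶜ d) (padᶜ d) (mapᵂ proj₁ L) ⟩
        expectation (f ∘ unpadᶜ d ∘ padᶜ d) (mapᵂ proj₁ L)                  ≡⟨ expectation-cong (λ C → cong f (unpadᶜ-padᶜ d C)) (mapᵂ proj₁ L) ⟩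
        expectation f (mapᵂ proj₁ L)                                        ∎
        where open ≡-Reasoning

  -- Transfer of typing, barbs and bisimilarity from padded observers

  module _ {N : ℕ} where
    -- A well-typed `nil` lists every qubit that it owns, so the inserted `𝟎` owns none and removing
    -- it leaves the type unchanged.
    pad-typed⁻ : ∀ d {Θ : Subset N} R → Θ ⊩ pad d R → Θ ⊩ R
    pad-typed⁻ ℕ.zero {Θ} R (par Θ₁ Θ₂ eq _ ⌊ nil [] _ _ complete ⌋ ⊢R) = ≡.subst (_⊩ R) (sym Θ≡Θ₂) ⊢R
      where
      Θ₁≡∅ : Θ₁ ≡ ∅
      Θ₁≡∅ = Subsetₚ.Empty-unique λ (x , x∈Θ₁) → case-[] (complete x x∈Θ₁)
        where
        case-[] : ∀ {x : Fin N} → ¬ (x ∈ˡ [])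
        case-[] ()
      Θ≡Θ₂ : Θ ≡ Θ₂
      Θ≡Θ₂ = trans eq (trans (cong (_∪ Θ₂) Θ₁≡∅) (Subsetₚ.∪-identityˡ Θ₂))
    pad-typed⁻ (ℕ.suc d) (R ∥ S) (par Θ₁ Θ₂ eq dis ⊢R ⊢S) = par Θ₁ Θ₂ eq dis (pad-typed⁻ d R ⊢R) ⊢S
    pad-typed⁻ (ℕ.suc d) ⌊ K ⌋        ⊢R = ⊢R
    pad-typed⁻ (ℕ.suc d) (R ∖ c)      ⊢R = ⊢R
    pad-typed⁻ (ℕ.suc d) (cond e R S) ⊢R = ⊢R

    pad-observer⁻ : ∀ d (R : Proc N) → IsObserver (pad d R) → IsObserver R
    pad-observer⁻ ℕ.zero    R            (_ ∥ obs)    = obs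
    pad-observer⁻ (ℕ.suc d) (R ∥ S)      (obs ∥ obs′) = pad-observer⁻ d R obs ∥ obs′
    pad-observer⁻ (ℕ.suc d) ⌊ K ⌋        obs          = obs
    pad-observer⁻ (ℕ.suc d) (R ∖ c)      obs          = obs
    pad-observer⁻ (ℕ.suc d) (cond e R S) obs          = obs

    padᶜ-typed⁻ : ∀ d {Θ : Subset N} C → Θ ⊢ᶜ padᶜ d C → Θ ⊢ᶜ C
    padᶜ-typed⁻ d ⟪ ρ , P , R ⟫ (conf Θ₁ Θ₂ eq dis δ ⊢P ⊢R obs) =
      conf Θ₁ Θ₂ eq dis δ ⊢P (pad-typed⁻ d R ⊢R) (pad-observer⁻ d R obs)
    padᶜ-typed⁻ d ⊥ ⊥ = ⊥

    padᵈ-typed⁻ : ∀ d {Θ : Subset N} Δ → Θ ⊢ᵈ mapᵂ (padᶜ d) Δ → Θ ⊢ᵈ Δ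
    padᵈ-typed⁻ d Δ (dist , ⊢Δ) =
      isDistribution (Allₚ.map⁻ (proj₁ dist)) (trans (sym (expectation-mapᵂ (λ _ → 1ℝ) (padᶜ d) Δ)) (distribution-total dist)) ,
      supported-map (λ {C} → padᶜ-typed⁻ d C) (mapᵂ-supported⁻ {g = padᶜ d} ⊢Δ)

    pad-↓ : ∀ d {c} (R : Proc N) → R ↓ c → pad d R ↓ c
    pad-↓ ℕ.zero    R            (v , P′ , s)      = v , _ , parʳ s
    pad-↓ (ℕ.suc d) (R ∥ S)      (v , _ , parˡ s)  = let v′ , _ , s′ = pad-↓ d R (v , _ , s) in v′ , _ , parˡ s′
    pad-↓ (ℕ.suc d) (R ∥ S)      (v , _ , parʳ s)  = v , _ , parʳ s
    pad-↓ (ℕ.suc d) ⌊ K ⌋        b                 = b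
    pad-↓ (ℕ.suc d) (R ∖ c)      b                 = b
    pad-↓ (ℕ.suc d) (cond e R S) b                 = b

    pad-↓⁻ : ∀ d {c} (R : Proc N) → pad d R ↓ c → R ↓ c
    pad-↓⁻ ℕ.zero    R            (v , _ , parʳ s) = v , _ , s
    pad-↓⁻ (ℕ.suc d) (R ∥ S)      (v , _ , parˡ s) = let v′ , _ , s′ = pad-↓⁻ d R (v , _ , s) in v′ , _ , parˡ s′
    pad-↓⁻ (ℕ.suc d) (R ∥ S)      (v , _ , parʳ s) = v , _ , parʳ s
    pad-↓⁻ (ℕ.suc d) ⌊ K ⌋        b                = b
    pad-↓⁻ (ℕ.suc d) (R ∖ c)      b                = b
    pad-↓⁻ (ℕ.suc d) (cond e R S) b                = b

    pad-barb : ∀ d {c} (C : Conf N) → Barb c (padᶜ d C) ⇔ Barb c C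
    pad-barb d {c} C = mk⇔ (to C) (from C)
      where
      to : ∀ C → Barb c (padᶜ d C) → Barb c C
      to ⟪ _ , _ , R ⟫ (process b)  = process b
      to ⟪ _ , _ , R ⟫ (observer b) = observer (pad-↓⁻ d R b)
      from : ∀ C → Barb c C → Barb c (padᶜ d C)
      from ⟪ _ , _ , R ⟫ (process b)  = process b
      from ⟪ _ , _ , R ⟫ (observer b) = observer (pad-↓ d R b)

    pad-≡⊥ : ∀ d (C : Conf N) → padᶜ d C ≡ ⊥ ⇔ C ≡ ⊥
    pad-≡⊥ d ⟪ _ , _ , _ ⟫ = mk⇔ (λ ()) (λ ())
    pad-≡⊥ d ⊥             = mk⇔ (λ _ → refl) (λ _ → refl)

    pad-sameBarbs⁻ : ∀ d (X Y : Dist N) → SameBarbs (mapᵂ (padᶜ d) X) (mapᵂ (padᶜ d) Y) → SameBarbs X Y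
    pad-sameBarbs⁻ d X Y (b , b⊥) = sameBarbs {Δ = X} {Y}
      (λ c → transfer {Barb c} (pad-barb d) (weight-⇔⁻¹ {Δ = mapᵂ (padᶜ d) X} {mapᵂ (padᶜ d) Y} (b c)))
      (transfer {_≡ ⊥} (pad-≡⊥ d) (weight-⇔⁻¹ {Δ = mapᵂ (padᶜ d) X} {mapᵂ (padᶜ d) Y} b⊥))
      where
      transfer : ∀ {Q : Conf N → Set} → (∀ C → Q (padᶜ d C) ⇔ Q C) →
                 expectation (𝟙 Q) (mapᵂ (padᶜ d) X) ≡ expectation (𝟙 Q) (mapᵂ (padᶜ d) Y) →
                 expectation (𝟙 Q) X ≡ expectation (𝟙 Q) Y
      transfer {Q} Q⇔ eq = trans (pulled X) (trans eq (sym (pulled Y)))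
        where
        pulled : ∀ Z → expectation (𝟙 Q) Z ≡ expectation (𝟙 Q) (mapᵂ (padᶜ d) Z)
        pulled Z = trans (expectation-cong (λ C → cong (if_then 1ℝ else 0ℝ) (does-⇔ (⇔-sym (Q⇔ C)) em₀ em₀)) Z)
          (sym (expectation-mapᵂ (𝟙 Q) (padᶜ d) Z))

    -- One round of the bisimulation game with the context already plugged in; bisimilarity yields
    -- it for each context.
    record Match (Θ : Subset N) (X Y : Dist N) : Set₁ where
      field
        barbs : SameBarbs X Y
        forth : ∀ {π X′} → X ⟿[ π ] X′ → ∃[ Y′ ] (Y ⟿[ π ] Y′ × X′ ∼cs[ Θ ] Y′)
        back  : ∀ {π Y′} → Y ⟿[ π ] Y′ → ∃[ X′ ] (X ⟿[ π ] X′ × X′ ∼cs[ Θ ] Y′)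

    ∼⇒match : ∀ {Θ Θ′ R} {Δ₁ Δ₂ : Dist N} → Δ₁ ∼cs[ Θ ] Δ₂ → Context Θ Θ′ R → Match (Θ ∪ Θ′) (Δ₁ ‖ R) (Δ₂ ‖ R)
    ∼⇒match rel ctx = record { barbs = ∼-barbs rel ctx ; forth = ∼-forth rel ctx ; back = ∼-back rel ctx }

    -- Padding is compared after plugging a context, since 𝟎 ∥ (R ∥ S) is 𝟎 in the
    -- context R ∥ S whereas (𝟎 ∥ R) ∥ S is not; the initial distributions have d = 0.
    MatchPadded : TypedRel N
    MatchPadded Θ Δ₁ Δ₂ = Θ ⊢ᵈ Δ₁ × Θ ⊢ᵈ Δ₂ × ∃[ d ] (∀ {Θ′ R} → Context Θ Θ′ R →
      Supported (Spineᶜ d) (Δ₁ ‖ R) × Supported (Spineᶜ d) (Δ₂ ‖ R) ×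
      Squash (Match (Θ ∪ Θ′) (mapᵂ (padᶜ d) (Δ₁ ‖ R)) (mapᵂ (padᶜ d) (Δ₂ ‖ R))))

    -- The next context is plugged in outside the padded observer, which buries the padding one
    -- level deeper; hence `suc d`.
    ∼⇒matchPadded : ∀ d {Θ} {Δ₁ Δ₂ : Dist N} → Supported (Spineᶜ d) Δ₁ → Supported (Spineᶜ d) Δ₂ →
                    mapᵂ (padᶜ d) Δ₁ ∼cs[ Θ ] mapᵂ (padᶜ d) Δ₂ → MatchPadded Θ Δ₁ Δ₂
    ∼⇒matchPadded d {Δ₁ = Δ₁} {Δ₂} sp₁ sp₂ rel = padᵈ-typed⁻ d Δ₁ (∼-typedˡ rel) , padᵈ-typed⁻ d Δ₂ (∼-typedʳ rel) , ℕ.suc d ,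
      λ {Θ′} {R} ctx → mapᵂ-supported (supported-map (λ {C} → spineᶜ-plug {C = C}) sp₁) , mapᵂ-supported (supported-map (λ {C} → spineᶜ-plug {C = C}) sp₂) ,
        squash (≡.subst₂ (Match _) (sym (padᶜ-‖ d R Δ₁)) (sym (padᶜ-‖ d R Δ₂)) (∼⇒match rel ctx))

    matchPadded-isBisimulation : IsBisimulation MatchPadded
    matchPadded-isBisimulation = record
      { typed = λ (⊢Δ₁ , ⊢Δ₂ , _) → ⊢Δ₁ , ⊢Δ₂
      ; barbs = λ {Δ₁ = Δ₁} {Δ₂} (_ , _ , d , match) Θ′ R ctx →
          pad-sameBarbs⁻ d (Δ₁ ‖ R) (Δ₂ ‖ R) (Match.barbs (unsquash (proj₂ (proj₂ (match ctx)))))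
      ; forth = λ (⊢Δ₁ , ⊢Δ₂ , d , match) Θ′ R ctx π Δ₁′ s →
          let sp₁ , sp₂ , m = match ctx
              s̃ , sp₁′ = pad-⟿ sp₁ s
              Ỹ , t̃ , rel = Match.forth (unsquash m) s̃
              Δ₂′ , t , sp₂′ , eq = pad-⟿⁻ π (‖-typed ctx ⊢Δ₂) sp₂ t̃
          in Δ₂′ , t , ∼⇒matchPadded d sp₁′ sp₂′ (∼-respʳ-≋ (mapᵂ-isDistribution (padᶜ d) (_⟿[_]_.isDistribution t)) eq rel)
      ; back = λ (⊢Δ₁ , ⊢Δ₂ , d , match) Θ′ R ctx π Δ₂′ s →
          let sp₁ , sp₂ , m = match ctx
              s̃ , sp₂′ = pad-⟿ sp₂ s
              Ỹ , t̃ , rel = Match.back (unsquash m) s̃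
              Δ₁′ , t , sp₁′ , eq = pad-⟿⁻ π (‖-typed ctx ⊢Δ₁) sp₁ t̃
          in Δ₁′ , t , ∼⇒matchPadded d sp₁′ sp₂′ (∼-respˡ-≋ (mapᵂ-isDistribution (padᶜ d) (_⟿[_]_.isDistribution t)) eq rel)
      }

  -- Convex combinations of density operators and conclusion

  module _ {d : ℕ} {p : ℝ} (0≤p : 0ℝ ≤ p) (p≤1 : p ≤ 1ℝ) where
    mix-density : ∀ (ρ σ : Matrix d) → IsDensity ρ → IsDensity σ → IsDensity (p ·ᴹ ρ +ᴹ (1ℝ + - p) ·ᴹ σ)
    mix-density ρ σ (psd-ρ , tr-ρ) (psd-σ , tr-σ) = psd , tr
      where
      open ℝ-Solver
      q = 1ℝ + - p
      psd : PositiveSemidefinite (p ·ᴹ ρ +ᴹ q ·ᴹ σ)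
      psd v = ≡.subst (λ z → im z ≡ 0ℝ × 0ℝ ≤ re z) (sym (Mat.form-·+· (ι p) (ι q) ρ σ (conj ∘ lookup v) (lookup v)))
        ( trans (cong₂ _+_ (trans (im-ι* p ⟨ v ∣ ρ ∣ v ⟩) (trans (cong (p *_) (proj₁ (psd-ρ v))) (zeroʳ p)))
                           (trans (im-ι* q ⟨ v ∣ σ ∣ v ⟩) (trans (cong (q *_) (proj₁ (psd-σ v))) (zeroʳ q)))) (+-identityˡ 0ℝ)
        , +-nonneg (≡.subst (0ℝ ≤_) (sym (re-ι* p ⟨ v ∣ ρ ∣ v ⟩)) (*-nonneg 0≤p (proj₂ (psd-ρ v))))
                   (≡.subst (0ℝ ≤_) (sym (re-ι* q ⟨ v ∣ σ ∣ v ⟩)) (*-nonneg (x≤y⇒0≤y-x p≤1) (proj₂ (psd-σ v)))))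
      tr : trace (p ·ᴹ ρ +ᴹ q ·ᴹ σ) ≡ 1ᶜ
      tr = trans (Mat.trace-·+· (ι p) (ι q) ρ σ) (trans (cong₂ (λ x y → ι p *ᶜ x +ᶜ ι q *ᶜ y) tr-ρ tr-σ)
        (trans (cong₂ _+ᶜ_ (ℂᵣ.*-identityʳ (ι p)) (ℂᵣ.*-identityʳ (ι q)))
          (trans (sym (ι-+ p q)) (cong ι (solve 1 (λ p → p :+ (con (ℤ.+ 1) :+ :- p) := con (ℤ.+ 1)) refl p)))))

  module _ {N : ℕ} {p : ℝ} (0≤p : 0ℝ ≤ p) (p≤1 : p ≤ 1ℝ) {Θ : Subset N} {P : Proc N} (⊢P : Θ ⊩ P) (det : Deterministic Θ P)
           {ρ σ : State N} (δ-ρ : IsDensity ρ) (δ-σ : IsDensity σ) where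
    private
      τ : State N
      τ = p ·ᴹ ρ +ᴹ (1ℝ + - p) ·ᴹ σ

      initial : Fin 3 → State N
      initial Fin.zero               = ρ
      initial (Fin.suc Fin.zero)     = σ
      initial (Fin.suc (Fin.suc _))  = τ

      initial-density : ∀ x → IsDensity (initial x)
      initial-density Fin.zero              = δ-ρ
      initial-density (Fin.suc Fin.zero)    = δ-σ
      initial-density (Fin.suc (Fin.suc _)) = mix-density 0≤p p≤1 ρ σ δ-ρ δ-σ

      item : Item {Fin 3} {N}
      item = (λ _ → 1ℝ) , initial , just (P , 𝟎)

      item-balanced : BalancedItem 0≤p p≤1 item
      item-balanced = balanced
        (solve 1 (λ p → p :* con (ℤ.+ 1) :+ (con (ℤ.+ 1) :+ :- p) :* con (ℤ.+ 1) := con (ℤ.+ 1)) refl p)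
        (trans (cong₂ (λ a b → a ·ᴹ ρ +ᴹ b ·ᴹ σ) (*-identityʳ p) (*-identityʳ (1ℝ + - p))) (sym (Mat.·-identity τ)))
        where open ℝ-Solver

    convex-𝟎 : mix p (point ⟪ ρ , P , 𝟎 ⟫) (point ⟪ σ , P , 𝟎 ⟫) ∼cs[ Θ ] point ⟪ τ , P , 𝟎 ⟫
    convex-𝟎 = balanced-∼ 0≤p p≤1 (λ x → proj₁ (det (initial x) (initial-density x))) (λ x → proj₁ (proj₂ (det (initial x) (initial-density x))))
      (item-balanced ∷ []) (λ x → proj₂ (proj₂ (det (initial x) (initial-density x))))

    convex : ∀ {Θ′ R} → IsObserver R → Θ′ ⊩ R → Θ ∩ Θ′ ≡ ∅ →
             mix p (point ⟪ ρ , P , R ⟫) (point ⟪ σ , P , R ⟫) ∼cs[ Θ ∪ Θ′ ] point ⟪ τ , P , R ⟫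
    convex {Θ′} {R} obs ⊢R disj = MatchPadded , matchPadded-isBisimulation ,
      mix-typed 0≤p p≤1 (point-typed δ-ρ) (point-typed δ-σ) , point-typed (mix-density 0≤p p≤1 ρ σ δ-ρ δ-σ) , 0 ,
      λ {Θ″} {S} ctx → spines (mix p (point ⟪ ρ , P , R ⟫) (point ⟪ σ , P , R ⟫) ‖ S) , spines (point ⟪ τ , P , R ⟫ ‖ S) ,
        -- At depth 0 the padded observer is `𝟎 ∥ (R ∥ S)`, which is also `𝟎` in the context
        -- `R ∥ S`, so one round of `convex-𝟎` in that context is what is asked; associativity
        -- aligns the types.
        squash (≡.subst (λ Θ → Match Θ _ _) (sym (Subsetₚ.∪-assoc Θ Θ′ Θ″)) (∼⇒match convex-𝟎 (∥-context obs ⊢R disj ctx)))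
      where
      point-typed : ∀ {s} → IsDensity s → Θ ∪ Θ′ ⊢ᵈ point ⟪ s , P , R ⟫
      point-typed δ = point-isDistribution _ , (λ _ → conf Θ Θ′ refl disj δ ⊢P ⊢R obs) ∷ []
      spines : ∀ Δ → Supported (Spineᶜ 0) Δ
      spines = All.universal λ (_ , C) _ → spineᶜ-zero C

theorem4p8 : ExcludedMiddle (suc 0ℓ) →
    (reals : RealNumbers) → let open LqCCS reals in
    (N : ℕ) (Θ : Subset N) (P : Proc N) → Θ ⊩ P → Deterministic Θ P →
    (ρ σ : State N) → IsDensity ρ → IsDensity σ →
    (p : ℝ) → 0ℝ ≤ p → p ≤ 1ℝ →
    (Θ′ : Subset N) (R : Proc N) → IsObserver R → Θ′ ⊩ R → Θ ∩ Θ′ ≡ ∅ →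
    mix p (point ⟪ ρ , P , R ⟫) (point ⟪ σ , P , R ⟫)
    ∼cs[ Θ ∪ Θ′ ]
    point ⟪ (p ·ᴹ ρ) +ᴹ ((1ℝ + - p) ·ᴹ σ) , P , R ⟫
theorem4p8 em reals N Θ P ⊢P det ρ σ δ-ρ δ-σ p 0≤p p≤1 Θ′ R obs ⊢R disj =
  Classical.convex em reals 0≤p p≤1 ⊢P det δ-ρ δ-σ obs ⊢R disj
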